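{- There is a polynomial-time $3$-approximation algorithm for the colorful $k$-center problem. That is, there is a polynomial-time algorithm which, given an instance $(P, d, R, B, k, r, b)$ of colorful $k$-center that has a feasible solution, outputs a set $C \subseteq P$ with $|C| \le k$ such that $\bigcup_{c \in C} \mathcal{B}(c, 3\rho^*)$ contains at least $r$ red points and at least $b$ blue points, where $\rho^*$ is the optimal radius of the instance.
   Context: An instance of colorful $k$-center consists of a finite set $P$ of $n$ points with a metric $d$ on $P$, a partition $P = R \cup B$ into red points $R$ and blue points $B$, and integers $k, r, b \ge 0$. For $j \in P$ and $\rho \ge 0$, $\mathcal{B}(j,\rho) = \{p \in P : d(j,p) \le \rho\}$. A solution of radius $\rho$ is a set $C \subseteq P$ with $|C| \le k$ such that $\bigcup_{c\in C}\mathcal{B}(c,\rho)$ contains at least $r$ points of $R$ and at least $b$ points of $B$. The optimal radius $\rho^*$ is the minimum $\rho$ for which a solution of radius $\rho$ exists.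
   Formalization: The metric d takes rational values (given as numerator and denominator in the input), and the radii ρ, including the optimal radius ρ*, range over the rationals. -}

module Defs where

open import Data.Bool.Base using (if_then_else_)
open import Data.Fin.Base using (Fin; toℕ)
open import Data.Fin.Subset using (Subset; _∩_; ∁; ⋃; ∣_∣)
open import Data.Fin.Subset.Properties using (_∈?_)
open import Data.Integer.Base as ℤ using (+_)
open import Data.List.Base using (List; []; _∷_; _++_; map; concatMap; allFin; filter)
open import Data.Nat.Base using (ℕ; zero; suc; _+_; _∸_; _*_; _^_; _≤_)
open import Data.Nat.DivMod using (_/_)
open import Data.Nat.ListAction using (sum)
open import Data.Nat.Logarithm using (⌊log₂_⌋)
open import Data.Nat.Properties using (_≟_)
open import Data.Product.Base using (_×_; _,_; ∃; ∃-syntax)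
open import Data.Rational.Base as ℚ using (ℚ; 0ℚ; ↥_; ↧ₙ_)
open import Data.Rational.Properties using () renaming (_≤?_ to _≤ℚ?_)
open import Data.Vec.Base using (tabulate)
open import Function.Metric.Rational using (IsMetric)
open import Relation.Binary.PropositionalEquality.Core using (_≡_; _≢_)
open import Relation.Nullary.Decidable using (does; _×-dec_; ¬?)

------------------------------------------------------------------------
-- Colorful k-center

-- The points are those of Fin n.  Distances are rational, so that an
-- instance is a finite input.
record Instance : Set where
  field
    n        : ℕ
    d        : Fin n → Fin n → ℚ
    isMetric : IsMetric _≡_ d
    R        : Subset n
    k r b    : ℕ

  B : Subset n
  B = ∁ R

  ball : Fin n → ℚ → Subset n
  ball j ρ = tabulate λ p → does (d j p ≤ℚ? ρ)

  covered : Subset n → ℚ → Subset n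
  covered C ρ = ⋃ (map (λ c → ball c ρ) (filter (_∈? C) (allFin n)))

  IsSolution : ℚ → Subset n → Set
  IsSolution ρ C =
    ∣ C ∣ ≤ k × r ≤ ∣ covered C ρ ∩ R ∣ × b ≤ ∣ covered C ρ ∩ B ∣

  Achievable : ℚ → Set
  Achievable ρ = 0ℚ ℚ.≤ ρ × ∃[ C ] IsSolution ρ C

  Feasible : Set
  Feasible = ∃[ ρ ] Achievable ρ

  IsOptimalRadius : ℚ → Set
  IsOptimalRadius ρ* = Achievable ρ* × (∀ ρ → Achievable ρ → ρ* ℚ.≤ ρ)

------------------------------------------------------------------------
-- Random access machines with the logarithmic cost criterion
--
-- Memory consists of arrays of natural numbers of arbitrary size.  Array
-- names are literals of the program text, so a program uses only a fixed
-- finite number of arrays; indices into an array are computed.  Every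
-- operation is charged the binary length of all the numbers it handles,
-- addresses included, so the total length of the stored numbers grows by
-- at most the cost spent, and cost agrees with Turing machine time up to
-- a polynomial.

data Op : Set where
  add sub mul div : Op

data Expr : Set where
  lit : ℕ → Expr
  get : ℕ → Expr → Expr
  op  : Op → Expr → Expr → Expr

infixr 5 _⨾_

data Program : Set where
  skip  : Program
  set   : ℕ → Expr → Expr → Program
  _⨾_   : Program → Program → Program
  cond  : Expr → Program → Program → Program
  while : Expr → Program → Program

Store : Set
Store = ℕ → ℕ → ℕ

bits : ℕ → ℕ
bits m = suc ⌊log₂ m ⌋

-- Subtraction is truncated, and division by zero gives zero.
apply : Op → ℕ → ℕ → ℕ
apply add x y       = x + y
apply sub x y       = x ∸ y
apply mul x y       = x * y
apply div x zero    = 0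
apply div x (suc y) = x / suc y

eval : Expr → Store → ℕ
eval (lit v)    σ = v
eval (get x e)  σ = σ x (eval e σ)
eval (op o e f) σ = apply o (eval e σ) (eval f σ)

cost : Expr → Store → ℕ
cost (lit v)    σ = bits v
cost (get x e)  σ = cost e σ + bits (eval e σ) + bits (eval (get x e) σ)
cost (op o e f) σ = cost e σ + cost f σ + bits (eval e σ) + bits (eval f σ)

update : Store → ℕ → ℕ → ℕ → Store
update σ x i v y j =
  if does ((y ≟ x) ×-dec (j ≟ i)) then v else σ y j

-- ⟨ P , σ ⟩⇓ τ ∶ t : started in store σ, the program P halts in store τ
-- after time t; τ and t are determined by P and σ.  A test succeeds when
-- its value is nonzero.
infix 4 ⟨_,_⟩⇓_∶_

data ⟨_,_⟩⇓_∶_ : Program → Store → Store → ℕ → Set where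
  ⇓skip : ∀ {σ} → ⟨ skip , σ ⟩⇓ σ ∶ 1

  ⇓set : ∀ {σ x e f} →
    ⟨ set x e f , σ ⟩⇓ update σ x (eval e σ) (eval f σ)
      ∶ cost e σ + cost f σ + bits (eval e σ) + bits (eval f σ)

  ⇓seq : ∀ {P Q σ τ υ s t} →
    ⟨ P , σ ⟩⇓ τ ∶ s → ⟨ Q , τ ⟩⇓ υ ∶ t → ⟨ P ⨾ Q , σ ⟩⇓ υ ∶ s + t

  ⇓then : ∀ {e P Q σ τ t} → eval e σ ≢ 0 →
    ⟨ P , σ ⟩⇓ τ ∶ t → ⟨ cond e P Q , σ ⟩⇓ τ ∶ cost e σ + t

  ⇓else : ∀ {e P Q σ τ t} → eval e σ ≡ 0 →
    ⟨ Q , σ ⟩⇓ τ ∶ t → ⟨ cond e P Q , σ ⟩⇓ τ ∶ cost e σ + t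

  ⇓stop : ∀ {e P σ} → eval e σ ≡ 0 →
    ⟨ while e P , σ ⟩⇓ σ ∶ cost e σ

  ⇓loop : ∀ {e P σ τ υ s t} → eval e σ ≢ 0 →
    ⟨ P , σ ⟩⇓ τ ∶ s → ⟨ while e P , τ ⟩⇓ υ ∶ t →
    ⟨ while e P , σ ⟩⇓ υ ∶ cost e σ + s + t

nth : List ℕ → ℕ → ℕ
nth []       i       = 0
nth (w ∷ ws) zero    = w
nth (w ∷ ws) (suc i) = nth ws i

-- The input is in array 0 and everything else is zero.
initial : List ℕ → Store
initial ws zero    i = nth ws i
initial ws (suc x) i = 0

-- The output is read off array 1.
outputSet : ∀ n → Store → Subset n
outputSet n σ = tabulate λ i → does (¬? (σ 1 (toℕ i) ≟ 0))

size : List ℕ → ℕ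
size ws = sum (map bits ws)

PolynomialTime : {A : Set} → (A → List ℕ) → Program → Set
PolynomialTime {A} encode P =
  ∃[ a ] ∃[ e ] ∀ (x : A) →
    ∃[ τ ] ∃[ t ] ⟨ P , initial (encode x) ⟩⇓ τ ∶ t
                × t ≤ a * size (encode x) ^ e + a

------------------------------------------------------------------------
-- Algorithms for colorful k-center

-- n, k, r, b, then for each point 1 if it is red and 0 if it is blue,
-- then the n × n distance matrix row by row, each (nonnegative) entry
-- being given by its numerator and denominator in lowest terms.
encode : Instance → List ℕ
encode I = n ∷ k ∷ r ∷ b ∷ map colour (allFin n) ++ concatMap row (allFin n)
  where
  open Instance I

  colour : Fin n → ℕ
  colour p = if does (p ∈? R) then 1 else 0

  row : Fin n → List ℕ
  row i = concatMap (λ j → ℤ.∣ ↥ d i j ∣ ∷ ↧ₙ d i j ∷ []) (allFin n)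

Outputs : Program → (I : Instance) → Subset (Instance.n I) → Set
Outputs P I C =
  ∃[ τ ] ∃[ t ] ⟨ P , initial (encode I) ⟩⇓ τ ∶ t
              × outputSet (Instance.n I) τ ≡ C

-- The optimal radius of a feasible instance exists and is unique, so
-- "∃ ρ*" only names it.
IsApproximation : ℕ → Program → Set
IsApproximation α P = ∀ (I : Instance) → let open Instance I in
  Feasible →
  ∃[ C ] Outputs P I C ×
  ∃[ ρ* ] IsOptimalRadius ρ* × IsSolution ((+ α ℚ./ 1) ℚ.* ρ*) C

{-# OPTIONS --safe #-}
module Submission where

-- Guess the optimal radius ρ; the balls of radius ρ are the neighbourhoods
-- N[p] of a graph, and a set covered by radius 3ρ is one within three hops.
-- If two optimal balls lie within two hops of a point j, then j serves both
-- of them and a center is saved.  Otherwise the optimal balls are far apart.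
-- Three times, an optimal ball N[o] is then replaced by the flower N[N[q]] of
-- a point q of N[o] gaining as many red points beyond N[o] as possible; with
-- τ the last gain, this wins 3τ red points, and all other gains are at most τ.
-- Consequently a dense ball N[g], one with more than 2τ remaining red points,
-- comes with a region within three hops of g which is disjoint from every
-- optimal ball that it does not contain.  These regions are split off; in the
-- rest, the optimum covers only points with at most 3τ red points in their
-- flower.
--
-- There a fractional solution z is found by the relaxation method.  Greedy
-- clustering by decreasing z yields centers no two of which lie in a common
-- ball, so the mass of z on them must not exceed the number of optimal balls.
-- Each violated constraint is repaired by a unit step, which decreases the
-- squared distance to the optimum.  Rounding the masses of the clusters costs
-- no blue points and fewer red points than one unselected cluster has; the
-- saved center or the 3τ red points make up for it.  Regions and clusters are
-- disjoint, so the right selection is found by a knapsack over their sizes.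
-- All remaining parameters are guessed, and each candidate is checked.
--
-- The program is compiled from a language of bounded loops.  It multiplies
-- only by inputs and by polynomials in n, so stored numbers grow in length by
-- a bounded amount per step, and polynomially many steps take polynomial time.

-- The constants balance one account. Rounding may lose the red points of one cluster, and a cluster
-- lies in the flower of one light point. When no ball with more than `2τ` remaining red points is
-- left, a point covered by an optimal ball has at most `2τ` of them in that ball and at most `τ` in
-- the rest of its flower, as that rest is a gain. Hence the threshold `3τ`, and hence three
-- flowers: maximal gains do not increase, so each flower won at least the last `τ`.
--
-- The fractional amounts are integers up to `N = n * n + n + 1`, read as multiples of `1 / N`. A
-- unit step moves at most `n` coordinates, so it approaches the optimum as soon as a constraint
-- fails by more than `n`; the squared distance is at most `n * N * N` at the start, which bounds
-- the number of steps. The slack `n` and a rounding loss of at most `n * n` together stay below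
-- `N`, so both vanish from inequalities between integers.
--
-- The mass constraint is a family with a member for every possible clustering. None is listed: the
-- clustering of the current `z` supplies the one that matters.

open import Defs
open import Data.Bool.Base using (Bool; true; false; if_then_else_)
open import Data.Empty using (⊥; ⊥-elim)
open import Data.List.Base using (List; []; _∷_; length)
open import Data.Nat.Base
open import Data.Nat.Properties
open import Data.Nat.Tactic.RingSolver using (solve-∀)
open import Data.Product.Base using (_×_; _,_; proj₁; proj₂; ∃-syntax)
open import Data.Sum.Base as Sum using (_⊎_; inj₁; inj₂)
open import Data.Unit.Base using (⊤; tt)
open import Function.Base using (_∘_; id)
open import Relation.Binary.PropositionalEquality hiding ([_])
open import Relation.Nullary.Decidable using (Dec; yes; no; does; dec-true; dec-false; _×-dec_; ¬?)

-- Lengths of numbers and running time on the machine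

module Cost where
  open import Data.Nat.DivMod using (m/n≤m)
  open import Data.Nat.Logarithm using (⌊log₂_⌋; ⌊log₂⌋-mono-≤; ⌊log₂[2^n]⌋≡n)

  -- Time is bounded as a number of steps times a cost per step, the latter depending on lengths
  -- that grow during the run.
  steps : ∀ {P σ τ t} → ⟨ P , σ ⟩⇓ τ ∶ t → ℕ
  steps ⇓skip         = 1
  steps ⇓set          = 1
  steps (⇓seq D E)    = steps D + steps E
  steps (⇓then _ D)   = suc (steps D)
  steps (⇓else _ D)   = suc (steps D)
  steps (⇓stop _)     = 1
  steps (⇓loop _ D E) = suc (steps D + steps E)

  weightᵉ : Expr → ℕ
  weightᵉ (lit v)    = bits v
  weightᵉ (get x e)  = weightᵉ e + 2
  weightᵉ (op o e f) = weightᵉ e + weightᵉ f + 2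

  -- Both branches of a conditional are added, so that every expression and subprogram weighs at
  -- most as much as the whole program; a single constant then serves throughout a run.
  weight : Program → ℕ
  weight skip         = 1
  weight (set x e f)  = weightᵉ e + weightᵉ f + 2
  weight (P ⨾ Q)      = weight P + weight Q
  weight (cond e P Q) = weightᵉ e + (weight P + weight Q)
  weight (while e P)  = weightᵉ e + weight P

  -- A tame program never writes to array 0, so a static value is a fixed formula in input cells,
  -- whatever index is computed in `inp`. Its length is at most a constant times that of the input,
  -- however long the run.
  data Static : Expr → Set where
    lit : ∀ v → Static (lit v)
    inp : ∀ e → Static (get 0 e)
    opˢ : ∀ o {e f} → Static e → Static f → Static (op o e f)

  -- Multiplication by static expressions only: the length of a stored
  -- number then grows by a bounded amount in each step.
  data Tameᵉ : Expr → Set where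
    lit : ∀ v → Tameᵉ (lit v)
    get : ∀ x {e} → Tameᵉ e → Tameᵉ (get x e)
    add : ∀ {e f} → Tameᵉ e → Tameᵉ f → Tameᵉ (op add e f)
    sub : ∀ {e f} → Tameᵉ e → Tameᵉ f → Tameᵉ (op sub e f)
    div : ∀ {e f} → Tameᵉ e → Tameᵉ f → Tameᵉ (op div e f)
    mul : ∀ {e f} → Tameᵉ e → Static f → Tameᵉ f → Tameᵉ (op mul e f)

  data Tame : Program → Set where
    skip  : Tame skip
    set   : ∀ {x e f} → 0 < x → Tameᵉ e → Tameᵉ f → Tame (set x e f)
    _⨾_   : ∀ {P Q} → Tame P → Tame Q → Tame (P ⨾ Q)
    cond  : ∀ {e P Q} → Tameᵉ e → Tame P → Tame Q → Tame (cond e P Q)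
    while : ∀ {e P} → Tameᵉ e → Tame P → Tame (while e P)

  -- A record, so that the exponent can be inferred.
  record _≤2^_ (v e : ℕ) : Set where
    constructor pow
    field bound : v ≤ 2 ^ e

  infix 4 _≤2^_

  bits≤ : ∀ {m w} → m ≤2^ w → bits m ≤ suc w
  bits≤ {m} {w} (pow m≤) = s≤s (subst (_ ≤_) (⌊log₂[2^n]⌋≡n w) (⌊log₂⌋-mono-≤ m≤))

  n≤2^bits : ∀ v → v ≤2^ bits v
  n≤2^bits v = pow (≮⇒≥ λ lt →
    1+n≰n (subst (_≤ ⌊log₂ v ⌋) (⌊log₂[2^n]⌋≡n (bits v)) (⌊log₂⌋-mono-≤ (<⇒≤ lt))))

  ≤2^-down : ∀ {u v e} → u ≤ v → v ≤2^ e → u ≤2^ e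
  ≤2^-down u≤v (pow v≤) = pow (≤-trans u≤v v≤)

  ≤2^-mono : ∀ {v m n} → v ≤2^ m → m ≤ n → v ≤2^ n
  ≤2^-mono (pow v≤) m≤n = pow (≤-trans v≤ (^-monoʳ-≤ 2 m≤n))

  +≤2^ : ∀ {x y e} → x ≤2^ e → y ≤2^ e → x + y ≤2^ suc e
  +≤2^ {e = e} (pow x≤) (pow y≤) =
    pow (≤-trans (+-mono-≤ x≤ y≤) (≤-reflexive (cong (2 ^ e +_) (sym (+-identityʳ (2 ^ e))))))

  *≤2^ : ∀ {x y d e} → x ≤2^ d → y ≤2^ e → x * y ≤2^ d + e
  *≤2^ {d = d} {e} (pow x≤) (pow y≤) =
    pow (≤-trans (*-mono-≤ x≤ y≤) (≤-reflexive (sym (^-distribˡ-+-* 2 d e))))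

  div≤ : ∀ x y → apply div x y ≤ x
  div≤ x zero    = z≤n
  div≤ x (suc y) = m/n≤m x (suc y)

  apply≤ : ∀ o {x y d e} → x ≤2^ d → y ≤2^ e → apply o x y ≤2^ suc (d + e)
  apply≤ add {d = d} {e} x≤ y≤ = +≤2^ (≤2^-mono x≤ (m≤m+n d e)) (≤2^-mono y≤ (m≤n+m e d))
  apply≤ sub {x} {y} {d} {e} x≤ y≤ = ≤2^-mono (≤2^-down (m∸n≤m x y) x≤) (m≤n⇒m≤1+n (m≤m+n d e))
  apply≤ mul x≤ y≤ = ≤2^-mono (*≤2^ x≤ y≤) (n≤1+n _)
  apply≤ div {x} {y} {d} {e} x≤ y≤ = ≤2^-mono (≤2^-down (div≤ x y) x≤) (m≤n⇒m≤1+n (m≤m+n d e))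

  module _ {L : ℕ} (1≤L : 1 ≤ L) where

    m≤m*L : ∀ m → m ≤ m * L
    m≤m*L m = ≤-trans (≤-reflexive (sym (*-identityʳ m))) (*-monoʳ-≤ m 1≤L)

    op-exponent : ∀ a b → suc (a * L + b * L) ≤ (a + b + 2) * L
    op-exponent a b = begin
      suc (a * L + b * L)   ≡⟨ +-comm 1 _ ⟩
      a * L + b * L + 1     ≤⟨ +-monoʳ-≤ (a * L + b * L) (≤-trans 1≤L (m≤m+n L _)) ⟩
      a * L + b * L + 2 * L ≡⟨ lemma a b L ⟩
      (a + b + 2) * L       ∎
      where
      open ≤-Reasoning
      lemma : ∀ a b L → a * L + b * L + 2 * L ≡ (a + b + 2) * L
      lemma = solve-∀

    static≤ : ∀ {e σ} → (∀ i → σ 0 i ≤2^ L) → Static e → eval e σ ≤2^ (weightᵉ e * L)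
    static≤ in≤ (lit v) = ≤2^-mono (n≤2^bits v) (m≤m*L (bits v))
    static≤ {σ = σ} in≤ (inp e) =
      ≤2^-mono (in≤ _) (≤-trans (≤-reflexive (sym (*-identityˡ L))) (*-monoˡ-≤ L (≤-trans (s≤s z≤n) (m≤n+m 2 (weightᵉ e)))))
    static≤ in≤ (opˢ o {e} {f} s s′) =
      ≤2^-mono (apply≤ o (static≤ in≤ s) (static≤ in≤ s′))
               (op-exponent (weightᵉ e) (weightᵉ f))

    -- A product has one static factor, so the length `w` of the stored numbers enters the exponent
    -- once and is only added to. Were both factors free, a loop could double the lengths in each
    -- round.
    tame≤ : ∀ {e σ w} → (∀ i → σ 0 i ≤2^ L) → (∀ x i → σ x i ≤2^ w) →
            Tameᵉ e → eval e σ ≤2^ (w + weightᵉ e * L)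
    tame≤ {w = w} in≤ σ≤ (lit v) = ≤2^-mono (n≤2^bits v) (≤-trans (m≤m*L (bits v)) (m≤n+m _ w))
    tame≤ in≤ σ≤ (get x e) = ≤2^-mono (σ≤ x _) (m≤m+n _ _)
    tame≤ {w = w} in≤ σ≤ (add {e} {f} s s′) =
      ≤2^-mono (+≤2^ (≤2^-mono (tame≤ in≤ σ≤ s) (+-monoʳ-≤ w (m≤m+n _ _)))
                 (≤2^-mono (tame≤ in≤ σ≤ s′) (+-monoʳ-≤ w (m≤n+m _ _))))
               (≤-trans (≤-reflexive (sym (+-suc w _))) (+-monoʳ-≤ w (op-exponent (weightᵉ e) (weightᵉ f))))
    tame≤ {σ = σ} {w} in≤ σ≤ (sub {e} {f} s s′) =
      ≤2^-mono (≤2^-down (m∸n≤m (eval e σ) (eval f σ)) (tame≤ in≤ σ≤ s))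
               (+-monoʳ-≤ w (≤-trans (≤-trans (m≤m+n _ _) (n≤1+n _)) (op-exponent (weightᵉ e) (weightᵉ f))))
    tame≤ {σ = σ} {w} in≤ σ≤ (div {e} {f} s s′) =
      ≤2^-mono (≤2^-down (div≤ (eval e σ) (eval f σ)) (tame≤ in≤ σ≤ s))
               (+-monoʳ-≤ w (≤-trans (≤-trans (m≤m+n _ _) (n≤1+n _)) (op-exponent (weightᵉ e) (weightᵉ f))))
    tame≤ {w = w} in≤ σ≤ (mul {e} {f} s s′ _) =
      ≤2^-mono (*≤2^ (tame≤ in≤ σ≤ s) (static≤ in≤ s′))
               (≤-trans (≤-reflexive (+-assoc w _ _))
                        (+-monoʳ-≤ w (≤-trans (n≤1+n _) (op-exponent (weightᵉ e) (weightᵉ f)))))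

    module _ (c W : ℕ) where

      -- With `W` a bound on the lengths of the numbers stored at any moment of a run and `c` one on
      -- the weight, no value evaluated during the run is longer than this.
      V : ℕ
      V = suc (W + c * L)

      bits-eval≤ : ∀ {e σ w} → (∀ i → σ 0 i ≤2^ L) → (∀ x i → σ x i ≤2^ w) → w ≤ W →
                   Tameᵉ e → weightᵉ e ≤ c → bits (eval e σ) ≤ V
      bits-eval≤ in≤ σ≤ w≤W s e≤c =
        bits≤ (≤2^-mono (tame≤ in≤ σ≤ s) (+-mono-≤ w≤W (*-monoˡ-≤ L e≤c)))

      cost≤ : ∀ {e σ w} → (∀ i → σ 0 i ≤2^ L) → (∀ x i → σ x i ≤2^ w) → w ≤ W →
              Tameᵉ e → weightᵉ e ≤ c → cost e σ ≤ weightᵉ e * V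
      cost≤ {lit v} in≤ σ≤ w≤W (lit .v) e≤c = ≤-trans (≤-reflexive (sym (*-identityʳ (bits v)))) (*-monoʳ-≤ (bits v) (s≤s z≤n))
      cost≤ {get x e} {σ} in≤ σ≤ w≤W (get .x s) e≤c = begin
        cost e σ + bits (eval e σ) + bits (σ x (eval e σ))
          ≤⟨ +-mono-≤ (+-mono-≤ (cost≤ in≤ σ≤ w≤W s e≤c′) (bits-eval≤ in≤ σ≤ w≤W s e≤c′))
                      (bits≤ (≤2^-mono (σ≤ x _) (≤-trans w≤W (m≤m+n W _)))) ⟩
        weightᵉ e * V + V + V ≡⟨ lemma (weightᵉ e) V ⟩
        (weightᵉ e + 2) * V ∎
        where
        open ≤-Reasoning
        e≤c′ = ≤-trans (m≤m+n _ 2) e≤c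
        lemma : ∀ a b → a * b + b + b ≡ (a + 2) * b
        lemma = solve-∀
      cost≤ {op o e f} {σ} in≤ σ≤ w≤W s e≤c = begin
        cost e σ + cost f σ + bits (eval e σ) + bits (eval f σ)
          ≤⟨ +-mono-≤ (+-mono-≤ (+-mono-≤ (cost≤ in≤ σ≤ w≤W (proj₁ (parts s)) e≤) (cost≤ in≤ σ≤ w≤W (proj₂ (parts s)) f≤))
                (bits-eval≤ in≤ σ≤ w≤W (proj₁ (parts s)) e≤)) (bits-eval≤ in≤ σ≤ w≤W (proj₂ (parts s)) f≤) ⟩
        weightᵉ e * V + weightᵉ f * V + V + V ≡⟨ lemma (weightᵉ e) (weightᵉ f) V ⟩
        (weightᵉ e + weightᵉ f + 2) * V ∎
        where
        open ≤-Reasoning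
        e≤ = ≤-trans (≤-trans (m≤m+n _ _) (m≤m+n _ 2)) e≤c
        f≤ = ≤-trans (≤-trans (m≤n+m _ (weightᵉ e)) (m≤m+n _ 2)) e≤c
        lemma : ∀ a b v → a * v + b * v + v + v ≡ (a + b + 2) * v
        lemma = solve-∀
        parts : ∀ {o e f} → Tameᵉ (op o e f) → Tameᵉ e × Tameᵉ f
        parts (add s s′)   = s , s′
        parts (sub s s′)   = s , s′
        parts (div s s′)   = s , s′
        parts (mul s _ s′) = s , s′

      Bounded : ℕ → Store → Set
      Bounded w σ = (∀ i → σ 0 i ≤2^ L) × (∀ x i → σ x i ≤2^ w)

      update≤ : ∀ {σ w} x i v → 0 < x → v ≤2^ (w + c * L) → Bounded w σ →
                Bounded (w + c * L) (update σ x i v)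
      update≤ {σ} {w} x i v 0<x v≤ (in≤ , σ≤) = in′ , σ′
        where
        in′ : ∀ j → update σ x i v 0 j ≤2^ L
        in′ j rewrite dec-false (0 ≟ x) (<⇒≢ 0<x) = in≤ j
        σ′ : ∀ y j → update σ x i v y j ≤2^ (w + c * L)
        σ′ y j = if-elim _
          where
          if-elim : ∀ b → (if b then v else σ y j) ≤2^ (w + c * L)
          if-elim true  = v≤
          if-elim false = ≤2^-mono (σ≤ y j) (m≤m+n w _)

      bounded-mono : ∀ {w w′ σ} → w ≤ w′ → Bounded w σ → Bounded w′ σ
      bounded-mono w≤ (in≤ , σ≤) = in≤ , λ x i → ≤2^-mono (σ≤ x i) w≤

      private
        cV = c * V
        cL = c * L

      1≤cV : 1 ≤ c → 1 ≤ cV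
      1≤cV 1≤c = *-mono-≤ 1≤c (s≤s (z≤n {W + c * L}))

      test≤ : ∀ {w σ} e → Tameᵉ e → weightᵉ e ≤ c → w ≤ W → Bounded w σ → cost e σ ≤ cV
      test≤ e te e≤c w≤W (in≤ , σ≤) = ≤-trans (cost≤ in≤ σ≤ w≤W te e≤c) (*-monoˡ-≤ V e≤c)

      -- Each step lengthens the stored numbers by at most `c * L` bits. Asking at the outset that
      -- the lengths reached in this way stay below `W` gives all steps the same cost bound `c * V`,
      -- and the induction only has to count them.
      time≤ : ∀ {P σ τ t w} (D : ⟨ P , σ ⟩⇓ τ ∶ t) → Tame P → weight P ≤ c → 1 ≤ c →
              w + steps D * cL ≤ W → Bounded w σ →
              Bounded (w + steps D * cL) τ × t ≤ steps D * cV
      time≤ {w = w} ⇓skip skip _ 1≤c W≥ bd =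
        bounded-mono (m≤m+n w _) bd , ≤-trans (1≤cV 1≤c) (m≤m+n _ 0)
      time≤ {σ = σ} {w = w} (⇓set {x = x} {e} {f}) (set 0<x te tf) P≤c 1≤c W≥ bd@(in≤ , σ≤) =
        subst (λ z → Bounded (w + z) (update σ x (eval e σ) (eval f σ))) (sym (+-identityʳ cL))
          (update≤ x (eval e σ) (eval f σ) 0<x
            (≤2^-mono (tame≤ in≤ σ≤ tf) (+-monoʳ-≤ w (*-monoˡ-≤ L f≤c))) bd) ,
        (begin
          cost e σ + cost f σ + bits (eval e σ) + bits (eval f σ)
            ≤⟨ +-mono-≤ (+-mono-≤ (+-mono-≤ (cost≤ in≤ σ≤ w≤W te e≤c) (cost≤ in≤ σ≤ w≤W tf f≤c))
                (bits-eval≤ in≤ σ≤ w≤W te e≤c)) (bits-eval≤ in≤ σ≤ w≤W tf f≤c) ⟩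
          weightᵉ e * V + weightᵉ f * V + V + V ≡⟨ lemma (weightᵉ e) (weightᵉ f) V ⟩
          (weightᵉ e + weightᵉ f + 2) * V ≤⟨ *-monoˡ-≤ V P≤c ⟩
          cV ≡⟨ sym (+-identityʳ cV) ⟩
          cV + 0 ∎)
        where
        open ≤-Reasoning
        w≤W = m+n≤o⇒m≤o w W≥
        e≤c = ≤-trans (≤-trans (m≤m+n _ _) (m≤m+n _ 2)) P≤c
        f≤c = ≤-trans (≤-trans (m≤n+m _ (weightᵉ e)) (m≤m+n _ 2)) P≤c
        lemma : ∀ a b v → a * v + b * v + v + v ≡ (a + b + 2) * v
        lemma = solve-∀
      time≤ {w = w} (⇓seq {P} {Q} D E) (tP ⨾ tQ) P≤c 1≤c W≥ bd =
        bounded-mono (≤-reflexive eq) (proj₁ q) ,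
        ≤-trans (+-mono-≤ (proj₂ p) (proj₂ q)) (≤-reflexive (sym (*-distribʳ-+ cV (steps D) (steps E))))
        where
        eq : w + steps D * cL + steps E * cL ≡ w + (steps D + steps E) * cL
        eq = trans (+-assoc w _ _) (cong (w +_) (sym (*-distribʳ-+ cL (steps D) (steps E))))
        W≥′ = subst (_≤ W) (sym eq) W≥
        p = time≤ D tP (≤-trans (m≤m+n _ _) P≤c) 1≤c (m+n≤o⇒m≤o _ W≥′) bd
        q = time≤ E tQ (≤-trans (m≤n+m _ (weight P)) P≤c) 1≤c W≥′ (proj₁ p)
      time≤ {w = w} (⇓then {e} {P} {Q} _ D) (cond te tP tQ) P≤c 1≤c W≥ bd =
        bounded-mono (+-monoʳ-≤ w (m≤n+m _ cL)) (proj₁ p) ,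
        +-mono-≤ (test≤ e te (≤-trans (m≤m+n _ _) P≤c) (m+n≤o⇒m≤o w W≥) bd) (proj₂ p)
        where
        p = time≤ D tP (≤-trans (≤-trans (m≤m+n _ _) (m≤n+m _ (weightᵉ e))) P≤c) 1≤c
              (≤-trans (+-monoʳ-≤ w (m≤n+m _ cL)) W≥) bd
      time≤ {w = w} (⇓else {e} {P} {Q} _ D) (cond te tP tQ) P≤c 1≤c W≥ bd =
        bounded-mono (+-monoʳ-≤ w (m≤n+m _ cL)) (proj₁ p) ,
        +-mono-≤ (test≤ e te (≤-trans (m≤m+n _ _) P≤c) (m+n≤o⇒m≤o w W≥) bd) (proj₂ p)
        where
        p = time≤ D tQ (≤-trans (≤-trans (m≤n+m _ (weight P)) (m≤n+m _ (weightᵉ e))) P≤c) 1≤c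
              (≤-trans (+-monoʳ-≤ w (m≤n+m _ cL)) W≥) bd
      time≤ {w = w} (⇓stop {e} {P} _) (while te tP) P≤c 1≤c W≥ bd =
        bounded-mono (m≤m+n w _) bd ,
        ≤-trans (test≤ e te (≤-trans (m≤m+n _ _) P≤c) (m+n≤o⇒m≤o w W≥) bd) (m≤m+n _ 0)
      time≤ {w = w} (⇓loop {e} {P} {s = s} {t} _ D E) tw@(while te tP) P≤c 1≤c W≥ bd =
        bounded-mono (≤-trans (≤-reflexive eq) (+-monoʳ-≤ w (m≤n+m _ cL))) (proj₁ q) ,
        (begin
          cost e _ + s + t                            ≤⟨ +-mono-≤ (+-mono-≤ (test≤ e te (≤-trans (m≤m+n _ _) P≤c) w≤W bd) (proj₂ p)) (proj₂ q) ⟩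
          cV + steps D * cV + steps E * cV            ≡⟨ +-assoc cV _ _ ⟩
          cV + (steps D * cV + steps E * cV)          ≡⟨ cong (cV +_) (sym (*-distribʳ-+ cV (steps D) (steps E))) ⟩
          cV + (steps D + steps E) * cV               ∎)
        where
        open ≤-Reasoning
        w≤W = m+n≤o⇒m≤o w W≥
        eq : w + steps D * cL + steps E * cL ≡ w + (steps D + steps E) * cL
        eq = trans (+-assoc w _ _) (cong (w +_) (sym (*-distribʳ-+ cL (steps D) (steps E))))
        W≥′ = subst (_≤ W) (sym eq) (≤-trans (+-monoʳ-≤ w (m≤n+m _ cL)) W≥)
        p = time≤ D tP (≤-trans (m≤n+m _ (weightᵉ e)) P≤c) 1≤c (m+n≤o⇒m≤o _ W≥′) bd
        q = time≤ E tw P≤c 1≤c W≥′ (proj₁ p)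

  nth≤ : ∀ ws i → nth ws i ≤2^ size ws
  nth≤ []       i       = pow z≤n
  nth≤ (v ∷ ws) zero    = ≤2^-mono (n≤2^bits v) (m≤m+n (bits v) _)
  nth≤ (v ∷ ws) (suc i) = ≤2^-mono (nth≤ ws i) (m≤n+m _ (bits v))

  initial≤ : ∀ ws x i → initial ws x i ≤2^ size ws
  initial≤ ws zero    i = nth≤ ws i
  initial≤ ws (suc x) i = pow z≤n

  timeBound : ℕ → ℕ → ℕ → ℕ
  timeBound c s L = s * (c * suc ((L + s * (c * L)) + c * L))

  time-initial≤ : ∀ {P ws τ t} (D : ⟨ P , initial ws ⟩⇓ τ ∶ t) → Tame P → 1 ≤ size ws →
                  t ≤ timeBound (suc (weight P)) (steps D) (size ws)
  time-initial≤ {P} {ws} D tP 1≤L = proj₂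
    (time≤ 1≤L (suc (weight P)) (size ws + steps D * (suc (weight P) * size ws)) D tP (n≤1+n _) (s≤s z≤n)
      ≤-refl (nth≤ ws , initial≤ ws))

-- Bounds by a monomial, uniform in n ≤ S so that monotonicity is not needed.
module Polynomial where

  Poly : (ℕ → ℕ) → Set
  Poly f = ∃[ a ] ∃[ e ] ∀ n S → n ≤ S → 1 ≤ S → f n ≤ a * S ^ e

  poly-const : ∀ c → Poly (λ _ → c)
  poly-const c = c , 0 , λ n S _ _ → ≤-reflexive (sym (*-identityʳ c))

  poly-id : Poly (λ n → n)
  poly-id = 1 , 1 , λ n S n≤S _ → ≤-trans n≤S (≤-reflexive (sym (trans (+-identityʳ _) (*-identityʳ S))))

  poly-+ : ∀ {f g} → Poly f → Poly g → Poly (λ n → f n + g n)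
  poly-+ (a , e , f≤) (a′ , e′ , g≤) = a + a′ , e + e′ , λ n S n≤S 1≤S → begin
    _                                     ≤⟨ +-mono-≤ (f≤ n S n≤S 1≤S) (g≤ n S n≤S 1≤S) ⟩
    a * S ^ e + a′ * S ^ e′               ≤⟨ +-mono-≤ (*-monoʳ-≤ a (pow S 1≤S (m≤m+n e e′))) (*-monoʳ-≤ a′ (pow S 1≤S (m≤n+m e′ e))) ⟩
    a * S ^ (e + e′) + a′ * S ^ (e + e′)  ≡⟨ sym (*-distribʳ-+ (S ^ (e + e′)) a a′) ⟩
    (a + a′) * S ^ (e + e′)               ∎
    where
    open ≤-Reasoning
    pow : ∀ S {d e} → 1 ≤ S → d ≤ e → S ^ d ≤ S ^ e
    pow (suc S) _ d≤e = ^-monoʳ-≤ (suc S) d≤e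

  poly-* : ∀ {f g} → Poly f → Poly g → Poly (λ n → f n * g n)
  poly-* (a , e , f≤) (a′ , e′ , g≤) = a * a′ , e + e′ , λ n S n≤S 1≤S → begin
    _                                   ≤⟨ *-mono-≤ (f≤ n S n≤S 1≤S) (g≤ n S n≤S 1≤S) ⟩
    (a * S ^ e) * (a′ * S ^ e′)         ≡⟨ lemma a (S ^ e) a′ (S ^ e′) ⟩
    (a * a′) * (S ^ e * S ^ e′)         ≡⟨ cong (a * a′ *_) (sym (^-distribˡ-+-* S e e′)) ⟩
    (a * a′) * S ^ (e + e′)             ∎
    where
    open ≤-Reasoning
    lemma : ∀ a b c d → (a * b) * (c * d) ≡ (a * c) * (b * d)
    lemma = solve-∀

-- Finite sums, Booleans and bounded iteration

module Sums where
  open import Data.Bool.Base using (T)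

  ∑ : ℕ → (ℕ → ℕ) → ℕ
  ∑ zero    f = 0
  ∑ (suc n) f = ∑ n f + f n

  𝟙 : Bool → ℕ
  𝟙 b = if b then 1 else 0

  count : ℕ → (ℕ → Bool) → ℕ
  count n P = ∑ n λ i → 𝟙 (P i)

  -- A positive count rather than a search: the term language has sums and comparisons, and its
  -- denotations are to agree with these functions by computation. The connectives are written with
  -- `if` for the same reason.
  any : ℕ → (ℕ → Bool) → Bool
  any n P = 0 <ᵇ count n P

  infixr 6 _&_
  infixr 5 _∥_

  _&_ _∥_ : Bool → Bool → Bool
  b & c = if b then c else false
  b ∥ c = if b then true else c

  ∼_ : Bool → Bool
  ∼ b = if b then false else true

  infix 7 ∼_

  <ᵇ-true : ∀ {m n} → m < n → (m <ᵇ n) ≡ true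
  <ᵇ-true {zero}  {suc n} _         = refl
  <ᵇ-true {suc m} {suc n} (s≤s m<n) = <ᵇ-true m<n

  <ᵇ-false : ∀ {m n} → n ≤ m → (m <ᵇ n) ≡ false
  <ᵇ-false {m}     {zero}  _         = refl
  <ᵇ-false {suc m} {suc n} (s≤s n≤m) = <ᵇ-false n≤m

  true-<ᵇ : ∀ {m n} → (m <ᵇ n) ≡ true → m < n
  true-<ᵇ {m} {n} eq = <ᵇ⇒< m n (subst T (sym eq) tt)

  false-<ᵇ : ∀ {m n} → (m <ᵇ n) ≡ false → n ≤ m
  false-<ᵇ {m} {n} eq with n ≤? m
  ... | yes n≤m = n≤m
  ... | no  n≰m with () ← trans (sym (<ᵇ-true (≰⇒> n≰m))) eq

  table : ℕ → (ℕ → ℕ) → ℕ → ℕ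
  table s f i = if i <ᵇ s then f i else 0

  -- Every round is cut off at `s`, as a compiled array has a meaning only up to its size.
  iterate : ℕ → (ℕ → ℕ) → (ℕ → (ℕ → ℕ) → ℕ → ℕ) → ℕ → ℕ → ℕ
  iterate s f g zero    = table s f
  iterate s f g (suc t) = table s (g t (iterate s f g t))

  table-< : ∀ {s i} f → i < s → table s f i ≡ f i
  table-< f i<s rewrite <ᵇ-true i<s = refl

  table-≥ : ∀ {s i} f → s ≤ i → table s f i ≡ 0
  table-≥ f s≤i rewrite <ᵇ-false s≤i = refl

  table-cong : ∀ s {f g} → (∀ i → f i ≡ g i) → ∀ i → table s f i ≡ table s g i
  table-cong s f≗g i with i <ᵇ s
  ... | true  = f≗g i
  ... | false = refl

  table-restrict : ∀ s f {h} → (∀ i → i < s → h i ≡ table s f i) → ∀ i → table s f i ≡ table s h i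
  table-restrict s f {h} h≗ i with i <? s
  ... | yes i<s = trans (sym (h≗ i i<s)) (sym (table-< h i<s))
  ... | no  i≮s = trans (table-≥ f (≮⇒≥ i≮s)) (sym (table-≥ h (≮⇒≥ i≮s)))

  iterate-restrict : ∀ s f g t {h} → (∀ i → i < s → h i ≡ iterate s f g t i) → ∀ i → iterate s f g t i ≡ table s h i
  iterate-restrict s f g zero    = table-restrict s f
  iterate-restrict s f g (suc t) = table-restrict s (g t (iterate s f g t))

  -- The minimum, in the form in which a compiled loop computes the number of its rounds. Iterations
  -- with a fixed number of rounds carry a `clip` with equal arguments, so that they are literally
  -- denotations of terms.
  clip : ℕ → ℕ → ℕ
  clip m n = m ∸ (m ∸ n)

  clip-≤ : ∀ {m n} → m ≤ n → clip m n ≡ m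
  clip-≤ {m} m≤n = cong (m ∸_) (m≤n⇒m∸n≡0 m≤n)

  clip≤ : ∀ m n → clip m n ≤ n
  clip≤ m n with ≤-total m n
  ... | inj₁ m≤n = ≤-trans (≤-reflexive (clip-≤ m≤n)) m≤n
  ... | inj₂ n≤m = ≤-reflexive (m∸[m∸n]≡n n≤m)

-- The algorithm as a function on numbers

module Algorithm where
  open Sums

  quot rem : ℕ → ℕ → ℕ
  quot M x = apply div x M
  rem M x  = x ∸ quot M x * M

  eq : ℕ → ℕ → Bool
  eq x y = ∼ (x <ᵇ y) & ∼ (y <ᵇ x)

  module Graph (n : ℕ) (adj : ℕ → ℕ → Bool) where

    hop₂ hop₃ : ℕ → ℕ → Bool
    hop₂ i j = any n λ u → adj i u & adj u j
    hop₃ i j = any n λ u → adj i u & hop₂ u j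

    -- `q₀` is the center that replaces two merged balls and reaches three hops; `q₁`, `q₂` and `q₃`
    -- are the centers of flowers. The value `n` marks an empty slot, as no point is within reach of
    -- it.
    region : ℕ → ℕ → ℕ → ℕ → ℕ → Bool
    region q₀ q₁ q₂ q₃ p = ((hop₃ q₀ p ∥ hop₂ q₁ p) ∥ hop₂ q₂ p) ∥ hop₂ q₃ p

    -- `M` is the base in which tuples of numbers up to `n` are packed. `N` is the common
    -- denominator of the fractional amounts, the least number above the total loss `n * n + n`.
    M N : ℕ
    M = 1 + n
    N = n * n + n + 1

    -- Owners: a value below n is the leader owning the point.
    module Dense (red U : ℕ → Bool) (τ : ℕ) where

      free : (ℕ → ℕ) → ℕ → Bool
      free A p = (p <ᵇ n) & ∼ U p & ∼ (A p <ᵇ n)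

      reds : (ℕ → ℕ) → ℕ → ℕ
      reds A i = count n λ x → adj i x & red x & free A x

      common : (ℕ → ℕ) → ℕ → ℕ → ℕ
      common A i j = count n λ x → adj i x & adj j x & red x & free A x

      -- A ball of the optimum that meets a region turns out to share many red points with its dense
      -- ball. Claiming balls whole therefore puts all free points of such a ball into that one
      -- region.
      denseStep : ℕ → (ℕ → ℕ) → ℕ → ℕ
      denseStep t A p =
        if free A p & (τ + τ <ᵇ reds A t) & any n (λ i → adj i p & (τ <ᵇ common A t i)) then t else A p

      owner : ℕ → ℕ
      owner = iterate n (λ _ → n) denseStep (clip n n)

      light : (ℕ → ℕ) → ℕ → Bool
      light A p = free A p & ∼ (τ + τ + τ <ᵇ count n λ x → hop₂ p x & red x & free A x)

    module Sparse (red L : ℕ → Bool) where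

      clusterStep : (ℕ → ℕ) → ℕ → (ℕ → ℕ) → ℕ → ℕ
      clusterStep z t A p =
        if L p & ∼ (A p <ᵇ n) & L (rem M t) & ∼ (A (rem M t) <ᵇ n) & ∼ (z (rem M t) <ᵇ N ∸ quot M t) & hop₂ (rem M t) p
        then rem M t else A p

      -- Clusters are opened in the order of decreasing z: round t handles
      -- the point t mod M at level N ∸ t / M.
      cluster : (ℕ → ℕ) → ℕ → ℕ
      cluster z = iterate n (λ _ → n) (clusterStep z) (clip ((N + 1) * M) ((N + 1) * M))

      mass : Bool → (ℕ → ℕ) → ℕ
      mass c z = ∑ n λ p → if L p & (if c then red p else ∼ red p) then z p else 0

      raise : Bool → (ℕ → ℕ) → ℕ → ℕ
      raise c z p = if (L p & (if c then red p else ∼ red p)) & (z p <ᵇ N) then z p + 1 else z p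

      lower : (ℕ → ℕ) → (ℕ → ℕ) → ℕ → ℕ
      lower C z p = if eq (C p) p then z p ∸ 1 else z p

      -- The mass constraint on the centers is not tested, since its right side, the number of
      -- optimal balls in the sparse part, is unknown: whenever red and blue suffice, the centers
      -- are lowered. The iteration may thus pass through a good `z` and leave it again, which is
      -- why the number of rounds is guessed.
      relaxStep : ℕ → ℕ → ℕ → (ℕ → ℕ) → ℕ → ℕ
      relaxStep rₛ bₛ t z p =
        if mass true z + n <ᵇ rₛ * N then raise true z p
        else if mass false z + n <ᵇ bₛ * N then raise false z p
        else lower (cluster z) z p

      relax : ℕ → ℕ → ℕ → ℕ → ℕ
      relax rₛ bₛ T = iterate n (λ _ → 0) (relaxStep rₛ bₛ) (clip T (N * N * n + 1))

    -- Owners and leaders share one range of indices: the center `g` serves all points of index `g`,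
    -- so a single item stands for them.
    item : (ℕ → ℕ) → (ℕ → ℕ) → ℕ → ℕ
    item A C p = if A p <ᵇ n then A p else C p

    module Knapsack (red : ℕ → Bool) (it : ℕ → ℕ) where

      weight : Bool → ℕ → ℕ
      weight c g = count n λ p → eq (it p) g & (if c then red p else ∼ red p)

      index : ℕ → ℕ → ℕ → ℕ → ℕ
      index κ a β j = ((κ * M + a) * M + β) * M + j

      reached : (ℕ → ℕ) → ℕ → ℕ → ℕ → Bool
      reached A κ a β = 0 <ᵇ A (index κ a β n)

      -- An entry that has been reached is never overwritten. It carries a set attaining its totals,
      -- so no path through the table has to be traced back.
      transfer : ℕ → (ℕ → ℕ) → ℕ → ℕ → ℕ → ℕ → ℕ
      transfer g A κ a β j =
        if reached A κ a β then A (index κ a β j)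
        else if (0 <ᵇ κ) & ∼ (a <ᵇ weight true g) & ∼ (β <ᵇ weight false g) &
                reached A (κ ∸ 1) (a ∸ weight true g) (β ∸ weight false g)
        then (if eq j g then 1 else A (index (κ ∸ 1) (a ∸ weight true g) (β ∸ weight false g) j))
        else 0

      knapsackStep : ℕ → (ℕ → ℕ) → ℕ → ℕ
      knapsackStep g A x =
        transfer g A (quot M (quot M (quot M x))) (rem M (quot M (quot M x))) (rem M (quot M x)) (rem M x)

      -- Entry (κ, a, β, n) tells whether some κ items weigh a and β, and
      -- the entries (κ, a, β, j) with j < n describe such a set of items.
      knapsack : ℕ → ℕ
      knapsack = iterate (M * M * M * M) (λ x → if eq x n then 1 else 0) knapsackStep (clip n n)

    candidate : (red : ℕ → Bool) (q₀ q₁ q₂ q₃ τ rₛ bₛ T κ a β : ℕ) → ℕ → Bool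
    candidate red q₀ q₁ q₂ q₃ τ rₛ bₛ T κ a β p =
      (((eq q₀ p ∥ eq q₁ p) ∥ eq q₂ p) ∥ eq q₃ p) ∥ (0 <ᵇ D (Knapsack.index red it κ a β p))
      where
      U = region q₀ q₁ q₂ q₃
      A = Dense.owner red U τ
      L = Dense.light red U τ A
      z = Sparse.relax red L rₛ bₛ T
      C = Sparse.cluster red L z
      it = item A C
      D = Knapsack.knapsack red it

    covers : (ℕ → Bool) → ℕ → Bool
    covers C p = any n λ c → C c & hop₃ c p

    solves : (red : ℕ → Bool) (k r b : ℕ) → (ℕ → Bool) → Bool
    solves red k r b C =
      ∼ (k <ᵇ count n C) & ∼ (count n (λ p → red p & covers C p) <ᵇ r) & ∼ (count n (λ p → ∼ red p & covers C p) <ᵇ b)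

-- Sums, counts, least and optimal indices

module SumLemmas where
  open Sums
  open Algorithm using (eq)

  dichotomy : ∀ b → b ≡ true ⊎ b ≡ false
  dichotomy true  = inj₁ refl
  dichotomy false = inj₂ refl

  absurd : ∀ {b} {A : Set} → b ≡ true → b ≡ false → A
  absurd refl ()

  &-intro : ∀ {b c} → b ≡ true → c ≡ true → (b & c) ≡ true
  &-intro refl refl = refl

  &-fst : ∀ b {c} → (b & c) ≡ true → b ≡ true
  &-fst true _ = refl

  &-snd : ∀ b {c} → (b & c) ≡ true → c ≡ true
  &-snd true p = p

  &-falseˡ : ∀ {b c} → b ≡ false → (b & c) ≡ false
  &-falseˡ refl = refl

  &₃-elim : ∀ b c {d} → (b & c & d) ≡ true → b ≡ true × c ≡ true × d ≡ true
  &₃-elim true true p = refl , refl , p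

  &₄-elim : ∀ b c d {e} → (b & c & d & e) ≡ true → b ≡ true × c ≡ true × d ≡ true × e ≡ true
  &₄-elim true true true p = refl , refl , refl , p

  &-intro₃ : ∀ {b c d} → b ≡ true → c ≡ true → d ≡ true → (b & c & d) ≡ true
  &-intro₃ refl refl refl = refl

  &-intro₄ : ∀ {b c d e} → b ≡ true → c ≡ true → d ≡ true → e ≡ true → (b & c & d & e) ≡ true
  &-intro₄ refl refl refl refl = refl

  ∥-introˡ : ∀ {b c} → b ≡ true → (b ∥ c) ≡ true
  ∥-introˡ refl = refl

  ∥-introʳ : ∀ b {c} → c ≡ true → (b ∥ c) ≡ true
  ∥-introʳ true  _ = refl
  ∥-introʳ false p = p

  ∥-elim : ∀ b {c} → (b ∥ c) ≡ true → b ≡ true ⊎ c ≡ true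
  ∥-elim true  _ = inj₁ refl
  ∥-elim false p = inj₂ p

  ∼-intro : ∀ {b} → b ≡ false → ∼ b ≡ true
  ∼-intro refl = refl

  ∼-elim : ∀ {b} → ∼ b ≡ true → b ≡ false
  ∼-elim {false} _ = refl

  bool-ext : ∀ {b c} → (b ≡ true → c ≡ true) → (c ≡ true → b ≡ true) → b ≡ c
  bool-ext {true}  {c}     f g = sym (f refl)
  bool-ext {false} {true}  f g = g refl
  bool-ext {false} {false} f g = refl

  if-true : ∀ {A : Set} {b} {x y : A} → b ≡ true → (if b then x else y) ≡ x
  if-true refl = refl

  if-false : ∀ {A : Set} {b} {x y : A} → b ≡ false → (if b then x else y) ≡ y
  if-false refl = refl

  ≮ᵇ-intro : ∀ {m n} → n ≤ m → ∼ (m <ᵇ n) ≡ true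
  ≮ᵇ-intro n≤m = ∼-intro (<ᵇ-false n≤m)

  ≮ᵇ-elim : ∀ {m n} → ∼ (m <ᵇ n) ≡ true → n ≤ m
  ≮ᵇ-elim p = false-<ᵇ (∼-elim p)

  eq-elim : ∀ {x y} → eq x y ≡ true → x ≡ y
  eq-elim {x} {y} p = ≤-antisym (≮ᵇ-elim (&-snd (∼ (x <ᵇ y)) p)) (≮ᵇ-elim (&-fst (∼ (x <ᵇ y)) p))

  eq-intro : ∀ {x y} → x ≡ y → eq x y ≡ true
  eq-intro {x} refl = &-intro (≮ᵇ-intro {x} ≤-refl) (≮ᵇ-intro {x} ≤-refl)

  eq-false : ∀ {x y} → x ≢ y → eq x y ≡ false
  eq-false {x} {y} x≢y with dichotomy (eq x y)
  ... | inj₁ p = ⊥-elim (x≢y (eq-elim p))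
  ... | inj₂ p = p

  ∑-cong : ∀ n {f g} → (∀ i → i < n → f i ≡ g i) → ∑ n f ≡ ∑ n g
  ∑-cong zero    f≗g = refl
  ∑-cong (suc n) f≗g = cong₂ _+_ (∑-cong n λ i i<n → f≗g i (m<n⇒m<1+n i<n)) (f≗g n ≤-refl)

  ∑-mono : ∀ n {f g} → (∀ i → i < n → f i ≤ g i) → ∑ n f ≤ ∑ n g
  ∑-mono zero    f≤g = z≤n
  ∑-mono (suc n) f≤g = +-mono-≤ (∑-mono n λ i i<n → f≤g i (m<n⇒m<1+n i<n)) (f≤g n ≤-refl)

  ∑-zero : ∀ n {f} → (∀ i → i < n → f i ≡ 0) → ∑ n f ≡ 0
  ∑-zero zero    f≗0 = refl
  ∑-zero (suc n) f≗0 = cong₂ _+_ (∑-zero n λ i i<n → f≗0 i (m<n⇒m<1+n i<n)) (f≗0 n ≤-refl)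

  ∑-+ : ∀ n f g → ∑ n (λ i → f i + g i) ≡ ∑ n f + ∑ n g
  ∑-+ zero    f g = refl
  ∑-+ (suc n) f g = trans (cong (_+ (f n + g n)) (∑-+ n f g)) (lemma (∑ n f) (∑ n g) (f n) (g n))
    where
    lemma : ∀ a b c d → a + b + (c + d) ≡ a + c + (b + d)
    lemma = solve-∀

  ∑-* : ∀ n c f → ∑ n (λ i → c * f i) ≡ c * ∑ n f
  ∑-* zero    c f = sym (*-zeroʳ c)
  ∑-* (suc n) c f = trans (cong (_+ c * f n) (∑-* n c f)) (sym (*-distribˡ-+ c (∑ n f) (f n)))

  ∑-swap : ∀ m n (f : ℕ → ℕ → ℕ) → ∑ m (λ i → ∑ n (f i)) ≡ ∑ n (λ j → ∑ m (λ i → f i j))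
  ∑-swap zero    n f = sym (∑-zero n λ _ _ → refl)
  ∑-swap (suc m) n f = trans (cong (_+ ∑ n (f m)) (∑-swap m n f)) (sym (∑-+ n _ (f m)))

  ∑≤* : ∀ n {f} c → (∀ i → i < n → f i ≤ c) → ∑ n f ≤ n * c
  ∑≤* zero    c f≤ = z≤n
  ∑≤* (suc n) c f≤ = ≤-trans (+-mono-≤ (∑≤* n c λ i i<n → f≤ i (m<n⇒m<1+n i<n)) (f≤ n ≤-refl)) (≤-reflexive (+-comm (n * c) c))

  ∑-term : ∀ n f {i} → i < n → f i ≤ ∑ n f
  ∑-term (suc n) f {i} i<1+n with i ≟ n
  ... | yes refl = m≤n+m (f i) _
  ... | no  i≢n  = ≤-trans (∑-term n f (≤∧≢⇒< (s≤s⁻¹ i<1+n) i≢n)) (m≤m+n _ _)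

  ∑-positive : ∀ n f → 0 < ∑ n f → ∃[ i ] i < n × 0 < f i
  ∑-positive (suc n) f 0< with 0 <? f n
  ... | yes p = n , ≤-refl , p
  ... | no ¬p with ∑-positive n f (subst (0 <_) (trans (cong (∑ n f +_) (n≤0⇒n≡0 (≮⇒≥ ¬p))) (+-identityʳ _)) 0<)
  ...   | i , i<n , q = i , m<n⇒m<1+n i<n , q

  𝟙≤1 : ∀ b → 𝟙 b ≤ 1
  𝟙≤1 true  = ≤-refl
  𝟙≤1 false = z≤n

  𝟙-mono : ∀ {b c} → (b ≡ true → c ≡ true) → 𝟙 b ≤ 𝟙 c
  𝟙-mono {false} _ = z≤n
  𝟙-mono {true}  f rewrite f refl = ≤-refl

  𝟙-positive : ∀ {b} → 0 < 𝟙 b → b ≡ true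
  𝟙-positive {true} _ = refl

  count-cong : ∀ n {P Q} → (∀ i → i < n → P i ≡ Q i) → count n P ≡ count n Q
  count-cong n P≗Q = ∑-cong n λ i i<n → cong 𝟙 (P≗Q i i<n)

  count-mono : ∀ n {P Q} → (∀ i → i < n → P i ≡ true → Q i ≡ true) → count n P ≤ count n Q
  count-mono n P⊆Q = ∑-mono n λ i i<n → 𝟙-mono (P⊆Q i i<n)

  count≤n : ∀ n P → count n P ≤ n
  count≤n n P = ≤-trans (∑≤* n 1 λ i _ → 𝟙≤1 (P i)) (≤-reflexive (*-identityʳ n))

  any-intro : ∀ {n P i} → i < n → P i ≡ true → any n P ≡ true
  any-intro {n} {P} {i} i<n p = <ᵇ-true (≤-trans (≤-reflexive (sym (cong 𝟙 p))) (∑-term n (λ i → 𝟙 (P i)) i<n))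

  any-elim : ∀ {n P} → any n P ≡ true → ∃[ i ] i < n × P i ≡ true
  any-elim {n} {P} p with ∑-positive n (λ i → 𝟙 (P i)) (true-<ᵇ p)
  ... | i , i<n , q = i , i<n , 𝟙-positive q

  any-false : ∀ {n P} → any n P ≡ false → ∀ i → i < n → P i ≡ false
  any-false {n} {P} p i i<n with dichotomy (P i)
  ... | inj₁ q = absurd (any-intro {n} {P} i<n q) p
  ... | inj₂ q = q

  count-empty : ∀ n P → (∀ i → i < n → P i ≡ false) → count n P ≡ 0
  count-empty n P P∅ = ∑-zero n λ i i<n → cong 𝟙 (P∅ i i<n)

  count≤1 : ∀ n P → (∀ i j → i < n → j < n → P i ≡ true → P j ≡ true → i ≡ j) → count n P ≤ 1
  count≤1 zero    P unique = z≤n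
  count≤1 (suc n) P unique with dichotomy (P n)
  ... | inj₁ p = ≤-trans (+-mono-≤ (≤-reflexive (count-empty n P λ i i<n → none i i<n)) (𝟙≤1 (P n))) ≤-refl
    where
    none : ∀ i → i < n → P i ≡ false
    none i i<n with dichotomy (P i)
    ... | inj₁ q = ⊥-elim (<⇒≢ i<n (unique i n (m<n⇒m<1+n i<n) ≤-refl q p))
    ... | inj₂ q = q
  ... | inj₂ p = ≤-trans (≤-reflexive (trans (cong (count n P +_) (cong 𝟙 p)) (+-identityʳ _)))
                   (count≤1 n P λ i j i<n j<n → unique i j (m<n⇒m<1+n i<n) (m<n⇒m<1+n j<n))

  count-split : ∀ n (P Q : ℕ → Bool) → count n P ≡ count n (λ i → P i & Q i) + count n (λ i → P i & ∼ Q i)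
  count-split n P Q = trans (∑-cong n λ i _ → pointwise (P i) (Q i)) (∑-+ n (λ i → 𝟙 (P i & Q i)) (λ i → 𝟙 (P i & ∼ Q i)))
    where
    pointwise : ∀ b c → 𝟙 b ≡ 𝟙 (b & c) + 𝟙 (b & ∼ c)
    pointwise true  true  = refl
    pointwise true  false = refl
    pointwise false c     = refl

  count-∥≤ : ∀ n (P Q : ℕ → Bool) → count n (λ i → P i ∥ Q i) ≤ count n P + count n Q
  count-∥≤ n P Q = ≤-trans (∑-mono n λ i _ → pointwise (P i) (Q i)) (≤-reflexive (∑-+ n (λ i → 𝟙 (P i)) (λ i → 𝟙 (Q i))))
    where
    pointwise : ∀ b c → 𝟙 (b ∥ c) ≤ 𝟙 b + 𝟙 c
    pointwise true  c = m≤m+n 1 _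
    pointwise false c = ≤-refl

  count-cover : ∀ n {P Q S} → (∀ i → i < n → P i ≡ true → Q i ≡ true ⊎ S i ≡ true) → count n P ≤ count n Q + count n S
  count-cover n {P} {Q} {S} P⊆ = ≤-trans
    (count-mono n {Q = λ i → Q i ∥ S i} λ i i<n p → join (P⊆ i i<n p)) (count-∥≤ n Q S)
    where
    join : ∀ {b c} → b ≡ true ⊎ c ≡ true → (b ∥ c) ≡ true
    join (inj₁ p) = ∥-introˡ p
    join {b} (inj₂ p) = ∥-introʳ b p

  count-disjoint : ∀ n {P Q S} → (∀ i → i < n → P i ≡ true → S i ≡ true) → (∀ i → i < n → Q i ≡ true → S i ≡ true) →
                   (∀ i → i < n → P i ≡ true → Q i ≡ false) → count n P + count n Q ≤ count n S
  count-disjoint n {P} {Q} {S} P⊆S Q⊆S P∩Q = ≤-trans (≤-reflexive (sym (∑-+ n (λ i → 𝟙 (P i)) (λ i → 𝟙 (Q i)))))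
    (∑-mono n λ i i<n → pointwise (P⊆S i i<n) (Q⊆S i i<n) (P∩Q i i<n))
    where
    pointwise : ∀ {b c d} → (b ≡ true → d ≡ true) → (c ≡ true → d ≡ true) → (b ≡ true → c ≡ false) → 𝟙 b + 𝟙 c ≤ 𝟙 d
    pointwise {true}  {c}     f g h rewrite h refl | f refl = ≤-refl
    pointwise {false} {true}  f g h rewrite g refl = ≤-refl
    pointwise {false} {false} f g h = z≤n

  ∑-single : ∀ n x {i} → i < n → ∑ n (λ g → if eq i g then x else 0) ≡ x
  ∑-single (suc n) x {i} i<1+n with i ≟ n
  ... | yes refl = cong₂ _+_ (∑-zero n λ g g<n → if-false (eq-false (λ i≡g → <⇒≢ g<n (sym i≡g)))) (if-true (eq-intro {n} refl))
  ... | no  i≢n  = trans (cong₂ _+_ (∑-single n x (≤∧≢⇒< (s≤s⁻¹ i<1+n) i≢n)) (if-false (eq-false i≢n))) (+-identityʳ x)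

  ∑-single≤ : ∀ n x i → ∑ n (λ g → if eq i g then x else 0) ≤ x
  ∑-single≤ n x i with i <? n
  ... | yes i<n = ≤-reflexive (∑-single n x i<n)
  ... | no  i≮n = ≤-trans (≤-reflexive (∑-zero n λ g g<n → if-false (eq-false (λ i≡g → i≮n (subst (_< n) (sym i≡g) g<n))))) z≤n

  -- Only where `f` is positive must `c` stay in range, so that points outside all classes may be
  -- sent to the marker `n`.
  ∑-fibres : ∀ n (c f : ℕ → ℕ) → (∀ p → p < n → 0 < f p → c p < n) → ∑ n f ≡ ∑ n (λ g → ∑ n (λ p → if eq (c p) g then f p else 0))
  ∑-fibres n c f c<n = trans (∑-cong n λ p p<n → sym (pointwise p p<n)) (∑-swap n n (λ p g → if eq (c p) g then f p else 0))
    where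
    pointwise : ∀ p → p < n → ∑ n (λ g → if eq (c p) g then f p else 0) ≡ f p
    pointwise p p<n with 0 <? f p
    ... | yes 0<fp = ∑-single n (f p) (c<n p p<n 0<fp)
    ... | no  0≮fp = trans (n≤0⇒n≡0 (≤-trans (∑-single≤ n (f p) (c p)) (≮⇒≥ 0≮fp))) (sym (n≤0⇒n≡0 (≮⇒≥ 0≮fp)))

  ∑-fibres≤ : ∀ n (c f : ℕ → ℕ) → ∑ n (λ g → ∑ n (λ p → if eq (c p) g then f p else 0)) ≤ ∑ n f
  ∑-fibres≤ n c f = ≤-trans (≤-reflexive (sym (∑-swap n n (λ p g → if eq (c p) g then f p else 0)))) (∑-mono n λ p _ → ∑-single≤ n (f p) (c p))

  𝟙-& : ∀ b c → 𝟙 (b & c) ≡ (if b then 𝟙 c else 0)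
  𝟙-& true  c = refl
  𝟙-& false c = refl

  if-*𝟙 : ∀ b x → (if b then x else 0) ≡ x * 𝟙 b
  if-*𝟙 true  x = sym (*-identityʳ x)
  if-*𝟙 false x = sym (*-zeroʳ x)

  least : ∀ n (P : ℕ → Bool) → P n ≡ true → ∃[ m ] m ≤ n × P m ≡ true × (∀ i → i < m → P i ≡ false)
  least zero    P p = 0 , z≤n , p , λ _ ()
  least (suc n) P p with dichotomy (P 0)
  ... | inj₁ q = 0 , z≤n , q , λ _ ()
  ... | inj₂ q with least n (λ i → P (suc i)) p
  ...   | m , m≤n , r , below = suc m , s≤s m≤n , r , λ { zero _ → q ; (suc i) (s≤s i<m) → below i i<m }

  -- The layer decomposition of a number. It turns sums of weights into sums over levels, and
  -- identifies an index with the count of the indices before it.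
  ∑-below : ∀ {n x} → x ≤ n → ∑ n (λ v → 𝟙 (v <ᵇ x)) ≡ x
  ∑-below {zero} {zero} _ = refl
  ∑-below {suc n} {x} x≤1+n with x ≟ suc n
  ... | yes refl = trans (cong₂ _+_ (trans (∑-cong n λ v v<n → cong 𝟙 (trans (<ᵇ-true (m<n⇒m<1+n v<n)) (sym (<ᵇ-true v<n)))) (∑-below {n} ≤-refl))
                     (cong 𝟙 (<ᵇ-true {n} ≤-refl))) (+-comm n 1)
  ... | no x≢    = trans (cong₂ _+_ (∑-below x≤n) (cong 𝟙 (<ᵇ-false x≤n))) (+-identityʳ x)
    where x≤n = s≤s⁻¹ (≤∧≢⇒< x≤1+n x≢)

  -- The preorder is arbitrary because the reverse order is used for maxima, and because the values
  -- are weights in one place and rational distances in another.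
  optimum : ∀ {A : Set} {_≼_ : A → A → Set} → (∀ {x} → x ≼ x) → (∀ {x y z} → x ≼ y → y ≼ z → x ≼ z) →
            (∀ x y → x ≼ y ⊎ y ≼ x) → ∀ m (P : ℕ → Bool) (f : ℕ → A) →
            (∀ i → i < m → P i ≡ false) ⊎ ∃[ u ] u < m × P u ≡ true × (∀ i → i < m → P i ≡ true → f u ≼ f i)
  optimum rfl trs tot zero    P f = inj₁ λ _ ()
  optimum {_≼_ = _≼_} rfl trs tot (suc m) P f = extend (optimum {_≼_ = _≼_} rfl trs tot m P f) (dichotomy (P m))
    where
    below : ∀ {Q : ℕ → Set} → (∀ i → i < m → Q i) → Q m → ∀ i → i < suc m → Q i
    below {Q} q qm i i<1+m = Sum.[ q i , (λ i≡m → subst Q (sym i≡m) qm) ] (m≤n⇒m<n∨m≡n (s≤s⁻¹ i<1+m))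
    extend : (∀ i → i < m → P i ≡ false) ⊎ (∃[ u ] u < m × P u ≡ true × (∀ i → i < m → P i ≡ true → f u ≼ f i)) →
             P m ≡ true ⊎ P m ≡ false →
             (∀ i → i < suc m → P i ≡ false) ⊎ ∃[ u ] u < suc m × P u ≡ true × (∀ i → i < suc m → P i ≡ true → f u ≼ f i)
    extend (inj₁ none) (inj₂ p) = inj₁ (below none p)
    extend (inj₁ none) (inj₁ p) = inj₂ (m , ≤-refl , p , below (λ i i<m q → absurd q (none i i<m)) (λ _ → rfl))
    extend (inj₂ (u , u<m , Pu , opt)) (inj₂ p) = inj₂ (u , m<n⇒m<1+n u<m , Pu , below opt (λ q → absurd q p))
    extend (inj₂ (u , u<m , Pu , opt)) (inj₁ p) with tot (f u) (f m)
    ... | inj₁ u≼m = inj₂ (u , m<n⇒m<1+n u<m , Pu , below opt (λ _ → u≼m))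
    ... | inj₂ m≼u = inj₂ (m , ≤-refl , p , below (λ i i<m q → trs m≼u (opt i i<m q)) (λ _ → rfl))

  -- The number of indices with no index satisfying P up to and including
  -- them is the least index satisfying P.
  first-satisfies : ∀ G (P : ℕ → Bool) {g} → g < G → P g ≡ true → P (∑ G λ g → 𝟙 (∼ any G λ h → P h & ∼ (g <ᵇ h))) ≡ true
  first-satisfies G P {g} g<G Pg with least g P Pg
  ... | m , m≤g , Pm , below = subst (λ x → P x ≡ true)
      (sym (trans (∑-cong G λ i i<G → cong 𝟙 (bool-ext (before i) (none i))) (∑-below (<⇒≤ m<G)))) Pm
    where
    m<G = ≤-trans (s≤s m≤g) g<G
    before : ∀ i → ∼ any G (λ h → P h & ∼ (i <ᵇ h)) ≡ true → (i <ᵇ m) ≡ true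
    before i p with i <? m
    ... | yes i<m = <ᵇ-true i<m
    ... | no  i≮m = absurd (any-intro {G} {λ h → P h & ∼ (i <ᵇ h)} m<G (&-intro Pm (≮ᵇ-intro (≮⇒≥ i≮m)))) (∼-elim p)
    none : ∀ i → (i <ᵇ m) ≡ true → ∼ any G (λ h → P h & ∼ (i <ᵇ h)) ≡ true
    none i i<m with dichotomy (any G (λ h → P h & ∼ (i <ᵇ h)))
    ... | inj₂ p = ∼-intro p
    ... | inj₁ p with any-elim {G} {λ h → P h & ∼ (i <ᵇ h)} p
    ...   | h , _ , q = absurd (&-fst (P h) q) (below h (≤-trans (s≤s (≮ᵇ-elim (&-snd (P h) q))) (true-<ᵇ i<m)))

-- Hops and dense balls

module GraphLemmas
  (n : ℕ) (adj : ℕ → ℕ → Bool)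
  (adj-sym : ∀ i j → adj i j ≡ true → adj j i ≡ true)
  (adj-refl : ∀ i → i < n → adj i i ≡ true)
  (adj-range : ∀ i j → adj i j ≡ true → j < n)
  where
  open import Relation.Binary.Definitions using (tri<; tri≈; tri>)
  open Sums
  open SumLemmas
  open Algorithm
  open Graph n adj

  adj-rangeˡ : ∀ i j → adj i j ≡ true → i < n
  adj-rangeˡ i j p = adj-range j i (adj-sym i j p)

  hop₂-intro : ∀ {i} u {j} → adj i u ≡ true → adj u j ≡ true → hop₂ i j ≡ true
  hop₂-intro {i} u p q = any-intro {n} (adj-range i u p) (&-intro p q)

  hop₂-elim : ∀ {i j} → hop₂ i j ≡ true → ∃[ u ] adj i u ≡ true × adj u j ≡ true
  hop₂-elim {i} {j} p with any-elim {n} {λ u → adj i u & adj u j} p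
  ... | u , _ , q = u , &-fst (adj i u) q , &-snd (adj i u) q

  hop₃-intro : ∀ {i} u v {j} → adj i u ≡ true → adj u v ≡ true → adj v j ≡ true → hop₃ i j ≡ true
  hop₃-intro {i} u v p q r = any-intro {n} (adj-range i u p) (&-intro p (hop₂-intro v q r))

  hop₃-elim : ∀ {i j} → hop₃ i j ≡ true → ∃[ u ] ∃[ v ] adj i u ≡ true × adj u v ≡ true × adj v j ≡ true
  hop₃-elim {i} {j} p with any-elim {n} {λ u → adj i u & hop₂ u j} p
  ... | u , _ , q with hop₂-elim (&-snd (adj i u) q)
  ...   | v , r , s = u , v , &-fst (adj i u) q , r , s

  hop₂-sym : ∀ {i j} → hop₂ i j ≡ true → hop₂ j i ≡ true
  hop₂-sym p with hop₂-elim p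
  ... | u , q , r = hop₂-intro u (adj-sym _ _ r) (adj-sym _ _ q)

  hop₂-refl : ∀ {i} → i < n → hop₂ i i ≡ true
  hop₂-refl {i} i<n = hop₂-intro i (adj-refl i i<n) (adj-refl i i<n)

  hop₂⇒hop₃ : ∀ {i j} → hop₂ i j ≡ true → hop₃ i j ≡ true
  hop₂⇒hop₃ {i} p with hop₂-elim p
  ... | u , q , r = hop₃-intro i u (adj-refl i (adj-rangeˡ i u q)) q r

  hop₂-rangeˡ : ∀ {i j} → hop₂ i j ≡ true → i < n
  hop₂-rangeˡ {i} p with hop₂-elim p
  ... | u , q , _ = adj-rangeˡ i u q

  hop₃-rangeˡ : ∀ {i j} → hop₃ i j ≡ true → i < n
  hop₃-rangeˡ {i} p with hop₃-elim p
  ... | u , _ , q , _ = adj-rangeˡ i u q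

  cov : (ℕ → Bool) → ℕ → Bool
  cov O p = any n λ o → O o & adj o p

  cov-intro : ∀ {O} o {p} → O o ≡ true → adj o p ≡ true → cov O p ≡ true
  cov-intro o {p} Oo o~p = any-intro {n} (adj-rangeˡ o p o~p) (&-intro Oo o~p)

  cov-elim : ∀ {O p} → cov O p ≡ true → ∃[ o ] o < n × O o ≡ true × adj o p ≡ true
  cov-elim {O} {p} q with any-elim {n} {λ o → O o & adj o p} q
  ... | o , o<n , r = o , o<n , &-fst (O o) r , &-snd (O o) r

  module DenseLemmas (red U : ℕ → Bool) (τ : ℕ) where
    open Dense red U τ

    stage : ℕ → ℕ → ℕ
    stage = iterate n (λ _ → n) denseStep

    owner≡ : ∀ p → owner p ≡ stage n p
    owner≡ p = cong (λ t → stage t p) (clip-≤ {n} ≤-refl)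

    -- Density is measured when round `g` comes, on the points that the earlier rounds left free.
    isDense : ℕ → Bool
    isDense g = τ + τ <ᵇ reds (stage g) g

    -- The paper's I_g: the balls sharing more than τ red points with a dense ball.
    near : ℕ → ℕ → Bool
    near g i = isDense g & (τ <ᵇ common (stage g) g i)

    step : ∀ t p → p < n → stage (suc t) p ≡ denseStep t (stage t) p
    step t p p<n = table-< (denseStep t (stage t)) p<n

    free-intro : ∀ A {p} → p < n → U p ≡ false → n ≤ A p → free A p ≡ true
    free-intro A {p} p<n Up n≤ = &-intro (<ᵇ-true p<n) (&-intro (∼-intro Up) (≮ᵇ-intro {A p} n≤))

    free-elim : ∀ A {p} → free A p ≡ true → p < n × U p ≡ false × n ≤ A p
    free-elim A {p} f with &₃-elim (p <ᵇ n) (∼ U p) f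
    ... | p<n , Up , Ap = true-<ᵇ p<n , ∼-elim Up , ≮ᵇ-elim Ap

    owned-not-free : ∀ {A p} → A p < n → free A p ≡ false
    owned-not-free {A} {p} A<n with dichotomy (free A p)
    ... | inj₁ f = ⊥-elim (<⇒≱ A<n (proj₂ (proj₂ (free-elim A f))))
    ... | inj₂ f = f

    keep : ∀ t p → p < n → stage t p < n → stage (suc t) p ≡ stage t p
    keep t p p<n own = trans (step t p p<n) (if-false (&-falseˡ (owned-not-free {stage t} own)))

    keep* : ∀ s t p → p < n → stage t p < n → stage (s + t) p ≡ stage t p
    keep* zero    t p p<n own = refl
    keep* (suc s) t p p<n own =
      trans (keep (s + t) p p<n (subst (_< n) (sym (keep* s t p p<n own)) own)) (keep* s t p p<n own)

    keep≤ : ∀ {s t} p → p < n → s ≤ t → stage s p < n → stage t p ≡ stage s p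
    keep≤ {s} {t} p p<n s≤t own = subst (λ z → stage z p ≡ stage s p) (m∸n+n≡m s≤t) (keep* (t ∸ s) s p p<n own)

    free-back : ∀ {s t p} → s ≤ t → free (stage t) p ≡ true → free (stage s) p ≡ true
    free-back {s} {t} {p} s≤t f with free-elim (stage t) f | stage s p <? n
    ... | p<n , Up , n≤ | yes own = ⊥-elim (<⇒≱ own (≤-trans n≤ (≤-reflexive (keep≤ p p<n s≤t own))))
    ... | p<n , Up , n≤ | no ¬own = free-intro (stage s) p<n Up (≮⇒≥ ¬own)

    record Origin (p : ℕ) (g : ℕ) : Set where
      field
        was-free : free (stage g) p ≡ true
        dense    : isDense g ≡ true
        via      : ℕ
        via-adj  : adj via p ≡ true
        via-near : (τ <ᵇ common (stage g) g via) ≡ true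

    origin : ∀ t p → p < n → stage t p < n → stage t p < t × Origin p (stage t p)
    origin zero p p<n own = ⊥-elim (<⇒≢ own (table-< (λ _ → n) p<n))
    origin (suc t) p p<n own with dichotomy (free (stage t) p & isDense t & any n (λ i → adj i p & (τ <ᵇ common (stage t) t i)))
    ... | inj₁ c with &₃-elim (free (stage t) p) (isDense t) c
    ...   | f , d , a with any-elim {n} {λ i → adj i p & (τ <ᵇ common (stage t) t i)} a
    ...     | i , i<n , q = subst (λ z → z < suc t × Origin p z) (sym (trans (step t p p<n) (if-true c)))
      (≤-refl , record { was-free = f ; dense = d ; via = i ; via-adj = &-fst (adj i p) q ; via-near = &-snd (adj i p) q })
    origin (suc t) p p<n own | inj₂ c =
      subst (λ z → z < suc t × Origin p z) (sym same) (m<n⇒m<1+n (proj₁ before) , proj₂ before)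
      where
      same = trans (step t p p<n) (if-false c)
      before = origin t p p<n (subst (_< n) same own)

    capture : ∀ {g i p} → near g i ≡ true → adj i p ≡ true → free (stage g) p ≡ true → stage (suc g) p ≡ g
    capture {g} {i} {p} near ip f = trans (step g p (adj-range i p ip)) (if-true
      (&-intro₃ f (&-fst (isDense g) near)
        (any-intro {n} {λ i → adj i p & (τ <ᵇ common (stage g) g i)} (adj-rangeˡ i p ip) (&-intro ip (&-snd (isDense g) near)))))

    -- Round `g` takes all free points of a ball near `g`, and owned points stay owned.
    captured : ∀ {g i p t} → g < t → g < n → near g i ≡ true → adj i p ≡ true → free (stage t) p ≡ true → ∀ {A : Set} → A
    captured {g} {i} {p} {t} g<t g<n near ip f =
      ⊥-elim (<⇒≱ own<n (proj₂ (proj₂ (free-elim (stage (suc g)) (free-back g<t f)))))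
      where own<n = subst (_< n) (sym (capture near ip (free-back (<⇒≤ g<t) f))) g<n

    shared : ℕ → ℕ → ℕ → Bool
    shared g i x = adj g x & adj i x & red x & free (stage g) x

    ball : ℕ → ℕ → Bool
    ball g x = adj g x & red x & free (stage g) x

    -- From the owner the path leads to a red point that it shares with the ball of `via`, on to
    -- `via`, and to `p`. These three hops are the whole allowance of the approximation.
    owned-hop₃ : ∀ {p} → p < n → stage n p < n → hop₃ (stage n p) p ≡ true × U p ≡ false
    owned-hop₃ {p} p<n own with origin n p p<n own
    ... | _ , record { was-free = f ; via = i ; via-adj = ip ; via-near = near }
      with ∑-positive n (λ x → 𝟙 (shared (stage n p) i x)) (≤-trans (s≤s z≤n) (true-<ᵇ near))
    ... | x , x<n , 0< with &₃-elim (adj (stage n p) x) (adj i x) (𝟙-positive 0<)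
    ... | gx , ix , _ = hop₃-intro x i gx (adj-sym i x ix) ip , proj₁ (proj₂ (free-elim (stage (stage n p)) f))

    -- A dense ball shares all its free red points with itself, so it is near itself and its own
    -- round leaves no free point in it. A ball that is not dense in its round can only lose free
    -- points afterwards.
    reds≤ : ∀ j → j < n → reds (stage n) j ≤ τ + τ
    reds≤ j j<n with dichotomy (isDense j)
    ... | inj₂ d = ≤-trans (count-mono n {Q = ball j} λ x x<n c → let jx , rx , fx = &₃-elim (adj j x) (red x) c in
                     &-intro₃ jx rx (free-back (<⇒≤ j<n) fx)) (false-<ᵇ d)
    ... | inj₁ d = ≤-trans (≤-reflexive (count-empty n (λ x → adj j x & red x & free (stage n) x) none)) z≤n
      where
      self : near j j ≡ true
      self = &-intro d (<ᵇ-true (≤-trans (s≤s (m≤m+n τ τ)) (≤-trans (true-<ᵇ d)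
               (count-mono n {ball j} {shared j j} λ x x<n c → &-intro (&-fst (adj j x) c) c))))
      none : ∀ x → x < n → adj j x & red x & free (stage n) x ≡ false
      none x x<n with dichotomy (adj j x & red x & free (stage n) x)
      ... | inj₁ c = let jx , rx , fx = &₃-elim (adj j x) (red x) c in captured j<n j<n self jx fx
      ... | inj₂ c = c

    -- The red points won when the ball of o is replaced by the flower of q.
    gained : ℕ → ℕ → ℕ → Bool
    gained o q x = (hop₂ q x & red x & ∼ U x) & ∼ adj o x

    module Centers (O : ℕ → Bool)
      (gain≤ : ∀ o q → O o ≡ true → adj o q ≡ true → count n (gained o q) ≤ τ) where

      -- The flower of `q` contains the ball around every neighbour of `q`, so the part of the ball
      -- of `g` outside the ball of `o` counts towards the gain of `q`.
      ball-gain : ∀ {o q g} → O o ≡ true → adj o q ≡ true → adj g q ≡ true → count n (λ x → ball g x & ∼ adj o x) ≤ τ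
      ball-gain {o} {q} {g} Oo oq gq = ≤-trans (count-mono n λ x x<n c →
        let gx , rx , fx = &₃-elim (adj g x) (red x) (&-fst (ball g x) c) in
        &-intro (&-intro₃ (hop₂-intro g (adj-sym g q gq) gx) rx (∼-intro (proj₁ (proj₂ (free-elim (stage g) fx)))))
                (&-snd (ball g x) c)) (gain≤ o q Oo oq)

      -- A ball of O meeting the points owned by g shares more than τ red
      -- points with the dense ball at g: otherwise its gain would exceed τ.
      meets⇒near : ∀ {o p g} → O o ≡ true → adj o p ≡ true → Origin p g → near g o ≡ true
      meets⇒near {o} {p} {g} Oo o~p record { was-free = f ; dense = d ; via = i ; via-adj = ip ; via-near = near } =
        -- If at most `τ` red points were shared with `o`, the dense ball would have at most `2τ`,
        -- as the others lie in the flower of `q` and outside the ball of `o`.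
        &-intro d (<ᵇ-true (≰⇒> λ le → <⇒≱ (true-<ᵇ d) (≤-trans (≤-reflexive (count-split n (ball g) (adj o)))
          (+-mono-≤ (≤-trans (count-mono n {Q = shared g o} inside) le) (ball-gain Oo oq gq)))))
        where
        -- The flower of `p` contains the ball of `i`, so at most `τ` of the points shared by `g`
        -- and `i` avoid the ball of `o`. More than `τ` are shared, hence some `q` lies in all three
        -- balls.
        outside≤ : count n (λ x → shared g i x & ∼ adj o x) ≤ τ
        outside≤ = ≤-trans (count-mono n λ x x<n c →
          let gx , ix , rx , fx = &₄-elim (adj g x) (adj i x) (red x) (&-fst (shared g i x) c) in
          &-intro (&-intro₃ (hop₂-intro i (adj-sym i p ip) ix) rx (∼-intro (proj₁ (proj₂ (free-elim (stage g) fx)))))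
                  (&-snd (shared g i x) c)) (gain≤ o p Oo o~p)
        meeting : 0 < count n (λ x → shared g i x & adj o x)
        meeting = ≰⇒> λ le → <⇒≱ (true-<ᵇ near) (≤-trans (≤-reflexive (count-split n (shared g i) (adj o)))
                    (+-mono-≤ le outside≤))
        point = ∑-positive n (λ x → 𝟙 (shared g i x & adj o x)) meeting
        q = proj₁ point
        both = 𝟙-positive (proj₂ (proj₂ point))
        oq : adj o q ≡ true
        oq = &-snd (shared g i q) both
        gq : adj g q ≡ true
        gq = proj₁ (&₃-elim (adj g q) (adj i q) (&-fst (shared g i q) both))
        inside : ∀ x → x < n → ball g x & adj o x ≡ true → shared g o x ≡ true
        inside x _ c = let gx , rx , fx = &₃-elim (adj g x) (red x) (&-fst (ball g x) c) in
          &-intro₄ gx (&-snd (ball g x) c) rx fx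

      -- The balls of `O` captured by some dense region, the balls captured by none, and the owners
      -- of the regions that capture at least one.
      Oᵈ Oˢ Sᵈ : ℕ → Bool
      Oᵈ o = O o & any n (λ g → near g o)
      Oˢ o = O o & ∼ any n (λ g → near g o)
      Sᵈ g = any n λ o → O o & near g o

      -- Sharing with `h` is measured on points still free in round `h`, but the earlier round `g`
      -- has left no free point in the ball of `o`.
      near-once : ∀ {o g h} → g < h → g < n → near g o ≡ true → near h o ≡ true → ∀ {A : Set} → A
      near-once {o} {g} {h} g<h g<n go ho with ∑-positive n (λ x → 𝟙 (shared h o x)) (≤-trans (s≤s z≤n) (true-<ᵇ (&-snd (isDense h) ho)))
      ... | x , x<n , 0< with &₄-elim (adj h x) (adj o x) (red x) (𝟙-positive 0<)
      ... | _ , ox , _ , fx = captured g<h g<n go ox fx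

      near-unique : ∀ o g h → g < n → h < n → near g o ≡ true → near h o ≡ true → g ≡ h
      near-unique o g h g<n h<n go ho with <-cmp g h
      ... | tri< g<h _ _ = near-once g<h g<n go ho
      ... | tri≈ _ g≡h _ = g≡h
      ... | tri> _ _ h<g = near-once h<g h<n ho go

      -- Each owner in `Sᵈ` is charged to a ball that it captures; a ball is near at most one dense
      -- ball and so is charged at most once.
      dense-count : count n Sᵈ ≤ count n Oᵈ
      dense-count = begin
        count n Sᵈ                                    ≤⟨ ∑-mono n (λ g g<n → pick g (dichotomy (Sᵈ g))) ⟩
        ∑ n (λ g → ∑ n (λ o → 𝟙 (O o & near g o)))    ≡⟨ ∑-swap n n (λ g o → 𝟙 (O o & near g o)) ⟩
        ∑ n (λ o → ∑ n (λ g → 𝟙 (O o & near g o)))    ≤⟨ ∑-mono n (λ o o<n → once o o<n) ⟩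
        count n Oᵈ                                    ∎
        where
        open ≤-Reasoning
        pick : ∀ g → Sᵈ g ≡ true ⊎ Sᵈ g ≡ false → 𝟙 (Sᵈ g) ≤ ∑ n (λ o → 𝟙 (O o & near g o))
        pick g (inj₁ p) with any-elim {n} {λ o → O o & near g o} p
        ... | o , o<n , q = ≤-trans (𝟙≤1 (Sᵈ g)) (≤-trans (≤-reflexive (sym (cong 𝟙 q))) (∑-term n (λ o → 𝟙 (O o & near g o)) o<n))
        pick g (inj₂ p) = ≤-trans (≤-reflexive (cong 𝟙 p)) z≤n
        once : ∀ o → o < n → ∑ n (λ g → 𝟙 (O o & near g o)) ≤ 𝟙 (Oᵈ o)
        once o o<n with dichotomy (Oᵈ o)
        ... | inj₁ p = ≤-trans (count≤1 n (λ g → O o & near g o) λ g h g<n h<n go ho →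
                          near-unique o g h g<n h<n (&-snd (O o) go) (&-snd (O o) ho)) (≤-reflexive (sym (cong 𝟙 p)))
        ... | inj₂ p = ≤-trans (≤-reflexive (count-empty n (λ g → O o & near g o) none)) z≤n
          where
          none : ∀ g → g < n → O o & near g o ≡ false
          none g g<n with dichotomy (O o & near g o)
          ... | inj₂ q = q
          ... | inj₁ q = absurd (&-intro (&-fst (O o) q) (any-intro {n} {λ g → near g o} g<n (&-snd (O o) q))) p

      split-count : count n O ≡ count n Oᵈ + count n Oˢ
      split-count = count-split n O (λ o → any n (λ g → near g o))

      -- If the point is owned, its ball meets a region and so is near the owner. If it is still
      -- free at the end, its ball is near no dense ball, as it would have been captured with it.
      covered-split : ∀ {p} → U p ≡ false → cov O p ≡ true →
        (stage n p < n × Sᵈ (stage n p) ≡ true) ⊎ (free (stage n) p ≡ true × cov Oˢ p ≡ true)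
      covered-split {p} Up c with cov-elim {O} c
      ... | o , o<n , Oo , o~p with stage n p <? n
      ...   | yes own = inj₁ (own , any-intro {n} o<n (&-intro Oo (meets⇒near Oo o~p (proj₂ (origin n p p<n own)))))
        where p<n = adj-range o p o~p
      ...   | no ¬own = inj₂ (f , cov-intro {Oˢ} o (&-intro Oo (∼-intro far)) o~p)
        where
        f = free-intro (stage n) (adj-range o p o~p) Up (≮⇒≥ ¬own)
        far : any n (λ g → near g o) ≡ false
        far with dichotomy (any n (λ g → near g o))
        ... | inj₂ q = q
        ... | inj₁ q with any-elim {n} {λ g → near g o} q
        ...   | g , g<n , go = captured g<n g<n go o~p f

      -- The free red points of the flower of `p` that lie in the ball of `o` number at most `2τ`,
      -- as no dense ball is left; those outside are gained by replacing `o` with the flower of `p`,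
      -- and so number at most `τ`.
      sparse-light : ∀ {p} → free (stage n) p ≡ true → cov Oˢ p ≡ true → light (stage n) p ≡ true
      sparse-light {p} f c with cov-elim {Oˢ} c
      ... | o , o<n , Oˢo , o~p = &-intro f (≮ᵇ-intro (≤-trans (≤-reflexive (count-split n F (adj o)))
              (+-mono-≤ (≤-trans (count-mono n inside) (reds≤ o o<n)) (≤-trans (count-mono n outside) (gain≤ o p Oo o~p)))))
        where
        Oo = &-fst (O o) Oˢo
        F : ℕ → Bool
        F x = hop₂ p x & red x & free (stage n) x
        inside : ∀ x → x < n → F x & adj o x ≡ true → adj o x & red x & free (stage n) x ≡ true
        inside x _ q = &-intro (&-snd (F x) q) (&-snd (hop₂ p x) (&-fst (F x) q))
        outside : ∀ x → x < n → F x & ∼ adj o x ≡ true → gained o p x ≡ true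
        outside x _ q = let px , rx , fx = &₃-elim (hop₂ p x) (red x) (&-fst (F x) q) in
          &-intro (&-intro₃ px rx (∼-intro (proj₁ (proj₂ (free-elim (stage n) fx))))) (&-snd (F x) q)

-- Packing numbers in base n + 1

module Pairing (n : ℕ) where
  open import Data.Nat.DivMod
  open import Data.Nat.Divisibility using (n∣m*n)
  open Algorithm using (quot; rem)

  quot-pair : ∀ x {y} → y ≤ n → quot (1 + n) (x * (1 + n) + y) ≡ x
  quot-pair x {y} y≤n = trans (+-distrib-/-∣ˡ {x * (1 + n)} y (n∣m*n x))
    (trans (cong₂ _+_ (m*n/n≡m x (1 + n)) (m<n⇒m/n≡0 (s≤s y≤n))) (+-identityʳ x))

  rem-pair : ∀ x {y} → y ≤ n → rem (1 + n) (x * (1 + n) + y) ≡ y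
  rem-pair x {y} y≤n = trans (cong (λ z → x * (1 + n) + y ∸ z * (1 + n)) (quot-pair x y≤n)) (m+n∸m≡n (x * (1 + n)) y)

  quot-mono : ∀ {x y} → x ≤ y → quot (1 + n) x ≤ quot (1 + n) y
  quot-mono x≤y = /-monoˡ-≤ (1 + n) x≤y

  pair< : ∀ {x y k} → x < k → y ≤ n → x * (1 + n) + y < k * (1 + n)
  pair< {x} {y} {k} x<k y≤n = begin-strict
    x * (1 + n) + y           <⟨ +-monoʳ-< (x * (1 + n)) (s≤s y≤n) ⟩
    x * (1 + n) + (1 + n)     ≡⟨ +-comm (x * (1 + n)) (1 + n) ⟩
    suc x * (1 + n)           ≤⟨ *-monoˡ-≤ (1 + n) x<k ⟩
    k * (1 + n)               ∎ where open ≤-Reasoning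

-- Greedy clusters and the relaxation method

module SparseLemmas
  (n : ℕ) (adj : ℕ → ℕ → Bool)
  (adj-sym : ∀ i j → adj i j ≡ true → adj j i ≡ true)
  (adj-refl : ∀ i → i < n → adj i i ≡ true)
  (adj-range : ∀ i j → adj i j ≡ true → j < n)
  (red L : ℕ → Bool) (L-range : ∀ p → L p ≡ true → p < n)
  where
  open Sums
  open SumLemmas
  open Algorithm
  open Graph n adj
  open GraphLemmas n adj adj-sym adj-refl adj-range
  open Sparse red L
  open Pairing n

  side : Bool → ℕ → Bool
  side c p = if c then red p else ∼ red p

  member? : Bool → ℕ → Bool
  member? c p = L p & side c p

  centerMass : (ℕ → ℕ) → ℕ → ℕ
  centerMass z g = if eq (cluster z g) g then z g else 0

  module ClusterLemmas (z : ℕ → ℕ) (z≤N : ∀ p → p < n → z p ≤ N) where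

    stage : ℕ → ℕ → ℕ
    stage = iterate n (λ _ → n) (clusterStep z)

    leader level : ℕ → ℕ
    leader t = rem M t
    level t  = N ∸ quot M t

    record Joins (t p : ℕ) : Set where
      constructor joins
      field
        point-in     : L p ≡ true
        point-free   : n ≤ stage t p
        leader-in    : L (leader t) ≡ true
        leader-free  : n ≤ stage t (leader t)
        leader-level : level t ≤ z (leader t)
        close        : hop₂ (leader t) p ≡ true

    step : ∀ t p → p < n → (stage (suc t) p ≡ leader t × Joins t p) ⊎ stage (suc t) p ≡ stage t p
    step t p p<n with dichotomy (L p & ∼ (stage t p <ᵇ n) & L (leader t) & ∼ (stage t (leader t) <ᵇ n) &
                                 ∼ (z (leader t) <ᵇ level t) & hop₂ (leader t) p)
    ... | inj₂ c = inj₂ (trans (table-< (clusterStep z t (stage t)) p<n) (if-false c))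
    ... | inj₁ c with &₄-elim (L p) (∼ (stage t p <ᵇ n)) (L (leader t)) c
    ...   | Lp , fp , Ll , c′ with &₃-elim (∼ (stage t (leader t) <ᵇ n)) (∼ (z (leader t) <ᵇ level t)) c′
    ...     | fl , zl , h = inj₁ (trans (table-< (clusterStep z t (stage t)) p<n) (if-true c) ,
                joins Lp (≮ᵇ-elim fp) Ll (≮ᵇ-elim fl) (≮ᵇ-elim zl) h)

    joined : ∀ {t p} → Joins t p → stage (suc t) p ≡ leader t
    joined {t} {p} (joins Lp fp Ll fl zl h) = trans (table-< (clusterStep z t (stage t)) (L-range p Lp))
      (if-true (&-intro₄ Lp (≮ᵇ-intro fp) Ll (&-intro₃ (≮ᵇ-intro fl) (≮ᵇ-intro zl) h)))

    keep : ∀ t p → p < n → stage t p < n → stage (suc t) p ≡ stage t p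
    keep t p p<n own with step t p p<n
    ... | inj₁ (_ , j) = ⊥-elim (<⇒≱ own (Joins.point-free j))
    ... | inj₂ same    = same

    keep-owned : ∀ s t p → p < n → stage t p < n → stage (s + t) p < n
    keep-owned zero    t p p<n own = own
    keep-owned (suc s) t p p<n own = subst (_< n) (sym (keep (s + t) p p<n o)) o
      where o = keep-owned s t p p<n own

    visit : ℕ → ℕ
    visit p = (N ∸ z p) * M + p

    -- In round `visit p` the level has come down to `z p` and `p` is the prospective leader; if it
    -- is still free, it joins a cluster of its own, being within two hops of itself.
    visited : ∀ {t p} → L p ≡ true → visit p < t → stage t p < n
    visited {t} {p} Lp v<t = subst (λ s → stage s p < n) (m∸n+n≡m v<t)
        (keep-owned (t ∸ suc (visit p)) (suc (visit p)) p p<n at-visit)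
      where
      p<n = L-range p Lp
      lead : leader (visit p) ≡ p
      lead = rem-pair (N ∸ z p) (<⇒≤ p<n)
      level≤ : level (visit p) ≤ z p
      level≤ = ≤-reflexive (trans (cong (N ∸_) (quot-pair (N ∸ z p) (<⇒≤ p<n))) (m∸[m∸n]≡n (z≤N p p<n)))
      at-visit : stage (suc (visit p)) p < n
      at-visit with stage (visit p) p <? n
      ... | yes own = keep-owned 1 (visit p) p p<n own
      ... | no ¬own = subst (_< n) (sym (trans (joined join) lead)) p<n
        where
        join : Joins (visit p) p
        join = joins Lp (≮⇒≥ ¬own) (subst (λ l → L l ≡ true) (sym lead) Lp)
          (subst (λ l → n ≤ stage (visit p) l) (sym lead) (≮⇒≥ ¬own))
          (subst (λ l → level (visit p) ≤ z l) (sym lead) level≤)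
          (subst (λ l → hop₂ l p ≡ true) (sym lead) (hop₂-refl p<n))

    -- This is what proceeding by levels achieves: a point that is still free has a value not above
    -- the current level, hence not above that of a leader opened now.
    free-level : ∀ {t p} → L p ≡ true → n ≤ stage t p → z p ≤ level t
    free-level {t} {p} Lp free = ≤-trans (≤-reflexive (sym (m∸[m∸n]≡n (z≤N p p<n)))) (∸-monoʳ-≤ N
        (≤-trans (quot-mono (≮⇒≥ λ v<t → <⇒≱ (visited {t} Lp v<t) free)) (≤-reflexive (quot-pair (N ∸ z p) (<⇒≤ p<n)))))
      where p<n = L-range p Lp

    record Member (t p c : ℕ) : Set where
      constructor member
      field
        point-in  : L p ≡ true
        leader-in : L c ≡ true
        leads     : stage t c ≡ c
        close     : hop₂ c p ≡ true
        below     : z p ≤ z c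

    -- `flowers` makes `apart` inductive: a new leader within two hops of an old one would already
    -- be owned and could not lead.
    record Invariant (t : ℕ) : Set where
      field
        members : ∀ p → p < n → stage t p < n → Member t p (stage t p)
        flowers : ∀ c p → c < n → stage t c ≡ c → L p ≡ true → hop₂ c p ≡ true → stage t p < n
        apart   : ∀ c d → c < n → d < n → stage t c ≡ c → stage t d ≡ d → hop₂ c d ≡ true → c ≡ d

    invariant : ∀ t → Invariant t
    invariant zero = record
      { members = λ p p<n own → ⊥-elim (<⇒≢ own (table-< (λ _ → n) p<n))
      ; flowers = λ c p c<n lead → ⊥-elim (<⇒≢ c<n (trans (sym lead) (table-< (λ _ → n) c<n)))
      ; apart   = λ c d c<n _ lead → ⊥-elim (<⇒≢ c<n (trans (sym lead) (table-< (λ _ → n) c<n))) }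
    invariant (suc t) = record { members = members′ ; flowers = flowers′ ; apart = apart′ }
      where
      open Invariant (invariant t)
      self-join : ∀ {p} → Joins t p → Joins t (leader t)
      self-join (joins _ _ Ll fl zl _) = joins Ll fl Ll fl zl (hop₂-refl (L-range _ Ll))
      members′ : ∀ p → p < n → stage (suc t) p < n → Member (suc t) p (stage (suc t) p)
      members′ p p<n own with step t p p<n
      ... | inj₁ (eq , j@(joins Lp fp Ll fl zl h)) = subst (Member (suc t) p) (sym eq)
              (member Lp Ll (joined (self-join j)) h (≤-trans (free-level {t} Lp fp) zl))
      ... | inj₂ same with members p p<n (subst (_< n) same own)
      ...   | member Lp Lc lead h below = subst (Member (suc t) p) (sym same)
              (member Lp Lc (trans (keep t c c<n (subst (_< n) (sym lead) c<n)) lead) h below)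
        where
        c = stage t p
        c<n = L-range c Lc
      flowers′ : ∀ c p → c < n → stage (suc t) c ≡ c → L p ≡ true → hop₂ c p ≡ true → stage (suc t) p < n
      flowers′ c p c<n lead Lp h with stage t p <? n
      ... | yes own = keep-owned 1 t p (L-range p Lp) own
      ... | no ¬own with step t c c<n
      ...   | inj₂ same = ⊥-elim (¬own (flowers c p c<n (trans (sym same) lead) Lp h))
      ...   | inj₁ (eq , joins _ _ Ll fl zl _) = subst (_< n) (sym (joined {t} (joins Lp (≮⇒≥ ¬own) Ll fl zl
                (subst (λ c → hop₂ c p ≡ true) (trans (sym lead) eq) h)))) (L-range _ Ll)
      apart′ : ∀ c d → c < n → d < n → stage (suc t) c ≡ c → stage (suc t) d ≡ d → hop₂ c d ≡ true → c ≡ d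
      apart′ c d c<n d<n lc ld h with step t c c<n | step t d d<n
      ... | inj₁ (ec , _) | inj₁ (ed , _) = trans (trans (sym lc) ec) (trans (sym ed) ld)
      ... | inj₂ sc | inj₂ sd = apart c d c<n d<n (trans (sym sc) lc) (trans (sym sd) ld) h
      ... | inj₁ (_ , j) | inj₂ sd = ⊥-elim (<⇒≱ (flowers d c d<n (trans (sym sd) ld) (Joins.point-in j) (hop₂-sym h)) (Joins.point-free j))
      ... | inj₂ sc | inj₁ (_ , j) = ⊥-elim (<⇒≱ (flowers c d c<n (trans (sym sc) lc) (Joins.point-in j) h) (Joins.point-free j))

    rounds : ℕ
    rounds = (N + 1) * M

    cluster≡ : ∀ p → cluster z p ≡ stage rounds p
    cluster≡ p = cong (λ t → stage t p) (clip-≤ {rounds} ≤-refl)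

    cluster-total : ∀ p → L p ≡ true → stage rounds p < n
    cluster-total p Lp = visited {rounds} Lp (pair< (≤-trans (s≤s (m∸n≤m N (z p))) (≤-reflexive (+-comm 1 N))) (<⇒≤ (L-range p Lp)))

    cluster< : ∀ p → p < n → L p ≡ true → cluster z p < n
    cluster< p p<n Lp = subst (_< n) (sym (cluster≡ p)) (cluster-total p Lp)

    cluster-member : ∀ p → p < n → cluster z p < n → Member rounds p (cluster z p)
    cluster-member p p<n own = subst (Member rounds p) (sym (cluster≡ p))
      (Invariant.members (invariant rounds) p p<n (subst (_< n) (cluster≡ p) own))

    center : ℕ → Bool
    center c = eq (cluster z c) c

    center-leads : ∀ c → center c ≡ true → stage rounds c ≡ c
    center-leads c p = trans (sym (cluster≡ c)) (eq-elim p)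

    member-center : ∀ {p} → p < n → cluster z p < n → center (cluster z p) ≡ true
    member-center p<n own = eq-intro (trans (cluster≡ _) (Member.leads (cluster-member _ p<n own)))

    center-apart : ∀ {o} c d → c < n → d < n → center c ≡ true → center d ≡ true →
                   adj o c ≡ true → adj o d ≡ true → c ≡ d
    center-apart {o} c d c<n d<n pc pd oc od = Invariant.apart (invariant rounds) c d c<n d<n
      (center-leads c pc) (center-leads d pd) (hop₂-intro o (adj-sym o c oc) od)

    -- Every ball of O contains at most one center.
    centers-covered≤ : ∀ O → count n (λ c → center c & cov O c) ≤ count n O
    centers-covered≤ O = begin
      count n (λ c → center c & cov O c)                      ≤⟨ ∑-mono n (λ c c<n → pick c (dichotomy (center c & cov O c))) ⟩
      ∑ n (λ c → ∑ n (λ o → 𝟙 (O o & adj o c & center c)))    ≡⟨ ∑-swap n n (λ c o → 𝟙 (O o & adj o c & center c)) ⟩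
      ∑ n (λ o → ∑ n (λ c → 𝟙 (O o & adj o c & center c)))    ≤⟨ ∑-mono n (λ o _ → once o (dichotomy (O o))) ⟩
      count n O                                               ∎
      where
      open ≤-Reasoning
      pick : ∀ c → center c & cov O c ≡ true ⊎ center c & cov O c ≡ false →
             𝟙 (center c & cov O c) ≤ ∑ n (λ o → 𝟙 (O o & adj o c & center c))
      pick c (inj₁ p) with cov-elim {O} (&-snd (center c) p)
      ... | o , o<n , Oo , oc = ≤-trans (𝟙≤1 (center c & cov O c)) (≤-trans
              (≤-reflexive (sym (cong 𝟙 (&-intro₃ Oo oc (&-fst (center c) p))))) (∑-term n (λ o → 𝟙 (O o & adj o c & center c)) o<n))
      pick c (inj₂ p) = ≤-trans (≤-reflexive (cong 𝟙 p)) z≤n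
      once : ∀ o → O o ≡ true ⊎ O o ≡ false → ∑ n (λ c → 𝟙 (O o & adj o c & center c)) ≤ 𝟙 (O o)
      once o (inj₁ p) = ≤-trans (count≤1 n (λ c → O o & adj o c & center c) λ c d c<n d<n pc pd →
          let _ , oc , cc = &₃-elim (O o) (adj o c) pc ; _ , od , cd = &₃-elim (O o) (adj o d) pd in
          center-apart c d c<n d<n cc cd oc od) (≤-reflexive (sym (cong 𝟙 p)))
      once o (inj₂ p) = ≤-trans (≤-reflexive (count-empty n (λ c → O o & adj o c & center c) λ c _ → &-falseˡ p)) z≤n

    clusterSize : Bool → ℕ → ℕ
    clusterSize c g = count n λ p → eq (cluster z p) g & member? c p

    -- Every point is credited with the mass of its center instead of its own, which is no larger
    -- because clusters are opened by decreasing `z`.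
    mass≤ : ∀ c → mass c z ≤ ∑ n (λ g → centerMass z g * clusterSize c g)
    mass≤ c = begin
      ∑ n (λ p → if member? c p then z p else 0)
        ≤⟨ ∑-mono n (λ p p<n → raise≤ p p<n (dichotomy (member? c p))) ⟩
      ∑ n f
        ≡⟨ ∑-fibres n (cluster z) f (λ p p<n 0<f → cluster< p p<n (&-fst (L p) (if-positive (member? c p) 0<f))) ⟩
      ∑ n (λ g → ∑ n (λ p → if eq (cluster z p) g then f p else 0))
        ≡⟨ ∑-cong n (λ g _ → trans (∑-cong n (λ p _ → pointwise g p (dichotomy (eq (cluster z p) g)))) (∑-* n (centerMass z g) _)) ⟩
      ∑ n (λ g → centerMass z g * clusterSize c g) ∎
      where
      open ≤-Reasoning
      f : ℕ → ℕ
      f p = if member? c p then centerMass z (cluster z p) else 0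
      if-positive : ∀ b {x} → 0 < (if b then x else 0) → b ≡ true
      if-positive true _ = refl
      raise≤ : ∀ p → p < n → member? c p ≡ true ⊎ member? c p ≡ false →
               (if member? c p then z p else 0) ≤ (if member? c p then centerMass z (cluster z p) else 0)
      raise≤ p p<n (inj₂ q) = ≤-reflexive (trans (if-false q) (sym (if-false q)))
      raise≤ p p<n (inj₁ q) = ≤-trans (≤-reflexive (if-true q)) (≤-trans (Member.below (cluster-member p p<n own))
          (≤-reflexive (sym (trans (if-true q) (if-true (member-center p<n own))))))
        where own = cluster< p p<n (&-fst (L p) q)
      pointwise : ∀ g p → eq (cluster z p) g ≡ true ⊎ eq (cluster z p) g ≡ false →
                  (if eq (cluster z p) g then f p else 0) ≡ centerMass z g * 𝟙 (eq (cluster z p) g & member? c p)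
      pointwise g p (inj₂ q) = trans (if-false q) (sym (trans (cong (centerMass z g *_) (cong 𝟙 (&-falseˡ {c = member? c p} q))) (*-zeroʳ (centerMass z g))))
      pointwise g p (inj₁ q) = trans (if-true q) (trans (cong (λ h → if member? c p then centerMass z h else 0) (eq-elim q))
        (trans (if-*𝟙 (member? c p) (centerMass z g)) (cong (λ b → centerMass z g * 𝟙 (b & member? c p)) (sym q))))

  module RelaxLemmas (O : ℕ → Bool) where

    required : Bool → ℕ
    required c = count n λ p → member? c p & cov O p

    stage : ℕ → ℕ → ℕ
    stage = iterate n (λ _ → 0) (relaxStep (required true) (required false))

    -- The squared distance to N times the indicator of the points covered by O.
    φ : Bool → ℕ → ℕ
    φ true  v = (N ∸ v) * (N ∸ v)
    φ false v = v * v

    Φ : (ℕ → ℕ) → ℕ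
    Φ z = ∑ n λ p → φ (cov O p) (z p)

    -- With `x = N * 𝟙 b` this is `(v + 1 - x)² = (v - x)² + 2v + 1 - 2x`, rearranged to avoid
    -- subtraction. At the cap nothing moves, and `2x` is at most `2v` by itself.
    raise-cell : ∀ m b v → φ b (if m & (v <ᵇ N) then v + 1 else v) + 2 * N * 𝟙 (m & b) ≤ φ b v + (2 * (if m then v else 0) + 𝟙 m)
    raise-cell false b v = ≤-trans (≤-reflexive (trans (cong (φ b v +_) (*-zeroʳ (2 * N))) (+-identityʳ _))) (m≤m+n _ _)
    raise-cell true b v with v <? N
    raise-cell true true v | yes v<N rewrite <ᵇ-true v<N = ≤-reflexive (begin
        (N ∸ (v + 1)) * (N ∸ (v + 1)) + 2 * N * 1   ≡⟨ cong₂ (λ x y → x * x + 2 * y * 1) eq₁ (sym eq₀) ⟩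
        d * d + 2 * (v + suc d) * 1                 ≡⟨ lemma v d ⟩
        suc d * suc d + (2 * v + 1)                 ≡⟨ cong (λ x → x * x + (2 * v + 1)) (sym eq₂) ⟩
        (N ∸ v) * (N ∸ v) + (2 * v + 1)             ∎)
      where
      open ≡-Reasoning
      d = N ∸ suc v
      eq₀ : v + suc d ≡ N
      eq₀ = trans (+-suc v d) (m+[n∸m]≡n v<N)
      eq₁ : N ∸ (v + 1) ≡ d
      eq₁ = cong (N ∸_) (+-comm v 1)
      eq₂ : N ∸ v ≡ suc d
      eq₂ = trans (cong (_∸ v) (sym eq₀)) (m+n∸m≡n v (suc d))
      lemma : ∀ v d → d * d + 2 * (v + suc d) * 1 ≡ suc d * suc d + (2 * v + 1)
      lemma = solve-∀
    raise-cell true false v | yes v<N rewrite <ᵇ-true v<N = ≤-reflexive (lemma v (2 * N))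
      where
      lemma : ∀ v x → (v + 1) * (v + 1) + x * 0 ≡ v * v + (2 * v + 1)
      lemma = solve-∀
    raise-cell true b v | no v≮N rewrite <ᵇ-false (≮⇒≥ v≮N) = +-monoʳ-≤ (φ b v) (begin
        2 * N * 𝟙 b   ≤⟨ *-monoʳ-≤ (2 * N) (𝟙≤1 b) ⟩
        2 * N * 1     ≡⟨ *-identityʳ (2 * N) ⟩
        2 * N         ≤⟨ *-monoʳ-≤ 2 (≮⇒≥ v≮N) ⟩
        2 * v         ≤⟨ m≤m+n (2 * v) 1 ⟩
        2 * v + 1     ∎)
      where open ≤-Reasoning

    -- The same expansion for a step down. At `v = 0`, where truncated subtraction stops the step,
    -- the term `2v` vanishes as well.
    lower-cell : ∀ m b v → v ≤ N → φ b (if m then v ∸ 1 else v) + 2 * (if m then v else 0) ≤ φ b v + (2 * N * 𝟙 (m & b) + 𝟙 m)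
    lower-cell false b v v≤N = ≤-trans (≤-reflexive (+-identityʳ (φ b v))) (m≤m+n _ _)
    lower-cell true b zero v≤N = ≤-trans (≤-reflexive (+-identityʳ (φ b 0))) (m≤m+n _ _)
    lower-cell true true (suc w) v≤N = ≤-reflexive (begin
        (N ∸ w) * (N ∸ w) + 2 * suc w             ≡⟨ cong (λ x → x * x + 2 * suc w) eq₁ ⟩
        suc d * suc d + 2 * suc w                 ≡⟨ lemma w d ⟩
        d * d + (2 * (suc w + d) * 1 + 1)         ≡⟨ cong (λ x → d * d + (2 * x * 1 + 1)) eq₀ ⟩
        d * d + (2 * N * 1 + 1)                   ∎)
      where
      open ≡-Reasoning
      d = N ∸ suc w
      eq₀ : suc w + d ≡ N
      eq₀ = m+[n∸m]≡n v≤N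
      eq₁ : N ∸ w ≡ suc d
      eq₁ = trans (cong (_∸ w) (sym (trans (+-suc w d) eq₀))) (m+n∸m≡n w (suc d))
      lemma : ∀ w d → suc d * suc d + 2 * suc w ≡ d * d + (2 * (suc w + d) * 1 + 1)
      lemma = solve-∀
    lower-cell true false (suc w) v≤N = ≤-reflexive (lemma w (2 * N))
      where
      lemma : ∀ w x → w * w + 2 * suc w ≡ suc w * suc w + (x * 0 + 1)
      lemma = solve-∀

    ∑-cells : ∀ k f g h {l} → (∀ p → p < n → f p + k * g p ≤ h p + l p) → ∑ n f + k * ∑ n g ≤ ∑ n h + ∑ n l
    ∑-cells k f g h {l} cell = begin
      ∑ n f + k * ∑ n g                 ≡⟨ cong (∑ n f +_) (sym (∑-* n k g)) ⟩
      ∑ n f + ∑ n (λ p → k * g p)       ≡⟨ sym (∑-+ n f (λ p → k * g p)) ⟩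
      ∑ n (λ p → f p + k * g p)         ≤⟨ ∑-mono n cell ⟩
      ∑ n (λ p → h p + l p)             ≡⟨ ∑-+ n h l ⟩
      ∑ n h + ∑ n l                     ∎ where open ≤-Reasoning

    ∑-tail : ∀ k f m → ∑ n (λ p → k * f p + 𝟙 (m p)) ≤ k * ∑ n f + n
    ∑-tail k f m = ≤-trans (≤-reflexive (trans (∑-+ n (λ p → k * f p) (λ p → 𝟙 (m p))) (cong (_+ count n m) (∑-* n k f))))
      (+-monoʳ-≤ (k * ∑ n f) (count≤n n m))

    -- The linear part of the change is twice the violation and the quadratic part is at most `n`,
    -- so a violation above `n` outweighs it.
    descend : ∀ {Φ Φ′ x y} → Φ′ + 2 * y ≤ Φ + (2 * x + n) → x + n < y → Φ′ < Φ
    descend {Φ} {Φ′} {x} {y} le lt = ≰⇒> λ Φ≤ → <⇒≱ (begin-strict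
      Φ + (2 * x + n)             ≤⟨ +-mono-≤ Φ≤ (+-monoʳ-≤ (2 * x) (m≤m+n n (n + 1))) ⟩
      Φ′ + (2 * x + (n + (n + 1))) <⟨ +-monoʳ-< Φ′ (n<1+n _) ⟩
      Φ′ + suc (2 * x + (n + (n + 1))) ≡⟨ cong (Φ′ +_) (lemma x n) ⟩
      Φ′ + 2 * suc (x + n)        ≤⟨ +-monoʳ-≤ Φ′ (*-monoʳ-≤ 2 lt) ⟩
      Φ′ + 2 * y                  ∎) le
      where
      open ≤-Reasoning
      lemma : ∀ x n → suc (2 * x + (n + (n + 1))) ≡ 2 * suc (x + n)
      lemma = solve-∀

    raise-descent : ∀ c z → mass c z + n < required c * N → Φ (raise c z) < Φ z
    raise-descent c z low = descend {x = mass c z} {y = required c * N} (begin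
      Φ (raise c z) + 2 * (required c * N)        ≡⟨ cong (Φ (raise c z) +_) (lemma (required c) N) ⟩
      Φ (raise c z) + 2 * N * required c          ≤⟨ ∑-cells (2 * N) (λ p → φ (cov O p) (raise c z p)) (λ p → 𝟙 (member? c p & cov O p))
          (λ p → φ (cov O p) (z p)) (λ p _ → raise-cell (member? c p) (cov O p) (z p)) ⟩
      Φ z + ∑ n (λ p → 2 * (if member? c p then z p else 0) + 𝟙 (member? c p))
                                                  ≤⟨ +-monoʳ-≤ (Φ z) (∑-tail 2 (λ p → if member? c p then z p else 0) (member? c)) ⟩
      Φ z + (2 * mass c z + n)                    ∎) low
      where
      open ≤-Reasoning
      lemma : ∀ r N → 2 * (r * N) ≡ 2 * N * r
      lemma = solve-∀

    -- The target of the descent satisfies the violated constraint: its mass on the centers is `N`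
    -- for each center covered by `O`, and no ball of `O` contains two centers.
    lower-descent : ∀ z → (∀ p → p < n → z p ≤ N) → N * count n O + n < ∑ n (centerMass z) → Φ (lower (cluster z) z) < Φ z
    lower-descent z z≤N high = descend {x = N * count n O} {y = ∑ n (centerMass z)} (begin
      Φ (lower (cluster z) z) + 2 * ∑ n (centerMass z)
        ≤⟨ ∑-cells 2 (λ p → φ (cov O p) (lower (cluster z) z p)) (centerMass z) (λ p → φ (cov O p) (z p))
             (λ p p<n → lower-cell (center p) (cov O p) (z p) (z≤N p p<n)) ⟩
      Φ z + ∑ n (λ p → 2 * N * 𝟙 (center p & cov O p) + 𝟙 (center p))
        ≤⟨ +-monoʳ-≤ (Φ z) (∑-tail (2 * N) (λ p → 𝟙 (center p & cov O p)) center) ⟩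
      Φ z + (2 * N * count n (λ p → center p & cov O p) + n)
        ≤⟨ +-monoʳ-≤ (Φ z) (+-monoˡ-≤ n (*-monoʳ-≤ (2 * N) (centers-covered≤ O))) ⟩
      Φ z + (2 * N * count n O + n)
        ≡⟨ cong (λ x → Φ z + (x + n)) (*-assoc 2 N (count n O)) ⟩
      Φ z + (2 * (N * count n O) + n) ∎) high
      where
      open ≤-Reasoning
      open ClusterLemmas z z≤N

    stage≤N : ∀ t p → p < n → stage t p ≤ N
    stage≤N zero    p p<n = ≤-trans (≤-reflexive (table-< (λ _ → 0) p<n)) z≤n
    stage≤N (suc t) p p<n = ≤-trans (≤-reflexive (table-< (relaxStep (required true) (required false) t (stage t)) p<n))
      (cases (mass true (stage t) + n <ᵇ required true * N) (mass false (stage t) + n <ᵇ required false * N))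
      where
      v≤N = stage≤N t p p<n
      raised : ∀ m v → v ≤ N → (if m & (v <ᵇ N) then v + 1 else v) ≤ N
      raised false v v≤N = v≤N
      raised true  v v≤N with v <? N
      ... | yes v<N rewrite <ᵇ-true v<N = ≤-trans (≤-reflexive (+-comm v 1)) v<N
      ... | no  v≮N rewrite <ᵇ-false (≮⇒≥ v≮N) = v≤N
      lowered : ∀ m v → v ≤ N → (if m then v ∸ 1 else v) ≤ N
      lowered true  v v≤N = ≤-trans (m∸n≤m v 1) v≤N
      lowered false v v≤N = v≤N
      cases : ∀ b c → (if b then raise true (stage t) p else if c then raise false (stage t) p else lower (cluster (stage t)) (stage t) p) ≤ N
      cases true  c     = raised (member? true p) (stage t p) v≤N
      cases false true  = raised (member? false p) (stage t p) v≤N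
      cases false false = lowered (eq (cluster (stage t) p) p) (stage t p) v≤N

    record Relaxed (z : ℕ → ℕ) : Set where
      field
        bounded : ∀ p → p < n → z p ≤ N
        enough  : ∀ c → required c * N ≤ mass c z + n
        few     : ∑ n (centerMass z) ≤ N * count n O + n

    -- Of the three constraints only the one on the centers is decided in the proof alone, where `O`
    -- is known; if it fails, the unconditional lowering was the right step.
    progress : ∀ t → Relaxed (stage t) ⊎ Φ (stage (suc t)) < Φ (stage t)
    progress t with dichotomy (mass true (stage t) + n <ᵇ required true * N)
    ... | inj₁ low = inj₂ (subst (_< Φ (stage t)) (∑-cong n λ p p<n → cong (φ (cov O p))
            (sym (trans (table-< (relaxStep (required true) (required false) t (stage t)) p<n) (if-true low))))
            (raise-descent true (stage t) (true-<ᵇ low)))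
    ... | inj₂ ok with dichotomy (mass false (stage t) + n <ᵇ required false * N)
    ...   | inj₁ low = inj₂ (subst (_< Φ (stage t)) (∑-cong n λ p p<n → cong (φ (cov O p))
            (sym (trans (table-< (relaxStep (required true) (required false) t (stage t)) p<n) (trans (if-false ok) (if-true low)))))
            (raise-descent false (stage t) (true-<ᵇ low)))
    ...   | inj₂ ok′ with N * count n O + n <? ∑ n (centerMass (stage t))
    ...     | yes high = inj₂ (subst (_< Φ (stage t)) (∑-cong n λ p p<n → cong (φ (cov O p))
            (sym (trans (table-< (relaxStep (required true) (required false) t (stage t)) p<n) (trans (if-false ok) (if-false ok′)))))
            (lower-descent (stage t) (stage≤N t) high))
    ...     | no ¬high = inj₁ record
            { bounded = stage≤N t ; enough = λ { true → false-<ᵇ ok ; false → false-<ᵇ ok′ } ; few = ≮⇒≥ ¬high }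

    relaxes : ∀ f t → Φ (stage t) ≤ f → ∃[ T ] T ≤ t + f × Relaxed (stage T)
    relaxes f t Φ≤f with progress t
    ... | inj₁ ok = t , m≤m+n t f , ok
    relaxes zero    t Φ≤f | inj₂ fall = ⊥-elim (<⇒≱ fall (≤-trans Φ≤f z≤n))
    relaxes (suc f) t Φ≤f | inj₂ fall with relaxes f (suc t) (s≤s⁻¹ (≤-trans fall Φ≤f))
    ... | T , T≤ , ok = T , ≤-trans T≤ (≤-reflexive (sym (+-suc t f))) , ok

    -- At `z = 0` each coordinate is at squared distance at most `N * N` from its target, so the
    -- distance can fall at most `n * (N * N)` times.
    relax-works : ∃[ T ] T ≤ N * N * n + 1 × Relaxed (relax (required true) (required false) T)
    relax-works with relaxes (n * (N * N)) 0 (∑≤* n (N * N) λ p p<n → cell≤ (cov O p) p<n)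
      where
      cell≤ : ∀ b {p} → p < n → φ b (stage 0 p) ≤ N * N
      cell≤ b {p} p<n rewrite table-< {n} (λ _ → 0) p<n = φ₀≤ b
        where
        φ₀≤ : ∀ b → φ b 0 ≤ N * N
        φ₀≤ true  = ≤-refl
        φ₀≤ false = z≤n
    ... | T , T≤ , ok = T , T≤′ , subst (λ t → Relaxed (stage t)) (sym (clip-≤ T≤′)) ok
      where
      T≤′ : T ≤ N * N * n + 1
      T≤′ = ≤-trans T≤ (≤-trans (≤-reflexive (*-comm n (N * N))) (m≤m+n _ 1))

-- Rounding the masses of the clusters

-- Items g < n with weights R g and B g carry fractional amounts Y g / N.
-- Going through them by decreasing R, a single fractional item is kept and
-- merged with the next one, shifting mass towards the larger B.
module Rounding (n : ℕ) (Y R B : ℕ → ℕ)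
  (Y≤ : ∀ g → Y g ≤ n * n + n + 1) (R≤ : ∀ g → R g ≤ n) (B≤ : ∀ g → B g ≤ n) where
  open import Data.List.Relation.Unary.All using (All; []; _∷_)
  open Sums
  open SumLemmas
  open Algorithm using (eq)

  N : ℕ
  N = n * n + n + 1

  total : List ℕ → (ℕ → ℕ) → ℕ
  total []      f = 0
  total (g ∷ l) f = f g + total l f

  insert : ℕ → List ℕ → List ℕ
  insert g []      = g ∷ []
  insert g (h ∷ l) = if R g <ᵇ R h then h ∷ insert g l else g ∷ h ∷ l

  sorted : ℕ → List ℕ
  sorted zero    = []
  sorted (suc m) = insert m (sorted m)

  total-insert : ∀ g l f → total (insert g l) f ≡ f g + total l f
  total-insert g []      f = refl
  total-insert g (h ∷ l) f with R g <ᵇ R h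
  ... | false = refl
  ... | true  = trans (cong (f h +_) (total-insert g l f)) (lemma (f h) (f g) (total l f))
    where
    lemma : ∀ a b c → a + (b + c) ≡ b + (a + c)
    lemma = solve-∀

  total-sorted : ∀ m f → total (sorted m) f ≡ ∑ m f
  total-sorted zero    f = refl
  total-sorted (suc m) f = trans (total-insert m (sorted m) f) (trans (cong (f m +_) (total-sorted m f)) (+-comm (f m) _))

  Descending : List ℕ → Set
  Descending []      = ⊤
  Descending (g ∷ l) = All (λ h → R h ≤ R g) l × Descending l

  all-insert : ∀ {P : ℕ → Set} g l → P g → All P l → All P (insert g l)
  all-insert g []      Pg []        = Pg ∷ []
  all-insert g (h ∷ l) Pg (Ph ∷ Pl) with R g <ᵇ R h
  ... | true  = Ph ∷ all-insert g l Pg Pl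
  ... | false = Pg ∷ Ph ∷ Pl

  all-≤ : ∀ {x y} l → x ≤ y → All (λ h → R h ≤ x) l → All (λ h → R h ≤ y) l
  all-≤ []      x≤y []       = []
  all-≤ (h ∷ l) x≤y (p ∷ ps) = ≤-trans p x≤y ∷ all-≤ l x≤y ps

  descending-insert : ∀ g l → Descending l → Descending (insert g l)
  descending-insert g []      _ = [] , tt
  descending-insert g (h ∷ l) (hl , d) with dichotomy (R g <ᵇ R h)
  ... | inj₁ lt rewrite lt = all-insert g l (<⇒≤ (true-<ᵇ lt)) hl , descending-insert g l d
  ... | inj₂ ge rewrite ge = (false-<ᵇ ge ∷ all-≤ l (false-<ᵇ ge) hl) , hl , d

  descending-sorted : ∀ m → Descending (sorted m)
  descending-sorted zero    = tt
  descending-sorted (suc m) = descending-insert m (sorted m) (descending-sorted m)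

  -- c is the fractional item, with mass y.
  select : ℕ → ℕ → List ℕ → List ℕ
  merge  : ℕ → ℕ → ℕ → List ℕ → List ℕ
  -- The last fractional item is taken if its mass exceeds `n`. This adds less than `N - n` to the
  -- mass, which even with the slack `n` does not make up another center. Dropping it loses at most
  -- `n * n` of blue weight.
  select c y []      = if n <ᵇ y then c ∷ [] else []
  select c y (i ∷ l) = if B c <ᵇ B i then merge i c (y + Y i) l else merge c i (y + Y i) l
  merge hi lo m l = if N <ᵇ m then hi ∷ select lo (m ∸ N) l else select hi m l

  -- The cases of a merger: the amounts y and Y i become m on hi, or N on
  -- hi and the rest on lo.
  data Merger (c y i : ℕ) (l : List ℕ) : List ℕ → Set where
    small : ∀ hi → (hi ≡ c × B i ≤ B c) ⊎ (hi ≡ i × B c ≤ B i) → y + Y i ≤ N → Merger c y i l (select hi (y + Y i) l)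
    large : ∀ hi lo → (hi ≡ c × lo ≡ i × B i ≤ B c) ⊎ (hi ≡ i × lo ≡ c × B c ≤ B i) → N < y + Y i →
            Merger c y i l (hi ∷ select lo (y + Y i ∸ N) l)

  merger : ∀ c y i l → Merger c y i l (select c y (i ∷ l))
  merger c y i l with dichotomy (B c <ᵇ B i) | dichotomy (N <ᵇ y + Y i)
  ... | inj₁ p | inj₁ q rewrite p | q = large i c (inj₂ (refl , refl , <⇒≤ (true-<ᵇ p))) (true-<ᵇ q)
  ... | inj₁ p | inj₂ q rewrite p | q = small i (inj₂ (refl , <⇒≤ (true-<ᵇ p))) (false-<ᵇ q)
  ... | inj₂ p | inj₁ q rewrite p | q = large c i (inj₁ (refl , refl , false-<ᵇ p)) (true-<ᵇ q)
  ... | inj₂ p | inj₂ q rewrite p | q = small c (inj₁ (refl , false-<ᵇ p)) (false-<ᵇ q)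

  excess≤N : ∀ {y i} → y ≤ N → y + Y i ∸ N ≤ N
  excess≤N {y} {i} y≤N = ≤-trans (∸-monoˡ-≤ N (+-monoˡ-≤ (Y i) y≤N)) (≤-trans (≤-reflexive (m+n∸m≡n N (Y i))) (Y≤ i))

  -- For `f` an indicator this shows that no item is selected twice and that no selected item is out
  -- of range.
  select⊆ : ∀ c y l f → total (select c y l) f ≤ f c + total l f
  select⊆ c y [] f with n <ᵇ y
  ... | true  = ≤-refl
  ... | false = z≤n
  select⊆ c y (i ∷ l) f with select c y (i ∷ l) | merger c y i l
  ... | _ | small hi (inj₁ (refl , _)) _ = ≤-trans (select⊆ c (y + Y i) l f) (+-monoʳ-≤ (f c) (m≤n+m _ (f i)))
  ... | _ | small hi (inj₂ (refl , _)) _ = ≤-trans (select⊆ i (y + Y i) l f) (m≤n+m _ (f c))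
  ... | _ | large hi lo (inj₁ (refl , refl , _)) _ = +-monoʳ-≤ (f c) (select⊆ i (y + Y i ∸ N) l f)
  ... | _ | large hi lo (inj₂ (refl , refl , _)) _ =
    ≤-trans (+-monoʳ-≤ (f i) (select⊆ c (y + Y i ∸ N) l f)) (≤-reflexive (lemma (f i) (f c) (total l f)))
    where
    lemma : ∀ a b c → a + (b + c) ≡ b + (a + c)
    lemma = solve-∀

  n<N : n < N
  n<N = ≤-trans (m≤n+m (suc n) (n * n)) (≤-reflexive (trans (+-suc (n * n) n) (+-comm 1 (n * n + n))))

  select-length : ∀ c y l → N * length (select c y l) + suc n ≤ y + total l Y + N
  select-length c y [] with dichotomy (n <ᵇ y)
  ... | inj₁ p rewrite p = ≤-trans (≤-reflexive (cong (_+ suc n) (*-identityʳ N)))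
          (≤-trans (≤-reflexive (+-comm N (suc n))) (+-monoˡ-≤ N (≤-trans (true-<ᵇ p) (≤-reflexive (sym (+-identityʳ y))))))
  ... | inj₂ p rewrite p = ≤-trans (≤-reflexive (cong (_+ suc n) (*-zeroʳ N))) (≤-trans n<N (m≤n+m N (y + 0)))
  select-length c y (i ∷ l) with select c y (i ∷ l) | merger c y i l
  ... | _ | small hi _ _ = ≤-trans (select-length hi (y + Y i) l) (≤-reflexive (cong (_+ N) (+-assoc y (Y i) (total l Y))))
  ... | _ | large hi lo _ N<m = begin
      N * suc (length S) + suc n                ≡⟨ lemma N (length S) (suc n) ⟩
      N + (N * length S + suc n)                ≤⟨ +-monoʳ-≤ N (select-length lo (y + Y i ∸ N) l) ⟩
      N + (y + Y i ∸ N + total l Y + N)         ≡⟨ lemma′ N (y + Y i ∸ N) (total l Y) N ⟩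
      N + (y + Y i ∸ N) + total l Y + N         ≡⟨ cong (λ x → x + total l Y + N) (m+[n∸m]≡n (<⇒≤ N<m)) ⟩
      y + Y i + total l Y + N                   ≡⟨ cong (_+ N) (+-assoc y (Y i) (total l Y)) ⟩
      y + (Y i + total l Y) + N                 ∎
    where
    open ≤-Reasoning
    S = select lo (y + Y i ∸ N) l
    lemma : ∀ a b c → a * suc b + c ≡ a + (a * b + c)
    lemma = solve-∀
    lemma′ : ∀ a b c d → a + (b + c + d) ≡ a + b + c + d
    lemma′ = solve-∀

  -- Moving mass from the smaller weight b to the larger weight a.
  exchange : ∀ {y x a b} → y ≤ N → b ≤ a → N ≤ y + x → y * a + x * b ≤ N * a + (y + x ∸ N) * b
  exchange {y} {x} {a} {b} y≤N b≤a N≤ = begin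
      y * a + x * b                   ≡⟨ cong (λ z → y * a + z * b) x≡ ⟩
      y * a + (d + e) * b             ≡⟨ cong (y * a +_) (*-distribʳ-+ b d e) ⟩
      y * a + (d * b + e * b)         ≤⟨ +-monoʳ-≤ (y * a) (+-monoˡ-≤ (e * b) (*-monoʳ-≤ d b≤a)) ⟩
      y * a + (d * a + e * b)         ≡⟨ sym (+-assoc (y * a) (d * a) (e * b)) ⟩
      y * a + d * a + e * b           ≡⟨ cong (_+ e * b) (sym (*-distribʳ-+ a y d)) ⟩
      (y + d) * a + e * b             ≡⟨ cong (λ z → z * a + e * b) (m+[n∸m]≡n y≤N) ⟩
      N * a + e * b                   ∎
    where
    open ≤-Reasoning
    d = N ∸ y
    e = y + x ∸ N
    x≡ : x ≡ d + e
    x≡ = +-cancelˡ-≡ y x (d + e) (trans (sym (m+[n∸m]≡n N≤)) (trans (cong (_+ e) (sym (m+[n∸m]≡n y≤N))) (+-assoc y d e)))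

  -- Every merger moves mass towards the larger blue weight, so blue weight can be lost only when
  -- the last item is dropped, whose mass and weight are both at most `n`.
  select-blue : ∀ c y l → y ≤ N → y * B c + total l (λ g → Y g * B g) ≤ N * total (select c y l) B + n * n
  select-blue c y [] y≤N with dichotomy (n <ᵇ y)
  ... | inj₁ p rewrite p = ≤-trans (+-mono-≤ (*-monoˡ-≤ (B c) y≤N) z≤n)
          (≤-trans (≤-reflexive (trans (+-identityʳ _) (cong (N *_) (sym (+-identityʳ (B c)))))) (m≤m+n _ (n * n)))
  ... | inj₂ p rewrite p = ≤-trans (≤-reflexive (+-identityʳ _)) (≤-trans (*-mono-≤ {y} {n} (false-<ᵇ p) (B≤ c)) (m≤n+m (n * n) (N * 0)))
  select-blue c y (i ∷ l) y≤N with select c y (i ∷ l) | merger c y i l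
  ... | _ | small hi e m≤N = begin
      y * B c + (Y i * B i + rest)              ≡⟨ sym (+-assoc (y * B c) (Y i * B i) rest) ⟩
      y * B c + Y i * B i + rest                ≤⟨ +-monoˡ-≤ rest (up e) ⟩
      (y + Y i) * B hi + rest                   ≤⟨ select-blue hi (y + Y i) l m≤N ⟩
      N * total (select hi (y + Y i) l) B + n * n ∎
    where
    open ≤-Reasoning
    rest = total l (λ g → Y g * B g)
    up : (hi ≡ c × B i ≤ B c) ⊎ (hi ≡ i × B c ≤ B i) → y * B c + Y i * B i ≤ (y + Y i) * B hi
    up (inj₁ (refl , le)) = ≤-trans (+-monoʳ-≤ (y * B c) (*-monoʳ-≤ (Y i) le)) (≤-reflexive (sym (*-distribʳ-+ (B c) y (Y i))))
    up (inj₂ (refl , le)) = ≤-trans (+-monoˡ-≤ (Y i * B i) (*-monoʳ-≤ y le)) (≤-reflexive (sym (*-distribʳ-+ (B i) y (Y i))))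
  ... | _ | large hi lo e N<m = begin
      y * B c + (Y i * B i + rest)              ≡⟨ sym (+-assoc (y * B c) (Y i * B i) rest) ⟩
      y * B c + Y i * B i + rest                ≤⟨ +-monoˡ-≤ rest (up e) ⟩
      N * B hi + x * B lo + rest                ≡⟨ +-assoc (N * B hi) (x * B lo) rest ⟩
      N * B hi + (x * B lo + rest)              ≤⟨ +-monoʳ-≤ (N * B hi) (select-blue lo x l (excess≤N {y} {i} y≤N)) ⟩
      N * B hi + (N * total S B + n * n)        ≡⟨ lemma N (B hi) (total S B) (n * n) ⟩
      N * (B hi + total S B) + n * n            ∎
    where
    open ≤-Reasoning
    rest = total l (λ g → Y g * B g)
    x = y + Y i ∸ N
    S = select lo x l
    lemma : ∀ a b c d → a * b + (a * c + d) ≡ a * (b + c) + d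
    lemma = solve-∀
    up : (hi ≡ c × lo ≡ i × B i ≤ B c) ⊎ (hi ≡ i × lo ≡ c × B c ≤ B i) → y * B c + Y i * B i ≤ N * B hi + x * B lo
    up (inj₁ (refl , refl , le)) = exchange y≤N le (<⇒≤ N<m)
    up (inj₂ (refl , refl , le)) = ≤-trans (≤-reflexive (+-comm (y * B c) (Y i * B i)))
      (≤-trans (exchange (Y≤ i) le (≤-trans (<⇒≤ N<m) (≤-reflexive (+-comm y (Y i)))))
        (≤-reflexive (cong (λ z → N * B i + (z ∸ N) * B c) (+-comm (Y i) y))))

  above : ℕ → ℕ → ℕ
  above v g = 𝟙 (v <ᵇ R g)

  -- Less than N of the mass of the items above a level is lost.
  select-level : ∀ v c y l → y ≤ N → Descending (c ∷ l) →
    y * above v c + total l (λ g → Y g * above v g) ≤ N * total (select c y l) (above v) + N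
  select-level v c y [] y≤N _ = ≤-trans (≤-reflexive (+-identityʳ _))
    (≤-trans (*-mono-≤ y≤N (𝟙≤1 (v <ᵇ R c))) (≤-trans (≤-reflexive (*-identityʳ N)) (m≤n+m N (N * total (select c y []) (above v)))))
  select-level v c y (i ∷ l) y≤N ((i≤c ∷ l≤c) , l≤i , d) with dichotomy (v <ᵇ R i)
  -- The list descends, so no later item is above level `v` either; all that can be lost there is
  -- the mass of the fractional item, at most `N`.
  ... | inj₂ low = ≤-trans (+-mono-≤ (*-mono-≤ y≤N (𝟙≤1 (v <ᵇ R c)))
                      (≤-reflexive (none (i ∷ l) (false-<ᵇ low ∷ all-≤ l (false-<ᵇ low) l≤i))))
                    (≤-trans (≤-reflexive (trans (+-identityʳ _) (*-identityʳ N))) (m≤n+m N (N * total (select c y (i ∷ l)) (above v))))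
    where
    none : ∀ l → All (λ h → R h ≤ v) l → total l (λ g → Y g * above v g) ≡ 0
    none []      []       = refl
    none (h ∷ l) (p ∷ ps) = cong₂ _+_ (trans (cong (λ b → Y h * 𝟙 b) (<ᵇ-false p)) (*-zeroʳ (Y h))) (none l ps)
  -- Both items of the merger are above the level, so no mass crosses it.
  ... | inj₁ high with select c y (i ∷ l) | merger c y i l
  ...   | _ | small hi e m≤N = begin
      y * above v c + (Y i * above v i + rest)  ≡⟨ cong₂ (λ p q → y * p + (Y i * q + rest)) c≡1 i≡1 ⟩
      y * 1 + (Y i * 1 + rest)                  ≡⟨ lemma y (Y i) rest ⟩
      (y + Y i) * 1 + rest                      ≡⟨ cong (λ p → (y + Y i) * p + rest) (sym hi≡1) ⟩
      (y + Y i) * above v hi + rest             ≤⟨ select-level v hi (y + Y i) l m≤N (hi-desc e) ⟩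
      N * total (select hi (y + Y i) l) (above v) + N ∎
    where
    open ≤-Reasoning
    rest = total l (λ g → Y g * above v g)
    i≡1 : above v i ≡ 1
    i≡1 = cong 𝟙 high
    c≡1 : above v c ≡ 1
    c≡1 = cong 𝟙 (<ᵇ-true (≤-trans (true-<ᵇ high) i≤c))
    hi≡1 : above v hi ≡ 1
    hi≡1 = Sum.[ (λ p → trans (cong (above v) (proj₁ p)) c≡1) , (λ p → trans (cong (above v) (proj₁ p)) i≡1) ] e
    hi-desc : (hi ≡ c × B i ≤ B c) ⊎ (hi ≡ i × B c ≤ B i) → Descending (hi ∷ l)
    hi-desc (inj₁ (refl , _)) = l≤c , d
    hi-desc (inj₂ (refl , _)) = l≤i , d
    lemma : ∀ a b c → a * 1 + (b * 1 + c) ≡ (a + b) * 1 + c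
    lemma = solve-∀
  ...   | _ | large hi lo e N<m = begin
      y * above v c + (Y i * above v i + rest)  ≡⟨ cong₂ (λ p q → y * p + (Y i * q + rest)) c≡1 i≡1 ⟩
      y * 1 + (Y i * 1 + rest)                  ≡⟨ lemma y (Y i) rest ⟩
      (y + Y i) + rest                          ≡⟨ cong (_+ rest) (sym (m+[n∸m]≡n (<⇒≤ N<m))) ⟩
      N + x + rest                              ≡⟨ lemma′ N x rest ⟩
      N * 1 + (x * 1 + rest)                    ≡⟨ cong₂ (λ p q → N * p + (x * q + rest)) (sym (proj₁ (ends e))) (sym (proj₂ (ends e))) ⟩
      N * above v hi + (x * above v lo + rest)  ≤⟨ +-monoʳ-≤ (N * above v hi) (select-level v lo x l (excess≤N {y} {i} y≤N) (lo-desc e)) ⟩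
      N * above v hi + (N * total S (above v) + N) ≡⟨ lemma″ N (above v hi) (total S (above v)) N ⟩
      N * (above v hi + total S (above v)) + N  ∎
    where
    open ≤-Reasoning
    rest = total l (λ g → Y g * above v g)
    x = y + Y i ∸ N
    S = select lo x l
    i≡1 : above v i ≡ 1
    i≡1 = cong 𝟙 high
    c≡1 : above v c ≡ 1
    c≡1 = cong 𝟙 (<ᵇ-true (≤-trans (true-<ᵇ high) i≤c))
    ends : (hi ≡ c × lo ≡ i × B i ≤ B c) ⊎ (hi ≡ i × lo ≡ c × B c ≤ B i) → above v hi ≡ 1 × above v lo ≡ 1
    ends (inj₁ (refl , refl , _)) = c≡1 , i≡1
    ends (inj₂ (refl , refl , _)) = i≡1 , c≡1
    lo-desc : (hi ≡ c × lo ≡ i × B i ≤ B c) ⊎ (hi ≡ i × lo ≡ c × B c ≤ B i) → Descending (lo ∷ l)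
    lo-desc (inj₁ (refl , refl , _)) = l≤i , d
    lo-desc (inj₂ (refl , refl , _)) = l≤c , d
    lemma : ∀ a b c → a * 1 + (b * 1 + c) ≡ (a + b) + c
    lemma = solve-∀
    lemma′ : ∀ a b c → a + b + c ≡ a * 1 + (b * 1 + c)
    lemma′ = solve-∀
    lemma″ : ∀ a b c d → a * b + (a * c + d) ≡ a * (b + c) + d
    lemma″ = solve-∀

  start : List ℕ → List ℕ
  start []      = []
  start (i ∷ l) = select i (Y i) l

  start⊆ : ∀ l f → total (start l) f ≤ total l f
  start⊆ []      f = z≤n
  start⊆ (i ∷ l) f = select⊆ i (Y i) l f

  start-length : ∀ l → N * length (start l) + suc n ≤ total l Y + N
  start-length []      = ≤-trans (≤-reflexive (cong (_+ suc n) (*-zeroʳ N))) n<N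
  start-length (i ∷ l) = select-length i (Y i) l

  start-blue : ∀ l → total l (λ g → Y g * B g) ≤ N * total (start l) B + n * n
  start-blue []      = z≤n
  start-blue (i ∷ l) = select-blue i (Y i) l (Y≤ i)

  start-level : ∀ v l → Descending l → total l (λ g → Y g * above v g) ≤ N * total (start l) (above v) + N
  start-level v []      _ = z≤n
  start-level v (i ∷ l) d = select-level v i (Y i) l (Y≤ i) d

  chosen : List ℕ
  chosen = start (sorted n)

  multiplicity : List ℕ → ℕ → ℕ
  multiplicity l g = total l λ x → 𝟙 (eq x g)

  S : ℕ → Bool
  S g = 0 <ᵇ multiplicity chosen g

  chosen≤ : ∀ f → total chosen f ≤ ∑ n f
  chosen≤ f = ≤-trans (start⊆ (sorted n) f) (≤-reflexive (total-sorted n f))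

  S-multiplicity : ∀ g → multiplicity chosen g ≡ 𝟙 (S g)
  S-multiplicity g = bit (≤-trans (chosen≤ (λ x → 𝟙 (eq x g)))
      (count≤1 n (λ x → eq x g) λ i j _ _ p q → trans (eq-elim {i} {g} p) (sym (eq-elim {j} {g} q))))
    where
    bit : ∀ {m} → m ≤ 1 → m ≡ 𝟙 (0 <ᵇ m)
    bit z≤n       = refl
    bit (s≤s z≤n) = refl

  total-∑ : ∀ l f → total l (λ x → 𝟙 (∼ (x <ᵇ n))) ≡ 0 → total l f ≡ ∑ n (λ g → multiplicity l g * f g)
  total-∑ []      f _ = sym (∑-zero n λ _ _ → refl)
  total-∑ (x ∷ l) f out = begin
      f x + total l f
        ≡⟨ cong₂ _+_ (sym (∑-single n (f x) x<n)) (total-∑ l f (m+n≡0⇒n≡0 (𝟙 (∼ (x <ᵇ n))) out)) ⟩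
      ∑ n (λ g → if eq x g then f x else 0) + ∑ n (λ g → multiplicity l g * f g)
        ≡⟨ sym (∑-+ n (λ g → if eq x g then f x else 0) (λ g → multiplicity l g * f g)) ⟩
      ∑ n (λ g → (if eq x g then f x else 0) + multiplicity l g * f g)
        ≡⟨ ∑-cong n (λ g _ → trans (cong (_+ multiplicity l g * f g) (pointwise g (dichotomy (eq x g)))) (sym (*-distribʳ-+ (f g) (𝟙 (eq x g)) _))) ⟩
      ∑ n (λ g → (𝟙 (eq x g) + multiplicity l g) * f g) ∎
    where
    open ≡-Reasoning
    x<n : x < n
    x<n with dichotomy (x <ᵇ n)
    ... | inj₁ p = true-<ᵇ p
    ... | inj₂ p with () ← trans (sym (m+n≡0⇒m≡0 (𝟙 (∼ (x <ᵇ n))) out)) (cong (λ b → 𝟙 (∼ b)) p)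
    pointwise : ∀ g → eq x g ≡ true ⊎ eq x g ≡ false → (if eq x g then f x else 0) ≡ 𝟙 (eq x g) * f g
    pointwise g (inj₁ p) = trans (if-true p) (trans (cong f (eq-elim p)) (sym (trans (cong (λ b → 𝟙 b * f g) p) (+-identityʳ (f g)))))
    pointwise g (inj₂ p) = trans (if-false p) (sym (cong (λ b → 𝟙 b * f g) p))

  selected : (ℕ → ℕ) → ℕ
  selected f = ∑ n λ g → 𝟙 (S g) * f g

  total-chosen : ∀ f → total chosen f ≡ selected f
  total-chosen f = trans (total-∑ chosen f (n≤0⇒n≡0 (≤-trans (chosen≤ (λ x → 𝟙 (∼ (x <ᵇ n))))
      (≤-reflexive (∑-zero n λ x x<n → cong (λ b → 𝟙 (∼ b)) (<ᵇ-true x<n))))))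
    (∑-cong n λ g _ → cong (_* f g) (S-multiplicity g))

  length-chosen : length chosen ≡ count n S
  length-chosen = trans (length-total chosen) (trans (total-chosen (λ _ → 1)) (∑-cong n λ g _ → *-identityʳ (𝟙 (S g))))
    where
    length-total : ∀ l → length l ≡ total l (λ _ → 1)
    length-total []      = refl
    length-total (_ ∷ l) = cong suc (length-total l)

  -- Integrality: an error below `N` is less than one unit. The errors that arise here are at most
  -- `n * n + n`.
  cancel-N : ∀ {x y k} → x * N ≤ N * y + k → k < N → x ≤ y
  cancel-N {x} {y} {k} le k<N = s≤s⁻¹ (*-cancelʳ-< N x (suc y) (begin-strict
    x * N         ≤⟨ le ⟩
    N * y + k     <⟨ +-monoʳ-< (N * y) k<N ⟩
    N * y + N     ≡⟨ lemma N y ⟩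
    suc y * N     ∎))
    where
    open ≤-Reasoning
    lemma : ∀ N y → N * y + N ≡ suc y * N
    lemma = solve-∀

  few-selected : ∀ {K} → ∑ n Y ≤ N * K + n → count n S ≤ K
  few-selected {K} Y≤K = cancel-N (begin
      count n S * N               ≡⟨ trans (cong (_* N) (sym length-chosen)) (*-comm (length chosen) N) ⟩
      N * length chosen           ≤⟨ +-cancelʳ-≤ (suc n) _ _ (begin
        N * length chosen + suc n       ≤⟨ start-length (sorted n) ⟩
        total (sorted n) Y + N          ≡⟨ cong (_+ N) (total-sorted n Y) ⟩
        ∑ n Y + N                       ≤⟨ +-monoˡ-≤ N Y≤K ⟩
        N * K + n + N                   ≡⟨ lemma (N * K) n (n * n) ⟩
        N * K + (n + n * n) + suc n     ∎) ⟩
      N * K + (n + n * n)         ∎) (≤-reflexive (lemma′ n (n * n)))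
    where
    open ≤-Reasoning
    lemma : ∀ a b c → a + b + (c + b + 1) ≡ a + (b + c) + suc b
    lemma = solve-∀
    lemma′ : ∀ a b → suc (a + b) ≡ b + a + 1
    lemma′ = solve-∀

  blue-selected : ∀ {b} → b * N ≤ ∑ n (λ g → Y g * B g) + n → b ≤ selected B
  blue-selected {b} b≤ = cancel-N (begin
      b * N                                       ≤⟨ b≤ ⟩
      ∑ n (λ g → Y g * B g) + n                   ≡⟨ cong (_+ n) (sym (total-sorted n (λ g → Y g * B g))) ⟩
      total (sorted n) (λ g → Y g * B g) + n      ≤⟨ +-monoˡ-≤ n (start-blue (sorted n)) ⟩
      N * total chosen B + n * n + n              ≡⟨ cong (λ z → N * z + n * n + n) (total-chosen B) ⟩
      N * selected B + n * n + n                  ≡⟨ +-assoc (N * selected B) (n * n) n ⟩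
      N * selected B + (n * n + n)                ∎) (≤-reflexive (+-comm 1 (n * n + n)))
    where open ≤-Reasoning

  by-levels : ∀ (f : ℕ → ℕ) → ∑ n (λ g → f g * R g) ≡ ∑ n (λ v → ∑ n (λ g → f g * above v g))
  by-levels f = trans (∑-cong n λ g _ → trans (cong (f g *_) (sym (∑-below (R≤ g)))) (sym (∑-* n (f g) (λ v → above v g))))
    (∑-swap n n (λ g v → f g * above v g))

  -- Above the weight of the heaviest unselected item u nothing is lost.
  red-selected : ∀ {r} → r * N ≤ ∑ n (λ g → Y g * R g) + n →
                 r ≤ selected R ⊎ ∃[ u ] u < n × S u ≡ false × r ≤ selected R + R u
  red-selected {r} r≤ with optimum {_≼_ = λ x y → y ≤ x} ≤-refl (λ p q → ≤-trans q p) (λ x y → ≤-total y x) n (λ g → ∼ S g) R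
  ... | inj₁ all = inj₁ (cancel-N (≤-trans r≤ (+-monoˡ-≤ n (begin
      ∑ n (λ g → Y g * R g)             ≤⟨ ∑-mono n (λ g g<n → ≤-trans (*-monoˡ-≤ (R g) (Y≤ g)) (≤-reflexive (pointwise g (all g g<n)))) ⟩
      ∑ n (λ g → N * (𝟙 (S g) * R g))   ≡⟨ ∑-* n N (λ g → 𝟙 (S g) * R g) ⟩
      N * selected R                    ∎))) n<N)
    where
    open ≤-Reasoning
    pointwise : ∀ g → ∼ S g ≡ false → N * R g ≡ N * (𝟙 (S g) * R g)
    pointwise g p with S g
    ... | true = cong (N *_) (sym (+-identityʳ (R g)))
  ... | inj₂ (u , u<n , Su , max) = inj₂ (u , u<n , ∼-elim Su , cancel-N (≤-trans r≤ (+-monoˡ-≤ n (begin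
      ∑ n (λ g → Y g * R g)
        ≡⟨ by-levels Y ⟩
      ∑ n (λ v → ∑ n (λ g → Y g * above v g))
        ≤⟨ ∑-mono n (λ v _ → level v (dichotomy (v <ᵇ R u))) ⟩
      ∑ n (λ v → N * (selected (above v) + above v u))
        ≡⟨ ∑-* n N (λ v → selected (above v) + above v u) ⟩
      N * ∑ n (λ v → selected (above v) + above v u)
        ≡⟨ cong (N *_) (∑-+ n (λ v → selected (above v)) (λ v → above v u)) ⟩
      N * (∑ n (λ v → selected (above v)) + ∑ n (λ v → above v u))
        ≡⟨ cong (N *_) (cong₂ _+_ (sym (by-levels (λ g → 𝟙 (S g)))) (∑-below (R≤ u))) ⟩
      N * (selected R + R u) ∎))) n<N)
    where
    open ≤-Reasoning
    pointwise : ∀ v g → (v <ᵇ R u) ≡ false → g < n → Y g * above v g ≤ N * (𝟙 (S g) * above v g)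
    pointwise v g low g<n with dichotomy (S g)
    ... | inj₁ p = ≤-trans (*-monoˡ-≤ (above v g) (Y≤ g)) (≤-reflexive (cong (N *_) (sym (trans (cong (λ b → 𝟙 b * above v g) p) (+-identityʳ _)))))
    ... | inj₂ p = ≤-trans (≤-reflexive (trans (cong (λ b → Y g * 𝟙 b) (<ᵇ-false (≤-trans (max g g<n (∼-intro p)) (false-<ᵇ low)))) (*-zeroʳ (Y g)))) z≤n
    -- On the levels below `R u` the loss of up to `N` is charged to `u`; on the others every item
    -- above the level is selected and nothing is lost. Over all levels the charges add up to
    -- `N * R u`.
    level : ∀ v → (v <ᵇ R u) ≡ true ⊎ (v <ᵇ R u) ≡ false → ∑ n (λ g → Y g * above v g) ≤ N * (selected (above v) + above v u)
    level v (inj₁ high) = begin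
      ∑ n (λ g → Y g * above v g)                   ≡⟨ sym (total-sorted n (λ g → Y g * above v g)) ⟩
      total (sorted n) (λ g → Y g * above v g)      ≤⟨ start-level v (sorted n) (descending-sorted n) ⟩
      N * total chosen (above v) + N                ≡⟨ cong₂ (λ x y → N * x + y) (total-chosen (above v)) (sym (trans (cong (λ b → N * 𝟙 b) high) (*-identityʳ N))) ⟩
      N * selected (above v) + N * above v u        ≡⟨ sym (*-distribˡ-+ N (selected (above v)) (above v u)) ⟩
      N * (selected (above v) + above v u)          ∎
    level v (inj₂ low) = begin
      ∑ n (λ g → Y g * above v g)                   ≤⟨ ∑-mono n (λ g g<n → pointwise v g low g<n) ⟩
      ∑ n (λ g → N * (𝟙 (S g) * above v g))         ≡⟨ ∑-* n N (λ g → 𝟙 (S g) * above v g) ⟩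
      N * selected (above v)                        ≤⟨ *-monoʳ-≤ N (m≤m+n _ (above v u)) ⟩
      N * (selected (above v) + above v u)          ∎

-- The knapsack table

module KnapsackLemmas (n : ℕ) (adj : ℕ → ℕ → Bool) (red : ℕ → Bool) (it : ℕ → ℕ) where
  open Sums
  open SumLemmas
  open Algorithm
  open Graph n adj
  open Knapsack red it
  open Pairing n

  capacity : ℕ
  capacity = M * M * M * M

  index< : ∀ {κ a β j} → κ ≤ n → a ≤ n → β ≤ n → j ≤ n → index κ a β j < capacity
  index< κ≤ a≤ β≤ j≤ = pair< (pair< (pair< (s≤s κ≤) a≤) β≤) j≤

  stage : ℕ → ℕ → ℕ
  stage = iterate capacity (λ x → if eq x n then 1 else 0) knapsackStep

  knapsack≡ : ∀ x → knapsack x ≡ stage n x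
  knapsack≡ x = cong (λ t → stage t x) (clip-≤ {n} ≤-refl)

  step : ∀ t {κ a β j} → κ ≤ n → a ≤ n → β ≤ n → j ≤ n →
         stage (suc t) (index κ a β j) ≡ transfer t (stage t) κ a β j
  step t {κ} {a} {β} {j} κ≤ a≤ β≤ j≤ = trans (table-< (knapsackStep t (stage t)) (index< κ≤ a≤ β≤ j≤))
      (trans (cong₂ (λ y r → transfer t (stage t) (quot M (quot M y)) (rem M (quot M y)) (rem M y) r)
                (quot-pair ((κ * M + a) * M + β) j≤) (rem-pair ((κ * M + a) * M + β) j≤))
      (trans (cong₂ (λ y r → transfer t (stage t) (quot M y) (rem M y) r j)
                (quot-pair (κ * M + a) β≤) (rem-pair (κ * M + a) β≤))
        (cong₂ (λ y r → transfer t (stage t) y r β j) (quot-pair κ a≤) (rem-pair κ a≤))))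

  weighted : (ℕ → Bool) → (ℕ → ℕ) → ℕ
  weighted C f = ∑ n λ j → 𝟙 (C j) * f j

  bit : ℕ → ℕ → ℕ → ℕ → ℕ → Bool
  bit t κ a β j = 0 <ᵇ stage t (index κ a β j)

  -- `later` keeps the item of the coming round out of the set, so that adding it cannot count it
  -- twice.
  record Encodes (C : ℕ → Bool) (t κ a β : ℕ) : Set where
    field
      number : weighted C (λ _ → 1) ≡ κ
      reds   : weighted C (weight true) ≡ a
      blues  : weighted C (weight false) ≡ β
      later  : ∀ j → t ≤ j → j < n → C j ≡ false

  encodes-cong : ∀ {C D t κ a β} → (∀ j → j < n → C j ≡ D j) → Encodes C t κ a β → Encodes D (suc t) κ a β
  encodes-cong {C} {D} C≗D E = record
    { number = trans (same (λ _ → 1)) (Encodes.number E)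
    ; reds   = trans (same (weight true)) (Encodes.reds E)
    ; blues  = trans (same (weight false)) (Encodes.blues E)
    ; later  = λ j t<j j<n → trans (sym (C≗D j j<n)) (Encodes.later E j (<⇒≤ t<j) j<n) }
    where
    same : ∀ f → weighted D f ≡ weighted C f
    same f = ∑-cong n λ j j<n → cong (λ b → 𝟙 b * f j) (sym (C≗D j j<n))

  encodes-add : ∀ {C D t κ a β} → t < n → (∀ j → j < n → D j ≡ (if eq j t then true else C j)) →
                Encodes C t κ a β → Encodes D (suc t) (κ + 1) (a + weight true t) (β + weight false t)
  encodes-add {C} {D} {t} t<n D≗ E = record
    { number = trans (more (λ _ → 1)) (cong (_+ 1) (Encodes.number E))
    ; reds   = trans (more (weight true)) (cong (_+ weight true t) (Encodes.reds E))
    ; blues  = trans (more (weight false)) (cong (_+ weight false t) (Encodes.blues E))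
    ; later  = λ j t<j j<n → trans (D≗ j j<n) (trans (if-false (eq-false λ j≡t → <⇒≢ t<j (sym j≡t))) (Encodes.later E j (<⇒≤ t<j) j<n)) }
    where
    pointwise : ∀ f j → j < n → eq t j ≡ true ⊎ eq t j ≡ false → 𝟙 (D j) * f j ≡ 𝟙 (C j) * f j + (if eq t j then f t else 0)
    pointwise f j j<n (inj₁ p) with eq-elim {t} {j} p
    ... | refl = trans (cong (λ b → 𝟙 b * f t) (trans (D≗ t t<n) (if-true p))) (trans (+-identityʳ (f t))
                   (sym (cong₂ _+_ (cong (λ b → 𝟙 b * f t) (Encodes.later E t ≤-refl t<n)) (if-true p))))
    pointwise f j j<n (inj₂ p) = trans (cong (λ b → 𝟙 b * f j) (trans (D≗ j j<n) (if-false (eq-false {j} {t} λ { refl → absurd (eq-intro {t} refl) p }))))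
                   (sym (trans (cong (𝟙 (C j) * f j +_) (if-false p)) (+-identityʳ _)))
    more : ∀ f → weighted D f ≡ weighted C f + f t
    more f = trans (∑-cong n λ j j<n → pointwise f j j<n (dichotomy (eq t j)))
      (trans (∑-+ n (λ j → 𝟙 (C j) * f j) (λ j → if eq t j then f t else 0)) (cong (weighted C f +_) (∑-single n (f t) t<n)))

  -- This concerns whatever set the entry happens to hold, while `complete` says only that the entry
  -- for the totals of a given `S` is reached. The set found may differ from `S`, but number and
  -- weights agree, and the candidate depends on nothing else.
  sound : ∀ t {κ a β} → t ≤ n → κ ≤ n → a ≤ n → β ≤ n → reached (stage t) κ a β ≡ true → Encodes (bit t κ a β) t κ a β
  sound zero {κ} {a} {β} _ κ≤ a≤ β≤ r = record
    { number = trans (∑-zero n λ j j<n → cong (λ b → 𝟙 b * 1) (none j j<n)) (sym κ≡0)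
    ; reds   = trans (∑-zero n λ j j<n → cong (λ b → 𝟙 b * weight true j) (none j j<n)) (sym a≡0)
    ; blues  = trans (∑-zero n λ j j<n → cong (λ b → 𝟙 b * weight false j) (none j j<n)) (sym β≡0)
    ; later  = λ j _ → none j }
    where
    at : ∀ {j} → j ≤ n → stage 0 (index κ a β j) ≡ (if eq (index κ a β j) n then 1 else 0)
    at j≤ = table-< (λ x → if eq x n then 1 else 0) (index< κ≤ a≤ β≤ j≤)
    -- Initially the only positive cell is the flag of the empty set, whose packed form is `n`.
    -- Unpacking this equation shows that all three totals are zero.
    index≡n : index κ a β n ≡ n
    index≡n with dichotomy (eq (index κ a β n) n)
    ... | inj₁ p = eq-elim p
    ... | inj₂ p with () ← trans (sym r) (cong (0 <ᵇ_) (trans (at ≤-refl) (if-false p)))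
    top≡0 : (κ * M + a) * M + β ≡ 0
    top≡0 = trans (sym (quot-pair _ ≤-refl)) (trans (cong (quot M) index≡n) (quot-pair 0 {n} ≤-refl))
    β≡0 : β ≡ 0
    β≡0 = m+n≡0⇒n≡0 ((κ * M + a) * M) top≡0
    mid≡0 : κ * M + a ≡ 0
    mid≡0 = trans (sym (quot-pair _ β≤)) (trans (cong (quot M) top≡0) (quot-pair 0 {0} z≤n))
    a≡0 : a ≡ 0
    a≡0 = m+n≡0⇒n≡0 (κ * M) mid≡0
    κ≡0 : κ ≡ 0
    κ≡0 = trans (sym (quot-pair _ a≤)) (trans (cong (quot M) mid≡0) (quot-pair 0 {0} z≤n))
    index≢n : ∀ j → j < n → index κ a β j ≢ n
    index≢n j j<n e = <⇒≢ j<n (trans (sym (rem-pair ((κ * M + a) * M + β) (<⇒≤ j<n)))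
      (trans (cong (rem M) e) (rem-pair 0 {n} ≤-refl)))
    none : ∀ j → j < n → bit 0 κ a β j ≡ false
    none j j<n = cong (0 <ᵇ_) (trans (at (<⇒≤ j<n)) (if-false (eq-false {index κ a β j} {n} (index≢n j j<n))))
  sound (suc t) {κ} {a} {β} t<n κ≤ a≤ β≤ r with dichotomy (reached (stage t) κ a β)
  ... | inj₁ old = encodes-cong (λ j j<n → cong (0 <ᵇ_) (sym (trans (step t κ≤ a≤ β≤ (<⇒≤ j<n)) (if-true old))))
                     (sound t (<⇒≤ t<n) κ≤ a≤ β≤ old)
  ... | inj₂ new with dichotomy ((0 <ᵇ κ) & ∼ (a <ᵇ weight true t) & ∼ (β <ᵇ weight false t) &
                                 reached (stage t) (κ ∸ 1) (a ∸ weight true t) (β ∸ weight false t))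
  ...   | inj₂ fail with () ← trans (sym r) (cong (0 <ᵇ_) (trans (step t κ≤ a≤ β≤ ≤-refl) (trans (if-false new) (if-false fail))))
  ...   | inj₁ ok with &₄-elim (0 <ᵇ κ) (∼ (a <ᵇ weight true t)) (∼ (β <ᵇ weight false t)) ok
  ...     | 0<κ , wa , wβ , old = subst₂ (λ x y → Encodes (bit (suc t) κ a β) (suc t) x y β) (m∸n+n≡m (true-<ᵇ 0<κ)) (m∸n+n≡m (≮ᵇ-elim {a} {weight true t} wa))
      (subst (Encodes (bit (suc t) κ a β) (suc t) _ _) (m∸n+n≡m (≮ᵇ-elim {β} {weight false t} wβ))
        (encodes-add t<n (λ j j<n → trans (cong (0 <ᵇ_) (trans (step t κ≤ a≤ β≤ (<⇒≤ j<n)) (trans (if-false new) (if-true ok))))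
              (push (eq j t)))
          (sound t (<⇒≤ t<n) (≤-trans (m∸n≤m κ 1) κ≤) (≤-trans (m∸n≤m a (weight true t)) a≤) (≤-trans (m∸n≤m β (weight false t)) β≤) old)))
      where
      push : ∀ b {x} → (0 <ᵇ (if b then 1 else x)) ≡ (if b then true else (0 <ᵇ x))
      push true  = refl
      push false = refl

  module _ (S : ℕ → Bool) where

    partial : ℕ → (ℕ → ℕ) → ℕ
    partial t f = ∑ t λ g → 𝟙 (S g) * f g

    ∑-prefix : ∀ {s t} f → s ≤ t → ∑ s f ≤ ∑ t f
    ∑-prefix {s} {t} f s≤t = go (≤⇒≤′ s≤t)
      where
      go : ∀ {t} → s ≤′ t → ∑ s f ≤ ∑ t f
      go ≤′-refl     = ≤-refl
      go (≤′-step p) = ≤-trans (go p) (m≤m+n _ _)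

    partial-number≤ : ∀ {t} → t ≤ n → partial t (λ _ → 1) ≤ n
    partial-number≤ t≤n = ≤-trans (∑-prefix (λ g → 𝟙 (S g) * 1) t≤n)
      (≤-trans (∑≤* n 1 λ g _ → *-monoˡ-≤ 1 (𝟙≤1 (S g))) (≤-reflexive (*-identityʳ n)))

    -- Items are fibres of `it` and thus disjoint, so the totals of any selection fit into the
    -- table.
    partial-weight≤ : ∀ c {t} → t ≤ n → partial t (weight c) ≤ n
    partial-weight≤ c t≤n = ≤-trans (∑-prefix (λ g → 𝟙 (S g) * weight c g) t≤n) (begin
      ∑ n (λ g → 𝟙 (S g) * weight c g)      ≤⟨ ∑-mono n (λ g _ → ≤-trans (*-monoˡ-≤ (weight c g) (𝟙≤1 (S g))) (≤-reflexive (+-identityʳ _))) ⟩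
      ∑ n (weight c)                        ≡⟨ ∑-cong n (λ g _ → ∑-cong n λ p _ → 𝟙-& (eq (it p) g) _) ⟩
      ∑ n (λ g → ∑ n (λ p → if eq (it p) g then 𝟙 (if c then red p else ∼ red p) else 0))
                                            ≤⟨ ∑-fibres≤ n it (λ p → 𝟙 (if c then red p else ∼ red p)) ⟩
      count n (λ p → if c then red p else ∼ red p) ≤⟨ count≤n n _ ⟩
      n                                     ∎) where open ≤-Reasoning

    complete : ∀ t → t ≤ n → reached (stage t) (partial t (λ _ → 1)) (partial t (weight true)) (partial t (weight false)) ≡ true
    complete zero _ = cong (0 <ᵇ_) (trans (table-< (λ x → if eq x n then 1 else 0) (index< {0} {0} {0} {n} z≤n z≤n z≤n ≤-refl)) (if-true (eq-intro {n} refl)))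
    complete (suc t) t<n = trans (cong (0 <ᵇ_) (step t (partial-number≤ t<n) (partial-weight≤ true t<n) (partial-weight≤ false t<n) ≤-refl)) goal
      where
      old = complete t (<⇒≤ t<n)
      κ = partial t (λ _ → 1)
      a = partial t (weight true)
      β = partial t (weight false)
      goal : (0 <ᵇ transfer t (stage t) (κ + 𝟙 (S t) * 1) (a + 𝟙 (S t) * weight true t) (β + 𝟙 (S t) * weight false t) n) ≡ true
      goal with dichotomy (reached (stage t) (κ + 𝟙 (S t) * 1) (a + 𝟙 (S t) * weight true t) (β + 𝟙 (S t) * weight false t))
      ... | inj₁ already = trans (cong (0 <ᵇ_) (if-true already)) already
      ... | inj₂ new with S t
      ...   | false = absurd (subst₂ (λ x y → reached (stage t) x y (β + 0) ≡ true) (sym (+-identityʳ κ)) (sym (+-identityʳ a))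
                        (subst (λ z → reached (stage t) κ a z ≡ true) (sym (+-identityʳ β)) old)) new
      ...   | true = trans (cong (0 <ᵇ_) (trans (if-false new) (trans (if-true conditions) (if-false (eq-false {n} {t} λ n≡t → <⇒≢ t<n (sym n≡t)))))) prior
        where
        drop : ∀ x y → x + (y + 0) ∸ y ≡ x
        drop x y = trans (cong (λ z → x + z ∸ y) (+-identityʳ y)) (m+n∸n≡m x y)
        above : ∀ x y → y ≤ x + (y + 0)
        above x y = ≤-trans (≤-reflexive (sym (+-identityʳ y))) (m≤n+m (y + 0) x)
        prior : reached (stage t) (κ + 1 ∸ 1) (a + (weight true t + 0) ∸ weight true t) (β + (weight false t + 0) ∸ weight false t) ≡ true
        prior = subst₂ (λ x y → reached (stage t) x y (β + (weight false t + 0) ∸ weight false t) ≡ true) (sym (m+n∸n≡m κ 1)) (sym (drop a (weight true t)))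
                  (subst (λ z → reached (stage t) κ a z ≡ true) (sym (drop β (weight false t))) old)
        conditions = &-intro₄ {0 <ᵇ κ + 1} {∼ (a + (weight true t + 0) <ᵇ weight true t)} {∼ (β + (weight false t + 0) <ᵇ weight false t)}
          (<ᵇ-true (m≤n+m 1 κ)) (≮ᵇ-intro (above a (weight true t))) (≮ᵇ-intro (above β (weight false t))) prior

    knapsack-works : Encodes (λ j → 0 <ᵇ knapsack (index (partial n (λ _ → 1)) (partial n (weight true)) (partial n (weight false)) j))
                       n (partial n (λ _ → 1)) (partial n (weight true)) (partial n (weight false))
    knapsack-works = record
      { number = trans (same (λ _ → 1)) (Encodes.number E)
      ; reds   = trans (same (weight true)) (Encodes.reds E)
      ; blues  = trans (same (weight false)) (Encodes.blues E)
      ; later  = λ j n≤j j<n → ⊥-elim (<⇒≱ j<n n≤j) }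
      where
      E = sound n ≤-refl (partial-number≤ ≤-refl) (partial-weight≤ true ≤-refl) (partial-weight≤ false ≤-refl) (complete n ≤-refl)
      same : ∀ f → weighted (λ j → 0 <ᵇ knapsack (index (partial n (λ _ → 1)) (partial n (weight true)) (partial n (weight false)) j)) f ≡
                   weighted (bit n (partial n (λ _ → 1)) (partial n (weight true)) (partial n (weight false))) f
      same f = ∑-cong n λ j _ → cong (λ z → 𝟙 (0 <ᵇ z) * f j) (knapsack≡ (index (partial n (λ _ → 1)) (partial n (weight true)) (partial n (weight false)) j))

-- Preparing the optimum by a merged center or by flowers

module Completeness
  (n : ℕ) (adj : ℕ → ℕ → Bool)
  (adj-sym : ∀ i j → adj i j ≡ true → adj j i ≡ true)
  (adj-refl : ∀ i → i < n → adj i i ≡ true)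
  (adj-range : ∀ i j → adj i j ≡ true → j < n)
  (red : ℕ → Bool) (O : ℕ → Bool)
  where
  open Sums
  open SumLemmas
  open Algorithm
  open Graph n adj
  open GraphLemmas n adj adj-sym adj-refl adj-range

  gained : (ℕ → Bool) → ℕ → ℕ → ℕ → Bool
  gained U o q x = (hop₂ q x & red x & ∼ U x) & ∼ adj o x

  -- `U` is the set of points split off so far, `O′` the optimal balls still to be served, `m` the
  -- number of flowers placed and `c` that of centers spent. `gains` is the surplus: `U` contains
  -- `m * τ` more red points than the optimum covers in it.
  record State (U O′ : ℕ → Bool) (τ m c : ℕ) : Set where
    field
      subset : ∀ o → O′ o ≡ true → O o ≡ true
      number : count n O′ + c ≤ count n O
      rest   : ∀ p → U p ≡ false → cov O p ≡ true → cov O′ p ≡ true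
      gains  : count n (λ p → (red p & U p) & cov O p) + m * τ ≤ count n (λ p → red p & U p)
      gain≤  : ∀ o q → O′ o ≡ true → adj o q ≡ true → count n (gained U o q) ≤ τ

  state-cong : ∀ {U V O′ τ m c} → (∀ p → V p ≡ U p) → State U O′ τ m c → State V O′ τ m c
  state-cong {U} {V} {m = m} V≗U s = record
    { subset = State.subset s
    ; number = State.number s
    ; rest   = λ p Vp → State.rest s p (trans (sym (V≗U p)) Vp)
    ; gains  = subst₂ (λ x y → x + m * _ ≤ y)
        (count-cong n λ p _ → cong (λ v → (red p & v) & cov O p) (sym (V≗U p)))
        (count-cong n λ p _ → cong (red p &_) (sym (V≗U p))) (State.gains s)
    ; gain≤  = λ o q Oo oq → ≤-trans (≤-reflexive (count-cong n λ x _ → cong (λ v → (hop₂ q x & red x & ∼ v) & ∼ adj o x) (V≗U x)))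
        (State.gain≤ s o q Oo oq) }

  hop₂-none : ∀ p → hop₂ n p ≡ false
  hop₂-none p with dichotomy (hop₂ n p)
  ... | inj₁ h = ⊥-elim (<-irrefl refl (hop₂-rangeˡ h))
  ... | inj₂ h = h

  ∥-identityʳ : ∀ b {c} → c ≡ false → (b ∥ c) ≡ b
  ∥-identityʳ true  _ = refl
  ∥-identityʳ false p = p

  count-remove : ∀ {P : ℕ → Bool} {o} → o < n → P o ≡ true → count n (λ i → P i & ∼ eq o i) + 1 ≤ count n P
  count-remove {P} {o} o<n Po = begin
    count n (λ i → P i & ∼ eq o i) + 1                              ≡⟨ +-comm _ 1 ⟩
    1 + count n (λ i → P i & ∼ eq o i)                              ≤⟨ +-monoˡ-≤ _ (begin
      1                                     ≡⟨ sym (cong 𝟙 (&-intro Po (eq-intro {o} refl))) ⟩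
      𝟙 (P o & eq o o)                      ≤⟨ ∑-term n (λ i → 𝟙 (P i & eq o i)) o<n ⟩
      count n (λ i → P i & eq o i)          ∎) ⟩
    count n (λ i → P i & eq o i) + count n (λ i → P i & ∼ eq o i)   ≡⟨ sym (count-split n P (eq o)) ⟩
    count n P                                                       ∎ where open ≤-Reasoning

  initially : State (hop₃ n) O n 0 0
  initially = record
    { subset = λ o Oo → Oo
    ; number = ≤-reflexive (+-identityʳ _)
    ; rest   = λ p _ c → c
    ; gains  = ≤-trans (≤-reflexive (+-identityʳ _)) (count-mono n λ p _ q → &-fst (red p & hop₃ n p) q)
    ; gain≤  = λ o q _ _ → count≤n n (gained (hop₃ n) o q) }

  -- Two balls of O within reach of j: the center j alone serves both.
  merged : ∀ {o o′ j} → o < n → o′ < n → O o ≡ true → O o′ ≡ true → o ≢ o′ → hop₂ j o ≡ true → hop₂ j o′ ≡ true →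
           ∃[ O′ ] State (hop₃ j) O′ n 0 2
  merged {o} {o′} {j} o<n o′<n Oo Oo′ o≢o′ jo jo′ = O₂ , record
    { subset = λ i p → &-fst (O i) (&-fst (O₁ i) p)
    ; number = begin
        count n O₂ + 2          ≡⟨ sym (+-assoc (count n O₂) 1 1) ⟩
        count n O₂ + 1 + 1      ≤⟨ +-monoˡ-≤ 1 (count-remove {O₁} o′<n (&-intro Oo′ (∼-intro (eq-false o≢o′)))) ⟩
        count n O₁ + 1          ≤⟨ count-remove {O} o<n Oo ⟩
        count n O               ∎
    ; rest   = rest
    ; gains  = ≤-trans (≤-reflexive (+-identityʳ _)) (count-mono n λ p _ q → &-fst (red p & hop₃ j p) q)
    ; gain≤  = λ o q _ _ → count≤n n (gained (hop₃ j) o q) }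
    where
    open ≤-Reasoning
    O₁ O₂ : ℕ → Bool
    O₁ i = O i & ∼ eq o i
    O₂ i = O₁ i & ∼ eq o′ i
    reach : ∀ {i p} → hop₂ j i ≡ true → adj i p ≡ true → hop₃ j p ≡ true
    reach {i} ji ip with hop₂-elim ji
    ... | u , ju , ui = hop₃-intro u i ju ui ip
    rest : ∀ p → hop₃ j p ≡ false → cov O p ≡ true → cov O₂ p ≡ true
    rest p out c with cov-elim {O} c
    ... | i , i<n , Oi , ip = cov-intro {O₂} i (&-intro (&-intro Oi (∼-intro (eq-false {o} {i} λ { refl → absurd (reach jo ip) out })))
                                (∼-intro (eq-false {o′} {i} λ { refl → absurd (reach jo′ ip) out }))) ip

  module Separated
    (separated : ∀ {o o′ j} → O o ≡ true → O o′ ≡ true → hop₂ j o ≡ true → hop₂ j o′ ≡ true → o ≡ o′) where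

    -- `τ` is the least number that no gain exceeds. Unless it is zero, some gain exceeds its
    -- predecessor and so attains it; at zero any remaining ball will do, with `q = o`.
    largest : ∀ U O′ → (∀ i → i < n → O′ i ≡ false) ⊎
      ∃[ o ] ∃[ q ] ∃[ τ ] o < n × O′ o ≡ true × adj o q ≡ true × τ ≤ count n (gained U o q) ×
        (∀ o q → O′ o ≡ true → adj o q ≡ true → count n (gained U o q) ≤ τ)
    largest U O′ with least n bounded bounded-n
      where
      exceeds : ℕ → ℕ → ℕ → Bool
      exceeds v o q = O′ o & adj o q & (v <ᵇ count n (gained U o q))
      bounded : ℕ → Bool
      bounded v = ∼ any n (λ o → any n (exceeds v o))
      bounded-n : bounded n ≡ true
      bounded-n with dichotomy (any n (λ o → any n (exceeds n o)))
      ... | inj₂ p = ∼-intro p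
      ... | inj₁ p with any-elim {n} {λ o → any n (exceeds n o)} p
      ...   | o , _ , p′ with any-elim {n} {exceeds n o} p′
      ...     | q , _ , p″ = ⊥-elim (<⇒≱ (true-<ᵇ (proj₂ (proj₂ (&₃-elim (O′ o) (adj o q) p″)))) (count≤n n (gained U o q)))
    ... | τ , _ , ok , below = choose τ ok below
      where
      exceeds : ℕ → ℕ → ℕ → Bool
      exceeds v o q = O′ o & adj o q & (v <ᵇ count n (gained U o q))
      all≤ : ∀ τ → ∼ any n (λ o → any n (exceeds τ o)) ≡ true →
             ∀ o q → O′ o ≡ true → adj o q ≡ true → count n (gained U o q) ≤ τ
      all≤ τ ok o q Oo oq = ≮⇒≥ λ lt → absurd (any-intro {n} {λ o → any n (exceeds τ o)} (adj-rangeˡ o q oq)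
        (any-intro {n} {exceeds τ o} (adj-range o q oq) (&-intro₃ Oo oq (<ᵇ-true lt)))) (∼-elim ok)
      choose : ∀ τ → ∼ any n (λ o → any n (exceeds τ o)) ≡ true → (∀ i → i < τ → ∼ any n (λ o → any n (exceeds i o)) ≡ false) →
        (∀ i → i < n → O′ i ≡ false) ⊎
        ∃[ o ] ∃[ q ] ∃[ τ ] o < n × O′ o ≡ true × adj o q ≡ true × τ ≤ count n (gained U o q) ×
          (∀ o q → O′ o ≡ true → adj o q ≡ true → count n (gained U o q) ≤ τ)
      choose zero ok below with dichotomy (any n O′)
      ... | inj₂ none = inj₁ (any-false none)
      ... | inj₁ some with any-elim {n} {O′} some
      ...   | o , o<n , Oo = inj₂ (o , o , 0 , o<n , Oo , adj-refl o o<n , z≤n , all≤ 0 ok)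
      choose (suc v) ok below with any-elim {n} {λ o → any n (exceeds v o)} (∼-false (below v ≤-refl))
        where
        ∼-false : ∀ {b} → ∼ b ≡ false → b ≡ true
        ∼-false {true} _ = refl
      ... | o , o<n , p with any-elim {n} {exceeds v o} p
      ...   | q , q<n , p′ with &₃-elim (O′ o) (adj o q) p′
      ...     | Oo , oq , lt = inj₂ (o , q , suc v , o<n , Oo , oq , true-<ᵇ lt , all≤ (suc v) ok)

    -- The red points gained lie outside the ball of `o`, and by separation no other optimal ball
    -- covers them, so they add `τ′` to the surplus. The earlier surplus was counted with `τ`, which
    -- is at least `τ′`. If no ball remains, the slot stays empty and the bound drops to zero.
    extend : ∀ {U O′ τ m c} → τ ≤ n → State U O′ τ m c →
      ∃[ q ] ∃[ O″ ] ∃[ τ′ ] q ≤ n × τ′ ≤ n × State (λ p → U p ∥ hop₂ q p) O″ τ′ (suc m) (c + 𝟙 (q <ᵇ n))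
    extend {U} {O′} {τ} {m} {c} τ≤n s with largest U O′
    ... | inj₁ none = n , O′ , 0 , ≤-refl , z≤n , state-cong {m = suc m} (λ p → ∥-identityʳ (U p) (hop₂-none p)) (record
      { subset = State.subset s
      ; number = ≤-trans (≤-reflexive (cong (count n O′ +_) (trans (cong (λ b → c + 𝟙 b) (<ᵇ-false {n} ≤-refl)) (+-identityʳ c)))) (State.number s)
      ; rest   = State.rest s
      ; gains  = ≤-trans (≤-reflexive (trans (cong (count n (λ p → (red p & U p) & cov O p) +_) (*-zeroʳ m)) (+-identityʳ _)))
                   (≤-trans (m≤m+n _ (m * τ)) (State.gains s))
      ; gain≤  = λ o q Oo oq → absurd Oo (none o (adj-rangeˡ o q oq)) })
    ... | inj₂ (o , q , τ′ , o<n , Oo , oq , τ′≤ , all≤) = q , O″ , τ′ , <⇒≤ q<n , ≤-trans τ′≤ (count≤n n (gained U o q)) , record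
      { subset = λ i p → State.subset s i (&-fst (O′ i) p)
      ; number = begin
          count n O″ + (c + 𝟙 (q <ᵇ n))   ≡⟨ cong (λ b → count n O″ + (c + 𝟙 b)) (<ᵇ-true q<n) ⟩
          count n O″ + (c + 1)            ≡⟨ lemma (count n O″) c ⟩
          count n O″ + 1 + c              ≤⟨ +-monoˡ-≤ c (count-remove {O′} o<n Oo) ⟩
          count n O′ + c                  ≤⟨ State.number s ⟩
          count n O                       ∎
      ; rest   = rest
      ; gains  = gains
      ; gain≤  = λ i x Oi ix → ≤-trans (count-mono n λ y _ g → let px , ry , uy = &₃-elim (hop₂ x y) (red y) (&-fst (hop₂ x y & red y & ∼ U′ y) g) in
          &-intro (&-intro₃ px ry (∼-intro (∥-falseˡ (∼-elim uy)))) (&-snd (hop₂ x y & red y & ∼ U′ y) g))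
          (all≤ i x (&-fst (O′ i) Oi) ix) }
      where
      open ≤-Reasoning
      q<n = adj-range o q oq
      U′ O″ : ℕ → Bool
      U′ p = U p ∥ hop₂ q p
      O″ i = O′ i & ∼ eq o i
      lemma : ∀ x c → x + (c + 1) ≡ x + 1 + c
      lemma = solve-∀
      ∥-falseˡ : ∀ {b c} → (b ∥ c) ≡ false → b ≡ false
      ∥-falseˡ {false} _ = refl
      rest : ∀ p → U′ p ≡ false → cov O p ≡ true → cov O″ p ≡ true
      rest p out c with cov-elim {O′} (State.rest s p (∥-falseˡ out) c)
      ... | i , i<n , Oi , ip = cov-intro {O″} i (&-intro Oi (∼-intro (eq-false {o} {i} λ { refl →
              absurd (∥-introʳ (U p) (hop₂-intro o (adj-sym o q oq) ip)) out }))) ip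
      gains : count n (λ p → (red p & U′ p) & cov O p) + suc m * τ′ ≤ count n (λ p → red p & U′ p)
      gains = begin
        count n (λ p → (red p & U′ p) & cov O p) + (τ′ + m * τ′)
          ≤⟨ +-mono-≤ (count-cover n {Q = λ p → (red p & U p) & cov O p} {S = λ p → (hop₂ q p & red p & ∼ U p) & cov O p} split)
               (+-mono-≤ τ′≤ (*-monoʳ-≤ m (≤-trans τ′≤ (State.gain≤ s o q Oo oq)))) ⟩
        count n (λ p → (red p & U p) & cov O p) + count n (λ p → (hop₂ q p & red p & ∼ U p) & cov O p) + (count n (gained U o q) + m * τ)
          ≡⟨ shuffle (count n (λ p → (red p & U p) & cov O p)) _ (count n (gained U o q)) (m * τ) ⟩
        (count n (λ p → (red p & U p) & cov O p) + m * τ) + (count n (λ p → (hop₂ q p & red p & ∼ U p) & cov O p) + count n (gained U o q))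
          ≤⟨ +-mono-≤ (State.gains s) (count-disjoint n {S = λ p → hop₂ q p & red p & ∼ U p}
               (λ p _ → &-fst (hop₂ q p & red p & ∼ U p)) (λ p _ → &-fst (hop₂ q p & red p & ∼ U p)) fresh) ⟩
        count n (λ p → red p & U p) + count n (λ p → hop₂ q p & red p & ∼ U p)
          ≤⟨ count-disjoint n {S = λ p → red p & U′ p}
               (λ p _ r → &-intro (&-fst (red p) r) (∥-introˡ (&-snd (red p) r)))
               (λ p _ r → let h , rp , _ = &₃-elim (hop₂ q p) (red p) r in &-intro rp (∥-introʳ (U p) h))
               apart ⟩
        count n (λ p → red p & U′ p) ∎
        where
        shuffle : ∀ a b c d → a + b + (c + d) ≡ (a + d) + (b + c)
        shuffle = solve-∀
        split : ∀ p → p < n → ((red p & U′ p) & cov O p) ≡ true →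
          ((red p & U p) & cov O p) ≡ true ⊎ ((hop₂ q p & red p & ∼ U p) & cov O p) ≡ true
        split p _ r with dichotomy (U p)
        ... | inj₁ Up = inj₁ (&-intro (&-intro (&-fst (red p) (&-fst (red p & U′ p) r)) Up) (&-snd (red p & U′ p) r))
        ... | inj₂ Up with ∥-elim (U p) (&-snd (red p) (&-fst (red p & U′ p) r))
        ...   | inj₁ Up′ = absurd Up′ Up
        ...   | inj₂ h = inj₂ (&-intro (&-intro₃ h (&-fst (red p) (&-fst (red p & U′ p) r)) (∼-intro Up)) (&-snd (red p & U′ p) r))
        -- A covered point in the flower of q lies in the ball of o.
        fresh : ∀ p → p < n → ((hop₂ q p & red p & ∼ U p) & cov O p) ≡ true → gained U o q p ≡ false
        fresh p _ r with dichotomy (gained U o q p)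
        ... | inj₂ g = g
        ... | inj₁ g with cov-elim {O} (&-snd (hop₂ q p & red p & ∼ U p) r) | hop₂-elim (&-fst (hop₂ q p) (&-fst (hop₂ q p & red p & ∼ U p) r))
        ...   | i , _ , Oi , ip | j , qj , jp = absurd (subst (λ x → adj x p ≡ true) i≡o ip) (∼-elim (&-snd (hop₂ q p & red p & ∼ U p) g))
          where
          -- The point `j` lies between `q` and `p`: in two hops it reaches `o` through `q` and `i`
          -- through `p`.
          i≡o : i ≡ o
          i≡o = separated Oi (State.subset s o Oo) (hop₂-intro p jp (adj-sym i p ip)) (hop₂-intro q (adj-sym q j qj) (adj-sym o q oq))
        apart : ∀ p → p < n → (red p & U p) ≡ true → (hop₂ q p & red p & ∼ U p) ≡ false
        apart p _ r with dichotomy (hop₂ q p & red p & ∼ U p)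
        ... | inj₂ g = g
        ... | inj₁ g = absurd (&-snd (red p) r) (∼-elim (proj₂ (proj₂ (&₃-elim (hop₂ q p) (red p) g))))

  -- `slack` is what pays for the cluster lost in rounding: a spare center if two balls were merged,
  -- otherwise `3τ` red points of `U` beyond those that the optimum covers.
  record Prepared (q₀ q₁ q₂ q₃ τ : ℕ) : Set where
    U = region q₀ q₁ q₂ q₃
    used = 𝟙 (q₀ <ᵇ n) + 𝟙 (q₁ <ᵇ n) + 𝟙 (q₂ <ᵇ n) + 𝟙 (q₃ <ᵇ n)
    field
      {O′}   : ℕ → Bool
      number : count n O′ + used ≤ count n O
      rest   : ∀ p → U p ≡ false → cov O p ≡ true → cov O′ p ≡ true
      gain≤  : ∀ o q → O′ o ≡ true → adj o q ≡ true → count n (gained U o q) ≤ τ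
      slack  : count n O′ + used + 1 ≤ count n O ⊎
               count n (λ p → (red p & U p) & cov O p) + (τ + τ + τ) ≤ count n (λ p → red p & U p)

  clash : ∀ o o′ j → Bool
  clash o o′ j = (O o & O o′ & ∼ eq o o′) & hop₂ j o & hop₂ j o′

  prepare : ∃[ q₀ ] ∃[ q₁ ] ∃[ q₂ ] ∃[ q₃ ] ∃[ τ ] q₀ ≤ n × q₁ ≤ n × q₂ ≤ n × q₃ ≤ n × τ ≤ n × Prepared q₀ q₁ q₂ q₃ τ
  prepare with dichotomy (any n λ o → any n λ o′ → any n λ j → clash o o′ j)
  ... | inj₁ p with any-elim {n} {λ o → any n λ o′ → any n λ j → clash o o′ j} p
  ...   | o , o<n , p′ with any-elim {n} {λ o′ → any n λ j → clash o o′ j} p′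
  ...     | o′ , o′<n , p″ with any-elim {n} {λ j → clash o o′ j} p″
  ...       | j , j<n , r with &₃-elim (O o & O o′ & ∼ eq o o′) (hop₂ j o) r
  ...         | r′ , jo , jo′ with &₃-elim (O o) (O o′) r′
  ...           | Oo , Oo′ , ne with merged o<n o′<n Oo Oo′ (λ e → absurd (eq-intro e) (∼-elim ne)) jo jo′
  ...             | O′ , s = j , n , n , n , n , <⇒≤ j<n , ≤-refl , ≤-refl , ≤-refl , ≤-refl , record
    { number = ≤-trans (m≤m+n _ 1) number′
    ; rest   = State.rest s′
    ; gain≤  = State.gain≤ s′
    ; slack  = inj₁ number′ }
    where
    s′ : State (region j n n n) O′ n 0 2
    s′ = state-cong {m = 0} (λ p → trans (∥-identityʳ _ (hop₂-none p)) (trans (∥-identityʳ _ (hop₂-none p)) (∥-identityʳ _ (hop₂-none p)))) s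
    number′ : count n O′ + (𝟙 (j <ᵇ n) + 𝟙 (n <ᵇ n) + 𝟙 (n <ᵇ n) + 𝟙 (n <ᵇ n)) + 1 ≤ count n O
    number′ rewrite <ᵇ-true j<n | <ᵇ-false {n} ≤-refl = ≤-trans (≤-reflexive (+-assoc (count n O′) 1 1)) (State.number s′)
  prepare | inj₂ none =
    let
      open Separated separated
      q₁ , _ , τ₁ , q₁≤ , τ₁≤ , s₁ = extend {m = 0} ≤-refl initially
      q₂ , _ , τ₂ , q₂≤ , τ₂≤ , s₂ = extend τ₁≤ s₁
      q₃ , _ , τ₃ , q₃≤ , τ₃≤ , s₃ = extend τ₂≤ s₂
    in n , q₁ , q₂ , q₃ , τ₃ , ≤-refl , q₁≤ , q₂≤ , q₃≤ , τ₃≤ , prepared {q₁} {q₂} {q₃} s₃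
    where
    lemma : ∀ τ → τ + τ + τ ≡ 3 * τ
    lemma = solve-∀
    prepared : ∀ {q₁ q₂ q₃ O₃ τ₃} → State (region n q₁ q₂ q₃) O₃ τ₃ 3 (𝟙 (q₁ <ᵇ n) + 𝟙 (q₂ <ᵇ n) + 𝟙 (q₃ <ᵇ n)) → Prepared n q₁ q₂ q₃ τ₃
    prepared {q₁} {q₂} {q₃} {O₃} {τ₃} s = record
      { number = ≤-trans (≤-reflexive (cong (λ b → count n O₃ + (𝟙 b + 𝟙 (q₁ <ᵇ n) + 𝟙 (q₂ <ᵇ n) + 𝟙 (q₃ <ᵇ n))) (<ᵇ-false {n} ≤-refl))) (State.number s)
      ; rest   = State.rest s
      ; gain≤  = State.gain≤ s
      ; slack  = inj₂ (≤-trans (≤-reflexive (cong (count n (λ p → (red p & region n q₁ q₂ q₃ p) & cov O p) +_) (lemma τ₃))) (State.gains s)) }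
    separated : ∀ {o o′ j} → O o ≡ true → O o′ ≡ true → hop₂ j o ≡ true → hop₂ j o′ ≡ true → o ≡ o′
    separated {o} {o′} {j} Oo Oo′ jo jo′ with o ≟ o′
    ... | yes e = e
    ... | no ne = absurd (any-intro {n} {λ o → any n λ o′ → any n λ j → clash o o′ j} o<n
        (any-intro {n} {λ o′ → any n λ j → clash o o′ j} o′<n
          (any-intro {n} {clash o o′} j<n (&-intro₃ (&-intro₃ Oo Oo′ (∼-intro (eq-false ne))) jo jo′)))) none
      where
      o<n = hop₂-rangeˡ (hop₂-sym jo)
      o′<n = hop₂-rangeˡ (hop₂-sym jo′)
      j<n = hop₂-rangeˡ jo

-- Combining the dense and the sparse part

module Assembly
  (n : ℕ) (adj : ℕ → ℕ → Bool)
  (adj-sym : ∀ i j → adj i j ≡ true → adj j i ≡ true)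
  (adj-refl : ∀ i → i < n → adj i i ≡ true)
  (adj-range : ∀ i j → adj i j ≡ true → j < n)
  (red : ℕ → Bool) (O : ℕ → Bool)
  where
  open Sums
  open SumLemmas
  open Algorithm
  open Graph n adj
  open GraphLemmas n adj adj-sym adj-refl adj-range

  fibre-count : ∀ (h : ℕ → ℕ) (P W : ℕ → Bool) →
    ∑ n (λ g → 𝟙 (P g) * count n (λ p → eq (h p) g & W p)) ≡ count n (λ p → W p & (h p <ᵇ n) & P (h p))
  fibre-count h P W = begin
    ∑ n (λ g → 𝟙 (P g) * count n (λ p → eq (h p) g & W p))
      ≡⟨ ∑-cong n (λ g g<n → trans (sym (∑-* n (𝟙 (P g)) (λ p → 𝟙 (eq (h p) g & W p))))
           (∑-cong n λ p _ → pointwise g p g<n (dichotomy (eq (h p) g)))) ⟩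
    ∑ n (λ g → ∑ n (λ p → if eq (h p) g then 𝟙 (W p & (h p <ᵇ n) & P (h p)) else 0))
      ≡⟨ sym (∑-fibres n h (λ p → 𝟙 (W p & (h p <ᵇ n) & P (h p))) λ p _ 0< →
           true-<ᵇ (proj₁ (proj₂ (&₃-elim (W p) (h p <ᵇ n) (𝟙-positive 0<))))) ⟩
    count n (λ p → W p & (h p <ᵇ n) & P (h p)) ∎
    where
    open ≡-Reasoning
    bools : ∀ b w → 𝟙 b * 𝟙 w ≡ 𝟙 (w & b)
    bools true  true  = refl
    bools true  false = refl
    bools false true  = refl
    bools false false = refl
    pointwise : ∀ g p → g < n → eq (h p) g ≡ true ⊎ eq (h p) g ≡ false →
      𝟙 (P g) * 𝟙 (eq (h p) g & W p) ≡ (if eq (h p) g then 𝟙 (W p & (h p <ᵇ n) & P (h p)) else 0)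
    pointwise g p g<n (inj₂ e) = trans (cong (λ b → 𝟙 (P g) * 𝟙 (b & W p)) e) (trans (*-zeroʳ (𝟙 (P g))) (sym (if-false e)))
    pointwise g p g<n (inj₁ e) = trans (cong (λ b → 𝟙 (P g) * 𝟙 (b & W p)) e) (trans (bools (P g) (W p))
      (sym (trans (if-true e) (trans (cong (λ x → 𝟙 (W p & (x <ᵇ n) & P x)) (eq-elim {h p} e)) (cong (λ b → 𝟙 (W p & b & P g)) (<ᵇ-true g<n))))))

  slotsUsed : ℕ → ℕ → ℕ → ℕ → ℕ
  slotsUsed q₀ q₁ q₂ q₃ = 𝟙 (q₀ <ᵇ n) + 𝟙 (q₁ <ᵇ n) + 𝟙 (q₂ <ᵇ n) + 𝟙 (q₃ <ᵇ n)

  -- The data of the dense and of the sparse part are parameters here, so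
  -- that they are not unfolded.
  module Combination
    {q₀ q₁ q₂ q₃ τ : ℕ} {U Oᵈ Oˢ Sᵈ L : ℕ → Bool} {A : ℕ → ℕ}
    (U-region : ∀ p → U p ≡ true → region q₀ q₁ q₂ q₃ p ≡ true)
    (L-range : ∀ p → L p ≡ true → p < n)
    (L-unowned : ∀ p → L p ≡ true → n ≤ A p)
    (L-outside : ∀ p → L p ≡ true → U p ≡ false)
    (L-light : ∀ u → L u ≡ true → count n (λ x → hop₂ u x & red x & L x) ≤ τ + τ + τ)
    (owned : ∀ p → p < n → A p < n → hop₃ (A p) p ≡ true × U p ≡ false)
    (covered-split : ∀ p → U p ≡ false → cov O p ≡ true → (A p < n × Sᵈ (A p) ≡ true) ⊎ (L p ≡ true × cov Oˢ p ≡ true))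
    (dense-count : count n Sᵈ ≤ count n Oᵈ)
    (number : count n Oᵈ + count n Oˢ + slotsUsed q₀ q₁ q₂ q₃ ≤ count n O)
    (slack : count n Oᵈ + count n Oˢ + slotsUsed q₀ q₁ q₂ q₃ + 1 ≤ count n O ⊎
             count n (λ p → (red p & U p) & cov O p) + (τ + τ + τ) ≤ count n (λ p → red p & U p))
    {z : ℕ → ℕ} (relaxed : SparseLemmas.RelaxLemmas.Relaxed n adj adj-sym adj-refl adj-range red L L-range Oˢ z)
    where
    open SparseLemmas n adj adj-sym adj-refl adj-range red L L-range using (side; member?; centerMass; module ClusterLemmas; module RelaxLemmas)

    used : ℕ
    used = slotsUsed q₀ q₁ q₂ q₃

    private module RL = RelaxLemmas Oˢ
    open RL using (required)

    private module CL = ClusterLemmas z (RL.Relaxed.bounded relaxed)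
    open CL using (clusterSize)

    C : ℕ → ℕ
    C = Sparse.cluster red L z

    it : ℕ → ℕ
    it = item A C

    open Knapsack red it using (weight; index; knapsack)
    private module KL = KnapsackLemmas n adj red it

    -- Cut off at `n`, so that the bound by `N` holds for every index, as the rounding asks.
    Y : ℕ → ℕ
    Y = table n (centerMass z)

    Y≤N : ∀ g → Y g ≤ n * n + n + 1
    Y≤N g with g <? n
    ... | no g≮n = ≤-trans (≤-reflexive (table-≥ (centerMass z) (≮⇒≥ g≮n))) z≤n
    ... | yes g<n = ≤-trans (≤-reflexive (table-< (centerMass z) g<n)) (capped (eq (C g) g))
      where
      capped : ∀ b → (if b then z g else 0) ≤ N
      capped true  = RL.Relaxed.bounded relaxed g g<n
      capped false = z≤n

    private module RO = Rounding n Y (clusterSize true) (clusterSize false) Y≤N (λ g → count≤n n _) (λ g → count≤n n _)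
    open RO using (S; selected)

    required≤ : ∀ c → required c * N ≤ ∑ n (λ g → Y g * clusterSize c g) + n
    required≤ c = ≤-trans (RL.Relaxed.enough relaxed c) (+-monoˡ-≤ n (≤-trans (CL.mass≤ c)
      (≤-reflexive (∑-cong n λ g g<n → cong (_* clusterSize c g) (sym (table-< (centerMass z) g<n))))))

    S-number : count n S ≤ count n Oˢ
    S-number = RO.few-selected (≤-trans (≤-reflexive (∑-cong n λ g g<n → table-< (centerMass z) g<n)) (RL.Relaxed.few relaxed))

    S-blue : required false ≤ selected (clusterSize false)
    S-blue = RO.blue-selected (required≤ false)

    S-red : required true ≤ selected (clusterSize true) ⊎
            ∃[ u ] u < n × S u ≡ false × required true ≤ selected (clusterSize true) + clusterSize true u
    S-red = RO.red-selected (required≤ true)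

    -- A cluster lies in the flower of a light point.
    cluster-light : ∀ u → clusterSize true u ≤ τ + τ + τ
    cluster-light u with 0 <? clusterSize true u
    ... | no ¬0< = ≤-trans (≮⇒≥ ¬0<) z≤n
    ... | yes 0< with ∑-positive n (λ p → 𝟙 (eq (C p) u & member? true p)) 0<
    ...   | p , p<n , 0<′ = ≤-trans (count-mono n {λ x → eq (C x) u & member? true x} λ x x<n m →
              inside x x<n (eq-elim (&-fst (eq (C x) u) m)) (&-snd (eq (C x) u) m)) (L-light u Lu)
      where
      c : (eq (C p) u & member? true p) ≡ true
      c = 𝟙-positive 0<′
      belongs : ∀ x → x < n → L x ≡ true → C x ≡ u → CL.Member CL.rounds x u
      belongs x x<n Lx Cx≡u = subst (CL.Member CL.rounds x) Cx≡u (CL.cluster-member x x<n (CL.cluster< x x<n Lx))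
      Lu : L u ≡ true
      Lu = CL.Member.leader-in (belongs p p<n (&-fst (L p) (&-snd (eq (C p) u) c)) (eq-elim (&-fst (eq (C p) u) c)))
      inside : ∀ x → x < n → C x ≡ u → member? true x ≡ true → hop₂ u x & red x & L x ≡ true
      inside x x<n Cx≡u m = let Lx = &-fst (L x) m in
        &-intro₃ (CL.Member.close (belongs x x<n Lx Cx≡u)) (&-snd (L x) m) Lx

    denseSize : Bool → ℕ → ℕ
    denseSize c g = count n λ p → eq (A p) g & side c p

    item-owned : ∀ p → A p < n → it p ≡ A p
    item-owned p own = if-true (<ᵇ-true own)

    item-free : ∀ p → L p ≡ true → it p ≡ C p
    item-free p Lp = if-false (<ᵇ-false (L-unowned p Lp))

    item-hop₃ : ∀ {p} → p < n → it p < n → hop₃ (it p) p ≡ true × U p ≡ false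
    item-hop₃ {p} p<n it<n with A p <? n
    ... | yes own = subst (λ x → hop₃ x p ≡ true × U p ≡ false) (sym (item-owned p own)) (owned p p<n own)
    ... | no ¬own = subst (λ x → hop₃ x p ≡ true × U p ≡ false) (sym it≡)
            (hop₂⇒hop₃ (CL.Member.close m) , L-outside p (CL.Member.point-in m))
      where
      it≡ : it p ≡ C p
      it≡ = if-false (<ᵇ-false (≮⇒≥ ¬own))
      m = CL.cluster-member p p<n (subst (_< n) it≡ it<n)

    sizes≤weight : ∀ c g → g < n → denseSize c g + clusterSize c g ≤ weight c g
    sizes≤weight c g g<n = count-disjoint n {P = λ p → eq (A p) g & side c p} {S = λ p → eq (it p) g & side c p}
      (λ p _ q → let e = eq-elim (&-fst (eq (A p) g) q) in
        &-intro (eq-intro {it p} {g} (trans (item-owned p (subst (_< n) (sym e) g<n)) e)) (&-snd (eq (A p) g) q))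
      (λ p _ q → let m = &-snd (eq (C p) g) q in
        &-intro (eq-intro {it p} {g} (trans (item-free p (&-fst (L p) m)) (eq-elim (&-fst (eq (C p) g) q)))) (&-snd (L p) m))
      apart
      where
      apart : ∀ p → p < n → (eq (A p) g & side c p) ≡ true → (eq (C p) g & member? c p) ≡ false
      apart p _ q with dichotomy (eq (C p) g & member? c p)
      ... | inj₂ r = r
      ... | inj₁ r = ⊥-elim (<⇒≱ (subst (_< n) (sym (eq-elim (&-fst (eq (A p) g) q))) g<n)
              (L-unowned p (&-fst (L p) (&-snd (eq (C p) g) r))))

    denseTotal : Bool → ℕ
    denseTotal c = ∑ n λ g → 𝟙 (Sᵈ g) * denseSize c g

    -- What the optimum covers falls into three parts: points of `U`, points owned by a member of
    -- `Sᵈ`, and light points covered by `Oˢ`. The last part is what the relaxation was required to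
    -- supply.
    demand : ∀ c → count n (λ p → side c p & cov O p) ≤
             count n (λ p → (side c p & U p) & cov O p) + (denseTotal c + required c)
    demand c = begin
      count n (λ p → side c p & cov O p)
        ≤⟨ count-cover n {Q = λ p → (side c p & U p) & cov O p} {S = λ p → owner-chosen p ∥ sparse p} split ⟩
      count n (λ p → (side c p & U p) & cov O p) + count n (λ p → owner-chosen p ∥ sparse p)
        ≤⟨ +-monoʳ-≤ (count n (λ p → (side c p & U p) & cov O p)) (count-∥≤ n owner-chosen sparse) ⟩
      count n (λ p → (side c p & U p) & cov O p) + (count n owner-chosen + required c)
        ≡⟨ cong (λ x → count n (λ p → (side c p & U p) & cov O p) + (x + required c)) (sym (fibre-count A Sᵈ (side c))) ⟩
      count n (λ p → (side c p & U p) & cov O p) + (denseTotal c + required c) ∎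
      where
      open ≤-Reasoning
      owner-chosen sparse : ℕ → Bool
      owner-chosen p = side c p & (A p <ᵇ n) & Sᵈ (A p)
      sparse p = member? c p & cov Oˢ p
      split : ∀ p → p < n → (side c p & cov O p) ≡ true → ((side c p & U p) & cov O p) ≡ true ⊎ (owner-chosen p ∥ sparse p) ≡ true
      split p _ q with dichotomy (U p)
      ... | inj₁ Up = inj₁ (&-intro (&-intro (&-fst (side c p) q) Up) (&-snd (side c p) q))
      ... | inj₂ Up with covered-split p Up (&-snd (side c p) q)
      ...   | inj₁ (own , Sp) = inj₂ (∥-introˡ (&-intro₃ (&-fst (side c p) q) (<ᵇ-true own) Sp))
      ...   | inj₂ (Lp , cp) = inj₂ (∥-introʳ (owner-chosen p) (&-intro (&-intro Lp (&-fst (side c p) q)) cp))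

    -- `G` is a selection that is known to be good. The knapsack is asked for its totals and returns
    -- some selection that has them.
    module Choice (G : ℕ → Bool) where

      κ a β : ℕ
      κ = KL.partial G n (λ _ → 1)
      a = KL.partial G n (weight true)
      β = KL.partial G n (weight false)

      supply : ∀ c (S′ : ℕ → Bool) → (∀ g → Sᵈ g ≡ true → G g ≡ true) → (∀ g → S′ g ≡ true → G g ≡ true) →
               denseTotal c + ∑ n (λ g → 𝟙 (S′ g) * clusterSize c g) ≤ KL.partial G n (weight c)
      supply c S′ Sᵈ⊆ S′⊆ = ≤-trans (≤-reflexive (sym (∑-+ n (λ g → 𝟙 (Sᵈ g) * denseSize c g) (λ g → 𝟙 (S′ g) * clusterSize c g))))
        (∑-mono n λ g g<n → pointwise (G g) (Sᵈ g) (S′ g) (Sᵈ⊆ g) (S′⊆ g) (sizes≤weight c g g<n))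
        where
        pointwise : ∀ b s s′ {x y w} → (s ≡ true → b ≡ true) → (s′ ≡ true → b ≡ true) → x + y ≤ w → 𝟙 s * x + 𝟙 s′ * y ≤ 𝟙 b * w
        pointwise true  s s′ {x} {y} f f′ le = ≤-trans (+-mono-≤ (*-monoˡ-≤ x (𝟙≤1 s)) (*-monoˡ-≤ y (𝟙≤1 s′)))
          (≤-trans (≤-reflexive (cong₂ _+_ (+-identityʳ x) (+-identityʳ y))) (≤-trans le (≤-reflexive (sym (+-identityʳ _)))))
        pointwise false true  s′    f f′ le with () ← f refl
        pointwise false false true  f f′ le with () ← f′ refl
        pointwise false false false f f′ le = z≤n

      slots picked cand : ℕ → Bool
      slots p = ((eq q₀ p ∥ eq q₁ p) ∥ eq q₂ p) ∥ eq q₃ p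
      picked j = 0 <ᵇ knapsack (index κ a β j)
      cand p = slots p ∥ picked p

      encodes : KL.Encodes picked n κ a β
      encodes = KL.knapsack-works G

      count-eq : ∀ q → count n (eq q) ≤ 𝟙 (q <ᵇ n)
      count-eq q with q <? n
      ... | yes q<n = ≤-trans (∑-single≤ n 1 q) (≤-reflexive (sym (cong 𝟙 (<ᵇ-true q<n))))
      ... | no q≮n = ≤-trans (≤-reflexive (count-empty n (eq q) λ i i<n → eq-false {q} {i} λ { refl → q≮n i<n })) z≤n

      cand-number : count n cand ≤ used + count n G
      cand-number = begin
        count n cand                 ≤⟨ count-∥≤ n slots picked ⟩
        count n slots + count n picked ≤⟨ +-mono-≤ slots≤ (≤-reflexive picked≡) ⟩
        used + count n G             ∎
        where
        open ≤-Reasoning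
        slots≤ : count n slots ≤ used
        slots≤ = ≤-trans (count-∥≤ n (λ p → (eq q₀ p ∥ eq q₁ p) ∥ eq q₂ p) (eq q₃)) (+-mono-≤
          (≤-trans (count-∥≤ n (λ p → eq q₀ p ∥ eq q₁ p) (eq q₂)) (+-mono-≤
            (≤-trans (count-∥≤ n (eq q₀) (eq q₁)) (+-mono-≤ (count-eq q₀) (count-eq q₁))) (count-eq q₂))) (count-eq q₃))
        ones : ∀ P → ∑ n (λ g → 𝟙 (P g) * 1) ≡ count n P
        ones P = ∑-cong n λ g _ → *-identityʳ (𝟙 (P g))
        picked≡ : count n picked ≡ count n G
        picked≡ = trans (sym (ones picked)) (trans (KL.Encodes.number encodes) (ones G))

      covers-intro : ∀ {c p} → c < n → cand c ≡ true → hop₃ c p ≡ true → covers cand p ≡ true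
      covers-intro c<n cc h = any-intro {n} c<n (&-intro cc h)

      region-covered : ∀ p → U p ≡ true → covers cand p ≡ true
      region-covered p Up with ∥-elim ((hop₃ q₀ p ∥ hop₂ q₁ p) ∥ hop₂ q₂ p) (U-region p Up)
      ... | inj₂ h = covers-intro (hop₂-rangeˡ h) (∥-introˡ (∥-introʳ ((eq q₀ q₃ ∥ eq q₁ q₃) ∥ eq q₂ q₃) (eq-intro {q₃} refl))) (hop₂⇒hop₃ h)
      ... | inj₁ Up′ with ∥-elim (hop₃ q₀ p ∥ hop₂ q₁ p) Up′
      ...   | inj₂ h = covers-intro (hop₂-rangeˡ h) (∥-introˡ (∥-introˡ (∥-introʳ (eq q₀ q₂ ∥ eq q₁ q₂) (eq-intro {q₂} refl)))) (hop₂⇒hop₃ h)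
      ...   | inj₁ Up″ with ∥-elim (hop₃ q₀ p) Up″
      ...     | inj₂ h = covers-intro (hop₂-rangeˡ h) (∥-introˡ (∥-introˡ (∥-introˡ (∥-introʳ (eq q₀ q₁) (eq-intro {q₁} refl))))) (hop₂⇒hop₃ h)
      ...     | inj₁ h = covers-intro (hop₃-rangeˡ h) (∥-introˡ (∥-introˡ (∥-introˡ (∥-introˡ (eq-intro {q₀} refl))))) h

      -- All points of items lie outside `U`, so what the slots cover and what the selected items
      -- contain may be added.
      cand-covers : ∀ c → count n (λ p → side c p & U p) + KL.weighted picked (weight c) ≤ count n (λ p → side c p & covers cand p)
      cand-covers c = ≤-trans (+-monoʳ-≤ (count n (λ p → side c p & U p)) (≤-reflexive (fibre-count it picked (side c))))
        (count-disjoint n {P = λ p → side c p & U p} {Q = λ p → side c p & (it p <ᵇ n) & picked (it p)}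
          (λ p _ q → &-intro (&-fst (side c p) q) (region-covered p (&-snd (side c p) q)))
          (λ p p<n q → let s , it<n , b = &₃-elim (side c p) (it p <ᵇ n) q in
            &-intro s (covers-intro (true-<ᵇ it<n) (∥-introʳ (slots (it p)) b) (proj₁ (item-hop₃ p<n (true-<ᵇ it<n)))))
          apart)
        where
        apart : ∀ p → p < n → (side c p & U p) ≡ true → (side c p & (it p <ᵇ n) & picked (it p)) ≡ false
        apart p p<n q with dichotomy (side c p & (it p <ᵇ n) & picked (it p))
        ... | inj₂ r = r
        ... | inj₁ r = absurd (&-snd (side c p) q) (proj₂ (item-hop₃ p<n (true-<ᵇ (proj₁ (proj₂ (&₃-elim (side c p) (it p <ᵇ n) r))))))

      cand-solves : ∀ {k r b} → used + count n G ≤ k →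
        r ≤ count n (λ p → red p & U p) + a → b ≤ count n (λ p → ∼ red p & U p) + β → solves red k r b cand ≡ true
      cand-solves k≥ r≤ b≤ = &-intro₃ (≮ᵇ-intro (≤-trans cand-number k≥))
        (≮ᵇ-intro (≤-trans r≤ (≤-trans (≤-reflexive (cong (count n (λ p → red p & U p) +_) (sym (KL.Encodes.reds encodes)))) (cand-covers true))))
        (≮ᵇ-intro (≤-trans b≤ (≤-trans (≤-reflexive (cong (count n (λ p → ∼ red p & U p) +_) (sym (KL.Encodes.blues encodes)))) (cand-covers false))))

    record Outcome (k r b : ℕ) : Set where
      field
        κ a β : ℕ
        κ≤    : κ ≤ n
        a≤    : a ≤ n
        β≤    : β ≤ n
        works : solves red k r b (λ p → (((eq q₀ p ∥ eq q₁ p) ∥ eq q₂ p) ∥ eq q₃ p) ∥ (0 <ᵇ knapsack (index κ a β p))) ≡ true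

    outcome : ∀ {k r b} → count n O ≤ k → r ≤ count n (λ p → red p & cov O p) → b ≤ count n (λ p → ∼ red p & cov O p) → Outcome k r b
    outcome {k} {r} {b} O≤k r≤ b≤ = final
      where
      from : ∀ G → solves red k r b (Choice.cand G) ≡ true → Outcome k r b
      from G w = record { κ≤ = KL.partial-number≤ G ≤-refl ; a≤ = KL.partial-weight≤ G true ≤-refl
                        ; β≤ = KL.partial-weight≤ G false ≤-refl ; works = w }
      DS : ℕ → Bool
      DS g = Sᵈ g ∥ S g
      DS-number : count n DS ≤ count n Oᵈ + count n Oˢ
      DS-number = ≤-trans (count-∥≤ n Sᵈ S) (+-mono-≤ dense-count S-number)
      drop-cov : ∀ c → count n (λ p → (side c p & U p) & cov O p) ≤ count n (λ p → side c p & U p)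
      drop-cov c = count-mono n λ p _ q → &-fst (side c p & U p) q
      blue≤ : ∀ G → (∀ g → Sᵈ g ≡ true → G g ≡ true) → (∀ g → S g ≡ true → G g ≡ true) →
              b ≤ count n (λ p → ∼ red p & U p) + KL.partial G n (weight false)
      blue≤ G Sᵈ⊆ S⊆ = ≤-trans b≤ (≤-trans (demand false) (+-mono-≤ (drop-cov false)
        (≤-trans (+-monoʳ-≤ (denseTotal false) S-blue) (Choice.supply G false S Sᵈ⊆ S⊆))))
      Sᵈ⊆DS : ∀ g → Sᵈ g ≡ true → DS g ≡ true
      Sᵈ⊆DS g = ∥-introˡ
      S⊆DS : ∀ g → S g ≡ true → DS g ≡ true
      S⊆DS g = ∥-introʳ (Sᵈ g)
      DS-fits : used + count n DS ≤ k
      DS-fits = ≤-trans (+-monoʳ-≤ used DS-number) (≤-trans (≤-reflexive (+-comm used ((count n Oᵈ + count n Oˢ)))) (≤-trans number O≤k))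
      final : Outcome k r b
      final = choose S-red slack
       where
       choose : required true ≤ selected (clusterSize true) ⊎
                (∃[ u ] u < n × S u ≡ false × required true ≤ selected (clusterSize true) + clusterSize true u) →
                (count n Oᵈ + count n Oˢ) + used + 1 ≤ count n O ⊎
                count n (λ p → (red p & U p) & cov O p) + (τ + τ + τ) ≤ count n (λ p → red p & U p) → Outcome k r b
       choose (inj₁ enough) _ = from DS (Choice.cand-solves DS DS-fits
        (≤-trans r≤ (≤-trans (demand true) (+-mono-≤ (drop-cov true)
          (≤-trans (+-monoʳ-≤ (denseTotal true) enough) (Choice.supply DS true S Sᵈ⊆DS S⊆DS)))))
        (blue≤ DS Sᵈ⊆DS S⊆DS))
       -- At most the red points of the unselected cluster `u` are missing; these are at most `3τ`,
       -- and the surplus of `U` makes up for them.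
       choose (inj₂ (u , u<n , Su , enough)) (inj₂ gains) = from DS (Choice.cand-solves DS DS-fits
        (begin
          r                                                       ≤⟨ ≤-trans r≤ (demand true) ⟩
          X + (denseTotal true + required true)                   ≤⟨ +-monoʳ-≤ X (+-monoʳ-≤ (denseTotal true) (≤-trans enough (+-monoʳ-≤ (selected (clusterSize true)) (cluster-light u)))) ⟩
          X + (denseTotal true + (selected (clusterSize true) + (τ + τ + τ)))
                                                                  ≡⟨ lemma X (denseTotal true) (selected (clusterSize true)) (τ + τ + τ) ⟩
          X + (τ + τ + τ) + (denseTotal true + selected (clusterSize true))
                                                                  ≤⟨ +-mono-≤ gains (Choice.supply DS true S Sᵈ⊆DS S⊆DS) ⟩
          count n (λ p → red p & U p) + KL.partial DS n (weight true) ∎)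
        (blue≤ DS Sᵈ⊆DS S⊆DS))
        where
        open ≤-Reasoning
        X = count n (λ p → (red p & U p) & cov O p)
        lemma : ∀ x d s t → x + (d + (s + t)) ≡ x + t + (d + s)
        lemma = solve-∀
       -- The spare center opens the unselected cluster `u` as well.
       choose (inj₂ (u , u<n , Su , enough)) (inj₁ spare) = from G (Choice.cand-solves G
        (begin
          used + count n G                ≤⟨ +-monoʳ-≤ used (≤-trans (count-∥≤ n DS (eq u)) (+-mono-≤ DS-number (≤-trans (Choice.count-eq DS u) (𝟙≤1 (u <ᵇ n))))) ⟩
          used + ((count n Oᵈ + count n Oˢ) + 1)         ≡⟨ lemma used ((count n Oᵈ + count n Oˢ)) ⟩
          (count n Oᵈ + count n Oˢ) + used + 1           ≤⟨ ≤-trans spare O≤k ⟩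
          k                               ∎)
        (begin
          r                                                       ≤⟨ ≤-trans r≤ (demand true) ⟩
          X + (denseTotal true + required true)                   ≤⟨ +-mono-≤ (drop-cov true) (+-monoʳ-≤ (denseTotal true) (≤-trans enough (≤-reflexive (sym Su-total)))) ⟩
          count n (λ p → red p & U p) + (denseTotal true + ∑ n (λ g → 𝟙 (S⁺ g) * clusterSize true g))
                                                                  ≤⟨ +-monoʳ-≤ (count n (λ p → red p & U p)) (Choice.supply G true S⁺ (λ g q → ∥-introˡ (Sᵈ⊆DS g q)) S⁺⊆G) ⟩
          count n (λ p → red p & U p) + KL.partial G n (weight true) ∎)
        (blue≤ G (λ g q → ∥-introˡ (Sᵈ⊆DS g q)) (λ g q → ∥-introˡ (S⊆DS g q))))
        where
        open ≤-Reasoning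
        X = count n (λ p → (red p & U p) & cov O p)
        G S⁺ : ℕ → Bool
        G g = DS g ∥ eq u g
        S⁺ g = S g ∥ eq u g
        lemma : ∀ x y → x + (y + 1) ≡ y + x + 1
        lemma = solve-∀
        S⁺⊆G : ∀ g → S⁺ g ≡ true → G g ≡ true
        S⁺⊆G g q with ∥-elim (S g) q
        ... | inj₁ s = ∥-introˡ (S⊆DS g s)
        ... | inj₂ e = ∥-introʳ (DS g) e
        Su-total : ∑ n (λ g → 𝟙 (S⁺ g) * clusterSize true g) ≡ selected (clusterSize true) + clusterSize true u
        Su-total = trans (∑-cong n λ g _ → pointwise g (dichotomy (eq u g)))
          (trans (∑-+ n (λ g → 𝟙 (S g) * clusterSize true g) (λ g → if eq u g then clusterSize true u else 0))
            (cong (selected (clusterSize true) +_) (∑-single n (clusterSize true u) u<n)))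
          where
          pointwise : ∀ g → eq u g ≡ true ⊎ eq u g ≡ false →
            𝟙 (S⁺ g) * clusterSize true g ≡ 𝟙 (S g) * clusterSize true g + (if eq u g then clusterSize true u else 0)
          pointwise g (inj₂ e) = trans (cong (λ b → 𝟙 (S g ∥ b) * clusterSize true g) e)
            (trans (cong (λ b → 𝟙 b * clusterSize true g) (Completeness.∥-identityʳ n adj adj-sym adj-refl adj-range red O (S g) refl))
              (sym (trans (cong (𝟙 (S g) * clusterSize true g +_) (if-false e)) (+-identityʳ _))))
          pointwise g (inj₁ e) with eq-elim {u} {g} e
          ... | refl = trans (cong (λ b → 𝟙 (b ∥ eq u u) * clusterSize true u) Su) (trans (cong (λ b → 𝟙 b * clusterSize true u) e)
                  (trans (+-identityʳ _) (sym (cong₂ _+_ (cong (λ b → 𝟙 b * clusterSize true u) Su) (if-true e)))))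

-- Existence of a successful guess

module Guessing
  (n : ℕ) (adj : ℕ → ℕ → Bool)
  (adj-sym : ∀ i j → adj i j ≡ true → adj j i ≡ true)
  (adj-refl : ∀ i → i < n → adj i i ≡ true)
  (adj-range : ∀ i j → adj i j ≡ true → j < n)
  (red : ℕ → Bool)
  where
  open Sums
  open SumLemmas
  open Algorithm
  open Graph n adj
  open GraphLemmas n adj adj-sym adj-refl adj-range

  -- Every range is polynomial in `n`, so all guesses can be enumerated. Whatever the analysis takes
  -- from the optimum reaches the algorithm through these numbers.
  record Guess (k r b : ℕ) : Set where
    field
      q₀ q₁ q₂ q₃ τ rₛ bₛ T κ a β : ℕ
      q₀≤ : q₀ ≤ n
      q₁≤ : q₁ ≤ n
      q₂≤ : q₂ ≤ n
      q₃≤ : q₃ ≤ n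
      τ≤  : τ ≤ n
      rₛ≤ : rₛ ≤ n
      bₛ≤ : bₛ ≤ n
      κ≤  : κ ≤ n
      a≤  : a ≤ n
      β≤  : β ≤ n
      T≤  : T ≤ N * N * n + 1
      works : solves red k r b (candidate red q₀ q₁ q₂ q₃ τ rₛ bₛ T κ a β) ≡ true

  module _ (O : ℕ → Bool) where
    open Completeness n adj adj-sym adj-refl adj-range red O using (Prepared; prepare)
    open Assembly n adj adj-sym adj-refl adj-range red O

    module _ {q₀ q₁ q₂ q₃ τ : ℕ} (q₀≤ : q₀ ≤ n) (q₁≤ : q₁ ≤ n) (q₂≤ : q₂ ≤ n) (q₃≤ : q₃ ≤ n) (τ≤ : τ ≤ n)
             (prepared : Prepared q₀ q₁ q₂ q₃ τ) where
      open Prepared prepared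
      open Dense red U τ using (owner; denseStep; free; light)
      private
        module D = DenseLemmas red U τ
        module C = D.Centers O′ gain≤

      L : ℕ → Bool
      L = light owner

      L-free : ∀ p → L p ≡ true → p < n × U p ≡ false × n ≤ owner p
      L-free p Lp = D.free-elim owner (&-fst (free owner p) Lp)

      -- An equality of functions, obtained by rewriting the number of rounds. It carries whole
      -- statements from stage to owner without extensionality.
      owner≡ : D.stage n ≡ owner
      owner≡ = cong (iterate n (λ _ → n) denseStep) (sym (clip-≤ {n} ≤-refl))

      L-light : ∀ u → L u ≡ true → count n (λ x → hop₂ u x & red x & L x) ≤ τ + τ + τ
      L-light u Lu = ≤-trans (count-mono n {Q = λ x → hop₂ u x & red x & free owner x} λ x _ c →
          let ux , rx , Lx = &₃-elim (hop₂ u x) (red x) c in &-intro₃ ux rx (&-fst (free owner x) Lx))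
        (≮ᵇ-elim (&-snd (free owner u) Lu))

      owned : ∀ p → p < n → owner p < n → hop₃ (owner p) p ≡ true × U p ≡ false
      owned p p<n = subst (λ A → A p < n → hop₃ (A p) p ≡ true × U p ≡ false) owner≡ (D.owned-hop₃ p<n)

      covered-split : ∀ p → U p ≡ false → cov O p ≡ true →
        (owner p < n × C.Sᵈ (owner p) ≡ true) ⊎ (L p ≡ true × cov C.Oˢ p ≡ true)
      covered-split p Up c = subst (λ A → (A p < n × C.Sᵈ (A p) ≡ true) ⊎ (light A p ≡ true × cov C.Oˢ p ≡ true)) owner≡
        (Sum.map (λ x → x) (λ (f , c′) → C.sparse-light f c′ , c′) (C.covered-split Up (rest p Up c)))

      L-range : ∀ p → L p ≡ true → p < n
      L-range p Lp = proj₁ (L-free p Lp)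

      private
        module R = SparseLemmas.RelaxLemmas n adj adj-sym adj-refl adj-range red L L-range C.Oˢ

      split : ∀ {x y} → count n O′ + x ≤ y → count n C.Oᵈ + count n C.Oˢ + x ≤ y
      split {x} {y} = subst (λ m → m + x ≤ y) C.split-count

      split₁ : count n O′ + used + 1 ≤ count n O → count n C.Oᵈ + count n C.Oˢ + used + 1 ≤ count n O
      split₁ = subst (λ m → m + used + 1 ≤ count n O) C.split-count

      guess-prepared : ∀ {k r b} → count n O ≤ k → r ≤ count n (λ p → red p & cov O p) → b ≤ count n (λ p → ∼ red p & cov O p) → Guess k r b
      guess-prepared {k} {r} {b} O≤k r≤ b≤ = conclude R.relax-works
        where
        conclude : ∃[ T ] T ≤ N * N * n + 1 × R.Relaxed (Sparse.relax red L (R.required true) (R.required false) T) → Guess k r b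
        conclude (T , T≤ , relaxed) = record
          { q₀≤ = q₀≤ ; q₁≤ = q₁≤ ; q₂≤ = q₂≤ ; q₃≤ = q₃≤ ; τ≤ = τ≤
          ; rₛ≤ = count≤n n _ ; bₛ≤ = count≤n n _
          ; κ≤ = O.κ≤ ; a≤ = O.a≤ ; β≤ = O.β≤ ; T≤ = T≤ ; works = O.works }
          where
          module Combine = Combination {q₀} {q₁} {q₂} {q₃} {τ} {U} {C.Oᵈ} {C.Oˢ} {C.Sᵈ} {L} {owner}
            (λ p Up → Up) L-range (λ p Lp → proj₂ (proj₂ (L-free p Lp))) (λ p Lp → proj₁ (proj₂ (L-free p Lp)))
            L-light owned covered-split C.dense-count (split number) (Sum.map split₁ (λ g → g) slack) relaxed
          module O = Combine.Outcome (Combine.outcome {k} {r} {b} O≤k r≤ b≤)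

    guess : ∀ {k r b} → count n O ≤ k → r ≤ count n (λ p → red p & cov O p) → b ≤ count n (λ p → ∼ red p & cov O p) → Guess k r b
    guess with prepare
    ... | q₀ , q₁ , q₂ , q₃ , τ , q₀≤ , q₁≤ , q₂≤ , q₃≤ , τ≤ , prepared = guess-prepared q₀≤ q₁≤ q₂≤ q₃≤ τ≤ prepared

-- A language of bounded loops and its compiler

module Language where
  open import Data.Fin.Base using (Fin; zero; suc; toℕ)
  open import Data.Vec.Base using (Vec; []; _∷_)
  open Cost
  open Polynomial
  open Sums

  infixl 6 _⊞_
  infixl 7 _⊠_

  -- Polynomials in `n`. They bound loops and array sizes, which keeps the number of steps
  -- polynomial, and they are the factors allowed in `_⊗_`, which keeps compiled programs tame.
  data Bd : Set where
    #_      : ℕ → Bd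
    n̂       : Bd
    _⊞_ _⊠_ : Bd → Bd → Bd

  ⟦_⟧ᵇ : Bd → ℕ → ℕ
  ⟦ # c ⟧ᵇ   n = c
  ⟦ n̂ ⟧ᵇ     n = n
  ⟦ B ⊞ C ⟧ᵇ n = ⟦ B ⟧ᵇ n + ⟦ C ⟧ᵇ n
  ⟦ B ⊠ C ⟧ᵇ n = ⟦ B ⟧ᵇ n * ⟦ C ⟧ᵇ n

  bdᵉ : Bd → Expr
  bdᵉ (# c)   = lit c
  bdᵉ n̂       = get 0 (lit 0)
  bdᵉ (B ⊞ C) = op add (bdᵉ B) (bdᵉ C)
  bdᵉ (B ⊠ C) = op mul (bdᵉ B) (bdᵉ C)

  data Ty : Set where
    nat bool : Ty

  Val : Ty → Set
  Val nat  = ℕ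
  Val bool = Bool

  code : ∀ {A} → Val A → ℕ
  code {nat}  v = v
  code {bool} b = 𝟙 b

  infixl 6 _⊕_ _⊖_
  infixl 7 _⊗_ _⊘_
  infix  4 _⊲_

  -- Terms over a array variables and k number variables.  Input cells are
  -- read by inp, and inp₂ multiplies two of them; rec r B s f g u binds in u
  -- the array of size s obtained from f by min(r, B) rounds of g.
  data Tm (a k : ℕ) : Ty → Set where
    bd      : Bd → Tm a k nat
    var     : Fin k → Tm a k nat
    inp     : Tm a k nat → Tm a k nat
    inp₂    : Tm a k nat → Tm a k nat → Tm a k nat
    arr     : Fin a → Tm a k nat → Tm a k nat
    _⊕_ _⊖_ : Tm a k nat → Tm a k nat → Tm a k nat
    _⊗_ _⊘_ : Tm a k nat → Bd → Tm a k nat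
    _⊲_     : Tm a k nat → Tm a k nat → Tm a k bool
    ite     : ∀ {A} → Tm a k bool → Tm a k A → Tm a k A → Tm a k A
    sum     : Bd → Tm a (suc k) nat → Tm a k nat
    rec     : ∀ {A} → Tm a k nat → Bd → Bd → Tm a (suc k) nat →
              Tm (suc a) (suc (suc k)) nat → Tm (suc a) k A → Tm a k A
    call    : ∀ {A a′ m} → Tm a′ m A → (Fin a′ → Fin a) → Vec (Tm a k nat) m → Tm a k A

  infixr 5 _▹_

  _▹_ : ∀ {X : Set} {k} → X → (Fin k → X) → Fin (suc k) → X
  (x ▹ ρ) zero    = x
  (x ▹ ρ) (suc i) = ρ i

  ∅ : ∀ {X : Set} → Fin 0 → X
  ∅ ()

  module Semantics (input : ℕ → ℕ) where

    ⟦_⟧ˢ : Bd → ℕ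
    ⟦ B ⟧ˢ = ⟦ B ⟧ᵇ (input 0)

    ⟦_⟧  : ∀ {a k A} → Tm a k A → (Fin a → ℕ → ℕ) → (Fin k → ℕ) → Val A
    ⟦_⟧* : ∀ {a k m} → Vec (Tm a k nat) m → (Fin a → ℕ → ℕ) → (Fin k → ℕ) → Fin m → ℕ
    ⟦ bd B ⟧            α ρ = ⟦ B ⟧ˢ
    ⟦ var i ⟧           α ρ = ρ i
    ⟦ inp t ⟧           α ρ = input (⟦ t ⟧ α ρ)
    ⟦ inp₂ t u ⟧        α ρ = input (⟦ t ⟧ α ρ) * input (⟦ u ⟧ α ρ)
    ⟦ arr i t ⟧         α ρ = α i (⟦ t ⟧ α ρ)
    ⟦ t ⊕ u ⟧           α ρ = ⟦ t ⟧ α ρ + ⟦ u ⟧ α ρ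
    ⟦ t ⊖ u ⟧           α ρ = ⟦ t ⟧ α ρ ∸ ⟦ u ⟧ α ρ
    ⟦ t ⊗ B ⟧           α ρ = ⟦ t ⟧ α ρ * ⟦ B ⟧ˢ
    ⟦ t ⊘ B ⟧           α ρ = apply div (⟦ t ⟧ α ρ) ⟦ B ⟧ˢ
    ⟦ t ⊲ u ⟧           α ρ = ⟦ t ⟧ α ρ <ᵇ ⟦ u ⟧ α ρ
    ⟦ ite b t u ⟧       α ρ = if ⟦ b ⟧ α ρ then ⟦ t ⟧ α ρ else ⟦ u ⟧ α ρ
    ⟦ sum B t ⟧         α ρ = ∑ ⟦ B ⟧ˢ λ i → ⟦ t ⟧ α (i ▹ ρ)
    ⟦ rec r B s f g u ⟧ α ρ =
      ⟦ u ⟧ (iterate ⟦ s ⟧ˢ (λ i → ⟦ f ⟧ α (i ▹ ρ)) (λ t A i → ⟦ g ⟧ (A ▹ α) (i ▹ t ▹ ρ))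
               (clip (⟦ r ⟧ α ρ) ⟦ B ⟧ˢ) ▹ α) ρ
    ⟦ call f φ ts ⟧     α ρ = ⟦ f ⟧ (α ∘ φ) (⟦ ts ⟧* α ρ)
    ⟦ [] ⟧*     α ρ = ∅
    ⟦ t ∷ ts ⟧* α ρ = ⟦ t ⟧ α ρ ▹ ⟦ ts ⟧* α ρ

  cell : ℕ → Expr
  cell x = get x (lit 0)

  -- The bound is evaluated anew at each test, so correctness asks that the body leave its value
  -- unchanged.
  for : ℕ → Expr → Program → Program
  for c e P = set c (lit 0) (lit 0) ⨾ while (op sub e (cell c)) (P ⨾ set c (lit 0) (op add (cell c) (lit 1)))

  fill : ℕ → ℕ → ℕ → Expr → Program → Program
  fill D c w e P = for c e (P ⨾ set D (cell c) (cell w))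

  -- comp t x writes only to arrays from x on and leaves its result in cell
  -- 0 of array x.
  comp  : ∀ {a k A} → Tm a k A → ℕ → (Fin a → ℕ × Bd) → (Fin k → ℕ) → Program
  comp* : ∀ {a k m} → Vec (Tm a k nat) m → ℕ → (Fin a → ℕ × Bd) → (Fin k → ℕ) → Program
  comp (bd B)            x α ρ = set x (lit 0) (bdᵉ B)
  comp (var i)           x α ρ = set x (lit 0) (cell (ρ i))
  comp (inp t)           x α ρ = comp t (1 + x) α ρ ⨾ set x (lit 0) (get 0 (cell (1 + x)))
  comp (inp₂ t u)        x α ρ = comp t (1 + x) α ρ ⨾ comp u (2 + x) α ρ ⨾
    set x (lit 0) (op mul (get 0 (cell (1 + x))) (get 0 (cell (2 + x))))
  -- Cells beyond the size of an array may hold remains of earlier computations; the index is tested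
  -- so that they read as zero, as in `table`.
  comp (arr i t)         x α ρ = comp t (1 + x) α ρ ⨾
    cond (op sub (bdᵉ (proj₂ (α i))) (cell (1 + x)))
      (set x (lit 0) (get (proj₁ (α i)) (cell (1 + x)))) (set x (lit 0) (lit 0))
  comp (t ⊕ u)           x α ρ = comp t (1 + x) α ρ ⨾ comp u (2 + x) α ρ ⨾
    set x (lit 0) (op add (cell (1 + x)) (cell (2 + x)))
  comp (t ⊖ u)           x α ρ = comp t (1 + x) α ρ ⨾ comp u (2 + x) α ρ ⨾
    set x (lit 0) (op sub (cell (1 + x)) (cell (2 + x)))
  comp (t ⊗ B)           x α ρ = comp t (1 + x) α ρ ⨾ set x (lit 0) (op mul (cell (1 + x)) (bdᵉ B))
  comp (t ⊘ B)           x α ρ = comp t (1 + x) α ρ ⨾ set x (lit 0) (op div (cell (1 + x)) (bdᵉ B))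
  comp (t ⊲ u)           x α ρ = comp t (1 + x) α ρ ⨾ comp u (2 + x) α ρ ⨾
    cond (op sub (cell (2 + x)) (cell (1 + x))) (set x (lit 0) (lit 1)) (set x (lit 0) (lit 0))
  comp (ite b t u)       x α ρ = comp b (1 + x) α ρ ⨾ cond (cell (1 + x)) (comp t x α ρ) (comp u x α ρ)
  comp (sum B t)         x α ρ = set x (lit 0) (lit 0) ⨾
    for (1 + x) (bdᵉ B) (comp t (2 + x) α (1 + x ▹ ρ) ⨾ set x (lit 0) (op add (cell x) (cell (2 + x))))
  -- Offsets from `x`: 1 is the current array, 2 the next one, 3 the index, 4 the round, 5 the
  -- requested number of rounds, 6 the start of the scratch space. The next array is built apart and
  -- then copied back, because `g` may read the current one at any index.
  comp (rec r B s f g u) x α ρ =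
    comp r (5 + x) α ρ ⨾
    fill (1 + x) (3 + x) (6 + x) (bdᵉ s) (comp f (6 + x) α (3 + x ▹ ρ)) ⨾
    for (4 + x) (op sub (cell (5 + x)) (op sub (cell (5 + x)) (bdᵉ B)))
      (fill (2 + x) (3 + x) (6 + x) (bdᵉ s) (comp g (6 + x) ((1 + x , s) ▹ α) (3 + x ▹ 4 + x ▹ ρ)) ⨾
       fill (1 + x) (3 + x) (6 + x) (bdᵉ s) (set (6 + x) (lit 0) (get (2 + x) (cell (3 + x))))) ⨾
    comp u (2 + x) ((1 + x , s) ▹ α) ρ ⨾
    set x (lit 0) (cell (2 + x))
  comp (call {m = m} f φ ts) x α ρ =
    comp* ts (1 + x) α ρ ⨾ comp f (m + (1 + x)) (α ∘ φ) (λ i → toℕ i + (1 + x)) ⨾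
    set x (lit 0) (cell (m + (1 + x)))
  comp* []       x α ρ = skip
  comp* (t ∷ ts) x α ρ = comp t x α ρ ⨾ comp* ts (1 + x) α ρ

  -- Two steps clear the counter and perform the last test; each round adds a test and an increment
  -- to the body.
  forSteps : ℕ → ℕ → ℕ
  forSteps b s = 2 + b * (2 + s)

  fillSteps : ℕ → ℕ → ℕ
  fillSteps b s = forSteps b (s + 1)

  -- A bound in terms of `n` alone: both branches of `ite` are added, and `rec` is charged for `B`
  -- rounds whatever number is requested.
  time  : ∀ {a k A} → Tm a k A → ℕ → ℕ
  time* : ∀ {a k m} → Vec (Tm a k nat) m → ℕ → ℕ
  time (bd B)            n = 1
  time (var i)           n = 1
  time (inp t)           n = time t n + 1
  time (inp₂ t u)        n = time t n + (time u n + 1)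
  time (arr i t)         n = time t n + 2
  time (t ⊕ u)           n = time t n + (time u n + 1)
  time (t ⊖ u)           n = time t n + (time u n + 1)
  time (t ⊗ B)           n = time t n + 1
  time (t ⊘ B)           n = time t n + 1
  time (t ⊲ u)           n = time t n + (time u n + 2)
  time (ite b t u)       n = time b n + suc (time t n + time u n)
  time (sum B t)         n = 1 + forSteps (⟦ B ⟧ᵇ n) (time t n + 1)
  time (rec r B s f g u) n =
    time r n + (fillSteps (⟦ s ⟧ᵇ n) (time f n) +
    (forSteps (⟦ B ⟧ᵇ n) (fillSteps (⟦ s ⟧ᵇ n) (time g n) + fillSteps (⟦ s ⟧ᵇ n) 1) + (time u n + 1)))
  time (call f φ ts)     n = time* ts n + (time f n + 1)
  time* []       n = 1
  time* (t ∷ ts) n = time t n + time* ts n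

  poly-bd : ∀ B → Poly ⟦ B ⟧ᵇ
  poly-bd (# c)   = poly-const c
  poly-bd n̂       = poly-id
  poly-bd (B ⊞ C) = poly-+ (poly-bd B) (poly-bd C)
  poly-bd (B ⊠ C) = poly-* (poly-bd B) (poly-bd C)

  poly-for : ∀ {f g} → Poly f → Poly g → Poly (λ n → forSteps (f n) (g n))
  poly-for p q = poly-+ (poly-const 2) (poly-* p (poly-+ (poly-const 2) q))

  poly-fill : ∀ {f g} → Poly f → Poly g → Poly (λ n → fillSteps (f n) (g n))
  poly-fill p q = poly-for p (poly-+ q (poly-const 1))

  poly-time  : ∀ {a k A} (t : Tm a k A) → Poly (time t)
  poly-time* : ∀ {a k m} (ts : Vec (Tm a k nat) m) → Poly (time* ts)
  poly-time (bd B)            = poly-const 1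
  poly-time (var i)           = poly-const 1
  poly-time (inp t)           = poly-+ (poly-time t) (poly-const 1)
  poly-time (inp₂ t u)        = poly-+ (poly-time t) (poly-+ (poly-time u) (poly-const 1))
  poly-time (arr i t)         = poly-+ (poly-time t) (poly-const 2)
  poly-time (t ⊕ u)           = poly-+ (poly-time t) (poly-+ (poly-time u) (poly-const 1))
  poly-time (t ⊖ u)           = poly-+ (poly-time t) (poly-+ (poly-time u) (poly-const 1))
  poly-time (t ⊗ B)           = poly-+ (poly-time t) (poly-const 1)
  poly-time (t ⊘ B)           = poly-+ (poly-time t) (poly-const 1)
  poly-time (t ⊲ u)           = poly-+ (poly-time t) (poly-+ (poly-time u) (poly-const 2))
  poly-time (ite b t u)       = poly-+ (poly-time b) (poly-+ (poly-const 1) (poly-+ (poly-time t) (poly-time u)))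
  poly-time (sum B t)         = poly-+ (poly-const 1) (poly-for (poly-bd B) (poly-+ (poly-time t) (poly-const 1)))
  poly-time (rec r B s f g u) =
    poly-+ (poly-time r) (poly-+ (poly-fill (poly-bd s) (poly-time f))
      (poly-+ (poly-for (poly-bd B) (poly-+ (poly-fill (poly-bd s) (poly-time g)) (poly-fill (poly-bd s) (poly-const 1))))
        (poly-+ (poly-time u) (poly-const 1))))
  poly-time (call f φ ts)     = poly-+ (poly-time* ts) (poly-+ (poly-time f) (poly-const 1))
  poly-time* []       = poly-const 1
  poly-time* (t ∷ ts) = poly-+ (poly-time t) (poly-time* ts)

  static-bd : ∀ B → Static (bdᵉ B)
  static-bd (# c)   = lit c
  static-bd n̂       = inp (lit 0)
  static-bd (B ⊞ C) = opˢ add (static-bd B) (static-bd C)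
  static-bd (B ⊠ C) = opˢ mul (static-bd B) (static-bd C)

  tame-bd : ∀ B → Tameᵉ (bdᵉ B)
  tame-bd (# c)   = lit c
  tame-bd n̂       = get 0 (lit 0)
  tame-bd (B ⊞ C) = add (tame-bd B) (tame-bd C)
  tame-bd (B ⊠ C) = mul (tame-bd B) (static-bd C) (tame-bd C)

  tame-cell : ∀ x → Tameᵉ (cell x)
  tame-cell x = get x (lit 0)

  tame-set : ∀ {x e} → 0 < x → Tameᵉ e → Tame (set x (lit 0) e)
  tame-set 0<x te = set 0<x (lit 0) te

  tame-for : ∀ {c e P} → 0 < c → Tameᵉ e → Tame P → Tame (for c e P)
  tame-for {c} 0<c te tP =
    tame-set 0<c (lit 0) ⨾ while (sub te (tame-cell c)) (tP ⨾ tame-set 0<c (add (tame-cell c) (lit 1)))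

  tame-fill : ∀ {D c w e P} → 0 < D → 0 < c → Tameᵉ e → Tame P → Tame (fill D c w e P)
  tame-fill {c = c} {w} 0<D 0<c te tP = tame-for 0<c te (tP ⨾ set 0<D (tame-cell c) (tame-cell w))

  private
    0<1+ : ∀ {x} → 0 < suc x
    0<1+ = s≤s z≤n

  tame-comp  : ∀ {a k A} (t : Tm a k A) {x} α ρ → 0 < x → Tame (comp t x α ρ)
  tame-comp* : ∀ {a k m} (ts : Vec (Tm a k nat) m) {x} α ρ → 0 < x → Tame (comp* ts x α ρ)
  tame-comp (bd B)            α ρ 0<x = tame-set 0<x (tame-bd B)
  tame-comp (var i)           α ρ 0<x = tame-set 0<x (tame-cell (ρ i))
  tame-comp (inp t) {x}       α ρ 0<x = tame-comp t α ρ 0<1+ ⨾ tame-set 0<x (get 0 (tame-cell (1 + x)))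
  tame-comp (inp₂ t u) {x}    α ρ 0<x = tame-comp t α ρ 0<1+ ⨾ tame-comp u α ρ 0<1+ ⨾ tame-set 0<x
    (mul (get 0 (tame-cell (1 + x))) (inp (cell (2 + x))) (get 0 (tame-cell (2 + x))))
  tame-comp (arr i t) {x}     α ρ 0<x = tame-comp t α ρ 0<1+ ⨾ cond (sub (tame-bd _) (tame-cell (1 + x)))
    (tame-set 0<x (get _ (tame-cell (1 + x)))) (tame-set 0<x (lit 0))
  tame-comp (t ⊕ u) {x}       α ρ 0<x = tame-comp t α ρ 0<1+ ⨾ tame-comp u α ρ 0<1+ ⨾ tame-set 0<x
    (add (tame-cell (1 + x)) (tame-cell (2 + x)))
  tame-comp (t ⊖ u) {x}       α ρ 0<x = tame-comp t α ρ 0<1+ ⨾ tame-comp u α ρ 0<1+ ⨾ tame-set 0<x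
    (sub (tame-cell (1 + x)) (tame-cell (2 + x)))
  tame-comp (t ⊗ B) {x}       α ρ 0<x = tame-comp t α ρ 0<1+ ⨾ tame-set 0<x
    (mul (tame-cell (1 + x)) (static-bd B) (tame-bd B))
  tame-comp (t ⊘ B) {x}       α ρ 0<x = tame-comp t α ρ 0<1+ ⨾ tame-set 0<x (div (tame-cell (1 + x)) (tame-bd B))
  tame-comp (t ⊲ u) {x}       α ρ 0<x = tame-comp t α ρ 0<1+ ⨾ tame-comp u α ρ 0<1+ ⨾
    cond (sub (tame-cell (2 + x)) (tame-cell (1 + x))) (tame-set 0<x (lit 1)) (tame-set 0<x (lit 0))
  tame-comp (ite b t u) {x}   α ρ 0<x = tame-comp b α ρ 0<1+ ⨾ cond (tame-cell (1 + x)) (tame-comp t α ρ 0<x) (tame-comp u α ρ 0<x)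
  tame-comp (sum B t) {x}     α ρ 0<x = tame-set 0<x (lit 0) ⨾
    tame-for 0<1+ (tame-bd B) (tame-comp t α _ 0<1+ ⨾ tame-set 0<x (add (tame-cell x) (tame-cell (2 + x))))
  tame-comp (rec r B s f g u) {x} α ρ 0<x =
    tame-comp r α ρ 0<1+ ⨾
    tame-fill 0<1+ 0<1+ (tame-bd s) (tame-comp f α _ 0<1+) ⨾
    tame-for 0<1+ (sub (tame-cell (5 + x)) (sub (tame-cell (5 + x)) (tame-bd B)))
      (tame-fill 0<1+ 0<1+ (tame-bd s) (tame-comp g _ _ 0<1+) ⨾
       tame-fill 0<1+ 0<1+ (tame-bd s) (tame-set 0<1+ (get (2 + x) (tame-cell (3 + x))))) ⨾
    tame-comp u _ ρ 0<1+ ⨾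
    tame-set 0<x (tame-cell (2 + x))
  tame-comp (call {m = m} f φ ts) {x} α ρ 0<x =
    tame-comp* ts α ρ 0<1+ ⨾ tame-comp f _ _ (≤-trans 0<1+ (m≤n+m (suc x) m)) ⨾ tame-set 0<x (tame-cell _)
  tame-comp* []       α ρ 0<x = skip
  tame-comp* (t ∷ ts) α ρ 0<x = tame-comp t α ρ 0<x ⨾ tame-comp* ts α ρ 0<1+

-- Correctness and running time of compiled programs

module Correctness where
  open import Data.Fin.Base using (Fin; zero; suc; toℕ)
  open import Data.Fin.Properties using (toℕ<n)
  open import Data.Vec.Base using (Vec; []; _∷_)
  open Cost
  open Sums
  open Language

  update-≡ : ∀ σ x i v → update σ x i v x i ≡ v
  update-≡ σ x i v rewrite dec-true (x ≟ x) refl | dec-true (i ≟ i) refl = refl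

  update-≢ : ∀ σ {x y} i v j → y ≢ x → update σ x i v y j ≡ σ y j
  update-≢ σ {x} {y} i v j y≢x rewrite dec-false (y ≟ x) y≢x = refl

  update-≢′ : ∀ σ x {i j} v → j ≢ i → update σ x i v x j ≡ σ x j
  update-≢′ σ x {i} {j} v j≢i rewrite dec-true (x ≟ x) refl | dec-false (j ≟ i) j≢i = refl

  record Run (P : Program) (σ : Store) (s : ℕ) (Q : Store → Set) : Set where
    constructor run
    field
      {final} : Store
      {spent} : ℕ
      halts   : ⟨ P , σ ⟩⇓ final ∶ spent
      steps≤  : steps halts ≤ s
      post    : Q final

  run-weaken : ∀ {P σ s s′ Q Q′} → s ≤ s′ → (∀ τ → Q τ → Q′ τ) → Run P σ s Q → Run P σ s′ Q′
  run-weaken s≤ Q⇒ (run D D≤ q) = run D (≤-trans D≤ s≤) (Q⇒ _ q)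

  run-set : ∀ {σ x e f} {Q : Store → Set} → Q (update σ x (eval e σ) (eval f σ)) → Run (set x e f) σ 1 Q
  run-set q = run ⇓set ≤-refl q

  run-seq : ∀ {P P′ σ s s′ Q Q′} → Run P σ s Q → (∀ τ → Q τ → Run P′ τ s′ Q′) → Run (P ⨾ P′) σ (s + s′) Q′
  run-seq (run D D≤ q) k with k _ q
  ... | run E E≤ q′ = run (⇓seq D E) (+-mono-≤ D≤ E≤) q′

  run-then : ∀ {e P P′ σ s Q} → eval e σ ≢ 0 → Run P σ s Q → Run (cond e P P′) σ (suc s) Q
  run-then e≢0 (run D D≤ q) = run (⇓then e≢0 D) (s≤s D≤) q

  run-else : ∀ {e P P′ σ s Q} → eval e σ ≡ 0 → Run P′ σ s Q → Run (cond e P P′) σ (suc s) Q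
  run-else e≡0 (run D D≤ q) = run (⇓else e≡0 D) (s≤s D≤) q

  module _ {c b s : ℕ} {e : Expr} {P : Program} (Inv : ℕ → Store → Set)
           (guard : ∀ i σ → Inv i σ → eval e σ ≡ b)
           (counter : ∀ i σ → Inv i σ → σ c 0 ≡ i)
           (body : ∀ i σ → i < b → Inv i σ → Run P σ s (λ τ → Inv (suc i) (update τ c 0 (τ c 0 + 1)))) where

    private
      test = op sub e (cell c)
      loop = P ⨾ set c (lit 0) (op add (cell c) (lit 1))

      run-while : ∀ m i σ → i + m ≡ b → Inv i σ → Run (while test loop) σ (1 + m * (2 + s)) (Inv b)
      run-while zero i σ i≡b inv = run (⇓stop stops) ≤-refl (subst (λ z → Inv z σ) (trans (sym (+-identityʳ i)) i≡b) inv)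
        where
        stops : eval test σ ≡ 0
        stops = trans (cong₂ _∸_ (guard i σ inv) (counter i σ inv))
                      (m≤n⇒m∸n≡0 (≤-reflexive (trans (sym i≡b) (+-identityʳ i))))
      run-while (suc m) i σ i+m≡b inv with body i σ i<b inv
        where i<b = subst (i <_) i+m≡b (m<m+n i (s≤s z≤n))
      ... | run D D≤ q with run-while m (suc i) _ (trans (sym (+-suc i m)) i+m≡b) q
      ... | run E E≤ q′ = run (⇓loop goes (⇓seq D ⇓set) E) bound q′
        where
        goes : eval test σ ≢ 0
        goes eq = <⇒≱ (m<m+n i (s≤s z≤n)) (≤-trans (≤-reflexive i+m≡b)
          (m∸n≡0⇒m≤n (trans (sym (cong₂ _∸_ (guard i σ inv) (counter i σ inv))) eq)))
        bound : suc (steps D + 1 + steps E) ≤ 1 + (2 + s + m * (2 + s))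
        bound = s≤s (begin
          steps D + 1 + steps E              ≡⟨ cong (_+ steps E) (+-comm (steps D) 1) ⟩
          suc (steps D + steps E)            ≤⟨ s≤s (+-mono-≤ D≤ E≤) ⟩
          suc (s + suc (m * (2 + s)))        ≡⟨ cong suc (+-suc s _) ⟩
          2 + s + m * (2 + s)                ∎)
          where open ≤-Reasoning

    run-for : ∀ σ → Inv 0 (update σ c 0 0) → Run (for c e P) σ (forSteps b s) (Inv b)
    run-for σ inv = run-seq {Q = Inv 0} (run-set inv) (λ τ → run-while b 0 τ refl)

  -- Code compiled at `x` writes from array `x` on, so everything that the surrounding program keeps
  -- below `x` survives it.
  Frame : ℕ → Store → Store → Set
  Frame x σ τ = ∀ y i → y < x → τ y i ≡ σ y i

  frame-trans : ∀ {x y σ τ υ} → x ≤ y → Frame x σ τ → Frame y τ υ → Frame x σ υ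
  frame-trans x≤y f g z i z<x = trans (g z i (≤-trans z<x x≤y)) (f z i z<x)

  frame-update : ∀ {x y} σ i v → x ≤ y → Frame x σ (update σ y i v)
  frame-update σ i v x≤y z j z<x = update-≢ σ i v j (<⇒≢ (≤-trans z<x x≤y))

  Post : ℕ → Store → ℕ → Store → Set
  Post x σ v τ = Frame x σ τ × τ x 0 ≡ v

  finish : ∀ {x σ e v} τ → Frame x σ τ → eval e τ ≡ v → Run (set x (lit 0) e) τ 1 (Post x σ v)
  finish {x} {e = e} τ f eq = run-set
    (frame-trans ≤-refl f (frame-update τ 0 (eval e τ) ≤-refl) , trans (update-≡ τ x 0 _) eq)

  module _ {D c w b s e P} (D<w : D < w) (c<w : c < w) (D≢c : D ≢ c) (h : ℕ → ℕ) (σ : Store)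
           (guard : ∀ τ → (∀ y i → y < w → y ≢ D → y ≢ c → τ y i ≡ σ y i) → eval e τ ≡ b)
           (body : ∀ i τ → i < b → (∀ y i → y < w → y ≢ D → y ≢ c → τ y i ≡ σ y i) → τ c 0 ≡ i →
                   Run P τ s (Post w τ (h i))) where

    Filled : ℕ → Store → Set
    Filled b τ = (∀ y i → y < w → y ≢ D → y ≢ c → τ y i ≡ σ y i) × (∀ j → j < b → τ D j ≡ h j)

    private
      stored : ∀ i υ → υ c 0 ≡ i → υ w 0 ≡ h i → (∀ j → j < i → υ D j ≡ h j) →
               ∀ j → j < suc i → update υ D (υ c 0) (υ w 0) D j ≡ h j
      stored i υ refl r done j j<1+i with j ≟ υ c 0
      ... | yes refl = trans (update-≡ υ D j (υ w 0)) r
      ... | no j≢i   = trans (update-≢′ υ D (υ w 0) j≢i) (done j (≤∧≢⇒< (s≤s⁻¹ j<1+i) j≢i))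

    run-fill : Run (fill D c w e P) σ (fillSteps b s) (Filled b)
    run-fill = run-weaken ≤-refl (λ τ → proj₁) (run-for
      (λ i τ → Filled i τ × τ c 0 ≡ i)
      (λ i τ inv → guard τ (proj₁ (proj₁ inv)))
      (λ i τ → proj₂)
      (λ i τ i<b ((keep , done) , ctr) → run-seq (body i τ i<b keep ctr) λ υ (f , r) →
        let
          ctr′ : υ c 0 ≡ i
          ctr′ = trans (f c 0 c<w) ctr
          υ′ = update υ D (υ c 0) (υ w 0)
          υ″ = update υ′ c 0 (υ′ c 0 + 1)
          at-c : υ′ c 0 ≡ i
          at-c = trans (update-≢ υ (υ c 0) (υ w 0) 0 (D≢c ∘ sym)) ctr′
          keep′ : ∀ y j → y < w → y ≢ D → y ≢ c → υ″ y j ≡ σ y j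
          keep′ = λ y j y<w y≢D y≢c → trans (update-≢ υ′ 0 _ j y≢c)
            (trans (update-≢ υ (υ c 0) (υ w 0) j y≢D) (trans (f y j y<w) (keep y j y<w y≢D y≢c)))
          done′ : ∀ j → j < suc i → υ″ D j ≡ h j
          done′ = λ j j<1+i → trans (update-≢ υ′ 0 _ j D≢c)
            (stored i υ ctr′ r (λ j j<i → trans (f D j D<w) (done j j<i)) j j<1+i)
        in run-set ((keep′ , done′) , trans (update-≡ υ′ c 0 _) (trans (cong (_+ 1) at-c) (+-comm i 1))))
      σ
      (((λ y i _ _ y≢c → update-≢ σ 0 0 i y≢c) , λ _ ()) , update-≡ σ c 0 0))

  module _ (input : ℕ → ℕ) where
    open Semantics input

    -- An array variable is compared with memory only below its size, since the cells beyond are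
    -- arbitrary.
    record Env {a k} (x : ℕ) (αₙ : Fin a → ℕ × Bd) (ρₙ : Fin k → ℕ)
               (α : Fin a → ℕ → ℕ) (ρ : Fin k → ℕ) (σ : Store) : Set where
      field
        0<x    : 0 < x
        inputs : ∀ i → σ 0 i ≡ input i
        var<   : ∀ v → ρₙ v < x
        vars   : ∀ v → σ (ρₙ v) 0 ≡ ρ v
        arr<   : ∀ j → proj₁ (αₙ j) < x
        arrs   : ∀ j i → α j i ≡ table ⟦ proj₂ (αₙ j) ⟧ˢ (σ (proj₁ (αₙ j))) i

    module _ {a k} {x : ℕ} {αₙ : Fin a → ℕ × Bd} {ρₙ : Fin k → ℕ} {α : Fin a → ℕ → ℕ} {ρ : Fin k → ℕ}
             {σ : Store} (E : Env x αₙ ρₙ α ρ σ) where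
      open Env E

      env-frame : ∀ {y τ} → x ≤ y → Frame x σ τ → Env y αₙ ρₙ α ρ τ
      env-frame x≤y f = record
        { 0<x    = ≤-trans 0<x x≤y
        ; inputs = λ i → trans (f 0 i 0<x) (inputs i)
        ; var<   = λ v → ≤-trans (var< v) x≤y
        ; vars   = λ v → trans (f _ 0 (var< v)) (vars v)
        ; arr<   = λ j → ≤-trans (arr< j) x≤y
        ; arrs   = λ j i → trans (arrs j i) (table-cong ⟦ proj₂ (αₙ j) ⟧ˢ (λ i → sym (f _ i (arr< j))) i)
        }

      env-var : ∀ {y v} → y < x → σ y 0 ≡ v → Env x αₙ (y ▹ ρₙ) α (v ▹ ρ) σ
      env-var y<x eq = record
        { 0<x = 0<x ; inputs = inputs ; arr< = arr< ; arrs = arrs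
        ; var< = λ { zero → y<x ; (suc v) → var< v }
        ; vars = λ { zero → eq ; (suc v) → vars v } }

      env-arr : ∀ {y s A} → y < x → (∀ i → A i ≡ table ⟦ s ⟧ˢ (σ y) i) → Env x ((y , s) ▹ αₙ) ρₙ (A ▹ α) ρ σ
      env-arr y<x eq = record
        { 0<x = 0<x ; inputs = inputs ; var< = var< ; vars = vars
        ; arr< = λ { zero → y<x ; (suc j) → arr< j }
        ; arrs = λ { zero → eq ; (suc j) → arrs j } }

      eval-bd : ∀ B → eval (bdᵉ B) σ ≡ ⟦ B ⟧ˢ
      eval-bd (# c)   = refl
      eval-bd n̂       = inputs 0
      eval-bd (B ⊞ C) = cong₂ _+_ (eval-bd B) (eval-bd C)
      eval-bd (B ⊠ C) = cong₂ _*_ (eval-bd B) (eval-bd C)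

    frame-refl : ∀ {x σ} → Frame x σ σ
    frame-refl y i _ = refl

    frame-pred : ∀ {x y σ τ} → x ≤ y → Frame y σ τ → Frame x σ τ
    frame-pred x≤y f z i z<x = f z i (≤-trans z<x x≤y)

    N : ℕ
    N = input 0

    correct  : ∀ {a k A} (t : Tm a k A) {x αₙ ρₙ α ρ σ} → Env x αₙ ρₙ α ρ σ →
               Run (comp t x αₙ ρₙ) σ (time t N) (Post x σ (code (⟦ t ⟧ α ρ)))
    correct* : ∀ {a k m} (ts : Vec (Tm a k nat) m) {x αₙ ρₙ α ρ σ} → Env x αₙ ρₙ α ρ σ →
               Run (comp* ts x αₙ ρₙ) σ (time* ts N)
                   (λ τ → Frame x σ τ × (∀ i → τ (toℕ i + x) 0 ≡ ⟦ ts ⟧* α ρ i))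

    correct₁ : ∀ {a k A} (t : Tm a k A) {x αₙ ρₙ α ρ σ e v} → Env x αₙ ρₙ α ρ σ →
               (∀ τ → Env x αₙ ρₙ α ρ τ → τ (1 + x) 0 ≡ code (⟦ t ⟧ α ρ) → eval e τ ≡ v) →
               Run (comp t (1 + x) αₙ ρₙ ⨾ set x (lit 0) e) σ (time t N + 1) (Post x σ v)
    correct₁ t E eq = run-seq (correct t (env-frame E (n≤1+n _) frame-refl)) λ τ (f , r) →
      finish τ (frame-pred (n≤1+n _) f) (eq τ (env-frame E ≤-refl (frame-pred (n≤1+n _) f)) r)

    correct₂ : ∀ {a k A} (t u : Tm a k A) {x αₙ ρₙ α ρ σ P s v} → Env x αₙ ρₙ α ρ σ →
               (∀ τ → Frame x σ τ → Env x αₙ ρₙ α ρ τ → τ (1 + x) 0 ≡ code (⟦ t ⟧ α ρ) → τ (2 + x) 0 ≡ code (⟦ u ⟧ α ρ) →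
                 Run P τ s (Post x σ v)) →
               Run (comp t (1 + x) αₙ ρₙ ⨾ comp u (2 + x) αₙ ρₙ ⨾ P) σ (time t N + (time u N + s)) (Post x σ v)
    correct₂ t u {x} E k =
      run-seq (correct t (env-frame E (n≤1+n _) frame-refl)) λ τ (f , r) →
      let f′ = frame-pred (n≤1+n _) f in
      run-seq (correct u (env-frame E (m≤n+m _ 2) f′)) λ υ (g , s) →
      let h = frame-trans ≤-refl f′ (frame-pred (m≤n+m x 2) g) in
      k υ h (env-frame E ≤-refl h) (trans (g (1 + x) 0 ≤-refl) r) s

    correct (bd B) E = finish _ frame-refl (eval-bd E B)
    correct (var i) E = finish _ frame-refl (Env.vars E i)
    correct (inp t) E = correct₁ t E λ τ E′ r → trans (Env.inputs E′ _) (cong input r)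
    correct (inp₂ t u) E = correct₂ t u E λ τ f E′ r s → finish τ f
      (cong₂ _*_ (trans (Env.inputs E′ _) (cong input r)) (trans (Env.inputs E′ _) (cong input s)))
    correct (arr i t) {x} {αₙ} {ρₙ} {α} {ρ} {σ} E =
      run-seq (correct t (env-frame E (n≤1+n _) frame-refl)) λ τ (f , r) → access τ (frame-pred (n≤1+n _) f) r
      where
      a = proj₁ (αₙ i)
      s = proj₂ (αₙ i)
      v = ⟦ t ⟧ α ρ
      access : ∀ τ → Frame x σ τ → τ (1 + x) 0 ≡ v →
               Run (cond (op sub (bdᵉ s) (cell (1 + x))) (set x (lit 0) (get a (cell (1 + x)))) (set x (lit 0) (lit 0)))
                   τ 2 (Post x σ (α i v))
      access τ f r with v <? ⟦ s ⟧ˢ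
      ... | yes v<s = run-then
        (λ eq → <⇒≱ v<s (m∸n≡0⇒m≤n (trans (sym (cong₂ _∸_ (eval-bd E′ s) r)) eq)))
        (finish τ f (trans (cong (τ a) r) (trans (sym (table-< (τ a) v<s)) (sym (Env.arrs E′ i v)))))
        where E′ = env-frame E ≤-refl f
      ... | no v≮s = run-else
        (trans (cong₂ _∸_ (eval-bd E′ s) r) (m≤n⇒m∸n≡0 (≮⇒≥ v≮s)))
        (finish τ f (trans (sym (table-≥ (τ a) (≮⇒≥ v≮s))) (sym (Env.arrs E′ i v))))
        where E′ = env-frame E ≤-refl f
    correct (t ⊕ u) E = correct₂ t u E λ τ f E′ r s → finish τ f (cong₂ _+_ r s)
    correct (t ⊖ u) E = correct₂ t u E λ τ f E′ r s → finish τ f (cong₂ _∸_ r s)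
    correct (t ⊗ B) E = correct₁ t E λ τ E′ r → cong₂ _*_ r (eval-bd E′ B)
    correct (t ⊘ B) E = correct₁ t E λ τ E′ r → cong₂ (apply div) r (eval-bd E′ B)
    correct (t ⊲ u) {x} {α = α} {ρ} {σ} E = correct₂ t u E λ τ f E′ r s → test τ f r s
      where
      test : ∀ τ → Frame x σ τ → τ (1 + x) 0 ≡ ⟦ t ⟧ α ρ → τ (2 + x) 0 ≡ ⟦ u ⟧ α ρ →
             Run (cond (op sub (cell (2 + x)) (cell (1 + x))) (set x (lit 0) (lit 1)) (set x (lit 0) (lit 0))) τ 2
                 (Post x σ (𝟙 (⟦ t ⟧ α ρ <ᵇ ⟦ u ⟧ α ρ)))
      test τ f r s with ⟦ t ⟧ α ρ <? ⟦ u ⟧ α ρ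
      ... | yes lt = run-then
        (λ eq → <⇒≱ lt (m∸n≡0⇒m≤n (trans (sym (cong₂ _∸_ s r)) eq)))
        (finish τ f (cong 𝟙 (sym (<ᵇ-true lt))))
      ... | no ¬lt = run-else (trans (cong₂ _∸_ s r) (m≤n⇒m∸n≡0 (≮⇒≥ ¬lt)))
        (finish τ f (cong 𝟙 (sym (<ᵇ-false (≮⇒≥ ¬lt)))))
    correct {A = A} (ite b t u) {x} {αₙ} {ρₙ} {α} {ρ} {σ} E =
      run-seq (correct b (env-frame E (n≤1+n _) frame-refl)) λ τ (f , r) → branch τ (frame-pred (n≤1+n _) f) _ r
      where
      post-trans : ∀ {τ v} → Frame x σ τ → ∀ υ → Post x τ v υ → Post x σ v υ
      post-trans f υ (g , r) = frame-trans ≤-refl f g , r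
      branch : ∀ τ → Frame x σ τ → ∀ v → τ (1 + x) 0 ≡ 𝟙 v →
               Run (cond (cell (1 + x)) (comp t x αₙ ρₙ) (comp u x αₙ ρₙ)) τ (suc (time t N + time u N))
                   (Post x σ (code (if v then ⟦ t ⟧ α ρ else ⟦ u ⟧ α ρ)))
      branch τ f true  r = run-then (λ eq → 1+n≢0 (trans (sym r) eq))
        (run-weaken (m≤m+n _ _) (post-trans f) (correct t (env-frame E ≤-refl f)))
      branch τ f false r = run-else r
        (run-weaken (m≤n+m _ (time t N)) (post-trans f) (correct u (env-frame E ≤-refl f)))
    correct (sum B t) {x} {αₙ} {ρₙ} {α} {ρ} {σ} E = run-seq {Q = Post x σ 0} (finish σ frame-refl refl) λ σ₁ (f₁ , r₁) →
      run-weaken ≤-refl (λ τ (f , r , _) → f , r) (run-for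
        (λ i τ → Frame x σ τ × τ x 0 ≡ ∑ i g × τ (1 + x) 0 ≡ i)
        (λ i τ (f , _) → eval-bd (env-frame E ≤-refl f) B)
        (λ i τ (_ , _ , ctr) → ctr)
        (λ i τ i<b (f , r , ctr) →
          run-seq (correct t {x = 2 + x} {ρ = i ▹ ρ} (env-var (env-frame E (m≤n+m x 2) f) ≤-refl ctr)) λ υ (f′ , r′) →
          let υ′ = update υ x 0 (υ x 0 + υ (2 + x) 0) in
          run-set
            ( frame-trans ≤-refl f (frame-trans ≤-refl (frame-pred (m≤n+m x 2) f′)
                (frame-trans ≤-refl (frame-update υ 0 _ ≤-refl) (frame-update υ′ 0 _ (n≤1+n x))))
            , trans (update-≢ υ′ 0 _ 0 (<⇒≢ ≤-refl))
                (trans (update-≡ υ x 0 _) (cong₂ _+_ (trans (f′ x 0 (n≤1+n _)) r) r′))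
            , trans (update-≡ υ′ (1 + x) 0 _)
                (trans (cong (_+ 1) (trans (update-≢ υ 0 _ 0 (<⇒≢ ≤-refl ∘ sym)) (trans (f′ (1 + x) 0 ≤-refl) ctr))) (+-comm i 1))))
        σ₁
        ( frame-trans ≤-refl f₁ (frame-update σ₁ 0 0 (n≤1+n x))
        , trans (update-≢ σ₁ 0 0 0 (<⇒≢ ≤-refl)) r₁
        , update-≡ σ₁ (1 + x) 0 0))
      where g = λ i → ⟦ t ⟧ α (i ▹ ρ)
    correct (rec r B s f g u) {x} {αₙ} {ρₙ} {α} {ρ} {σ} E =
      run-seq (correct r (env-frame E (m≤n+m x 5) frame-refl)) λ σ₁ (f₁ , lim) →
      let f₁ = frame-pred (m≤n+m x 5) f₁ in
      run-seq (run-fill {D = 1 + x} {3 + x} {6 + x} (up 1 6 refl) (up 3 6 refl) (apart 1 3 λ ()) F σ₁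
                 (λ τ keep → eval-bd (env-frame E ≤-refl (kept 1 3 f₁ keep)) s)
                 (λ i τ _ keep ctr → correct f
                   (env-var (env-frame E (m≤n+m x 6) (kept 1 3 f₁ keep)) (up 3 6 refl) ctr)))
        λ σ₂ (keep₂ , done₂) →
      let f₂ = kept 1 3 f₁ keep₂ in
      -- The loop makes `R` rounds, the smaller of the request and `B`, while `time` charges for
      -- `B`.
      run-seq (run-weaken (+-monoʳ-≤ 2 (*-monoˡ-≤ (2 + roundSteps) (clip≤ (⟦ r ⟧ α ρ) ⟦ B ⟧ˢ))) (λ τ p → p)
       (run-for Inv guard (λ t τ (_ , _ , _ , ctr) → ctr) body σ₂
        ( frame-trans ≤-refl f₂ (frame-update σ₂ 0 0 (m≤n+m x 4))
        , trans (update-≢ σ₂ 0 0 0 (apart 5 4 λ ())) (trans (keep₂ (5 + x) 0 (up 5 6 refl) (apart 5 1 λ ()) (apart 5 3 λ ())) lim)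
        , (λ j j<S → trans (update-≢ σ₂ 0 0 j (apart 1 4 λ ())) (trans (done₂ j j<S) (sym (table-< F j<S))))
        , update-≡ σ₂ (4 + x) 0 0)))
        λ σ₃ (f₃ , _ , done₃ , _) →
      run-seq (correct u (env-arr (env-frame E (m≤n+m x 2) f₃) (up 1 2 refl) (iterate-restrict S F G R done₃)))
        λ σ₄ (f₄ , res) →
      finish σ₄ (frame-trans ≤-refl f₃ (frame-pred (m≤n+m x 2) f₄)) res
      where
      S = ⟦ s ⟧ˢ
      F = λ i → ⟦ f ⟧ α (i ▹ ρ)
      G = λ t A i → ⟦ g ⟧ (A ▹ α) (i ▹ t ▹ ρ)
      R = clip (⟦ r ⟧ α ρ) ⟦ B ⟧ˢ
      up : ∀ i j → (i <ᵇ j) ≡ true → i + x < j + x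
      up i j lt = +-monoˡ-< x (true-<ᵇ lt)
      apart : ∀ i j → i ≢ j → i + x ≢ j + x
      apart i j i≢j = i≢j ∘ +-cancelʳ-≡ x i j
      kept : ∀ i j {τ υ} → Frame x σ τ → (∀ y l → y < 6 + x → y ≢ i + x → y ≢ j + x → υ y l ≡ τ y l) → Frame x σ υ
      kept i j f keep y l y<x = trans (keep y l (≤-trans y<x (m≤n+m x 6)) (low i) (low j)) (f y l y<x)
        where
        low : ∀ i → y ≢ i + x
        low i = <⇒≢ (≤-trans y<x (m≤n+m x i))
      Inv : ℕ → Store → Set
      Inv t τ = Frame x σ τ × τ (5 + x) 0 ≡ ⟦ r ⟧ α ρ × (∀ j → j < S → τ (1 + x) j ≡ iterate S F G t j) × τ (4 + x) 0 ≡ t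
      guard : ∀ t τ → Inv t τ → eval (op sub (cell (5 + x)) (op sub (cell (5 + x)) (bdᵉ B))) τ ≡ R
      guard t τ (f , lim , _) = cong₂ _∸_ lim (cong₂ _∸_ lim (eval-bd (env-frame E ≤-refl f) B))
      roundSteps = fillSteps (⟦ s ⟧ᵇ N) (time g N) + fillSteps (⟦ s ⟧ᵇ N) 1
      body : ∀ t τ → t < R → Inv t τ →
        Run (fill (2 + x) (3 + x) (6 + x) (bdᵉ s) (comp g (6 + x) ((1 + x , s) ▹ αₙ) (3 + x ▹ 4 + x ▹ ρₙ)) ⨾
             fill (1 + x) (3 + x) (6 + x) (bdᵉ s) (set (6 + x) (lit 0) (get (2 + x) (cell (3 + x)))))
            τ roundSteps (λ υ → Inv (suc t) (update υ (4 + x) 0 (υ (4 + x) 0 + 1)))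
      body t τ t<R (f , lim , done , ctr) =
        run-seq (run-fill {D = 2 + x} {3 + x} {6 + x} (up 2 6 refl) (up 3 6 refl) (apart 2 3 λ ()) (G t (iterate S F G t)) τ
                   (λ υ keep → eval-bd (env-frame E ≤-refl (kept 2 3 f keep)) s)
                   (λ i υ _ keep idx → correct g
                     (env-arr (env-var (env-var (env-frame E (m≤n+m x 6) (kept 2 3 f keep)) (up 4 6 refl)
                         (trans (keep (4 + x) 0 (up 4 6 refl) (apart 4 2 λ ()) (apart 4 3 λ ())) ctr))
                       (up 3 6 refl) idx) (up 1 6 refl)
                       (iterate-restrict S F G t (λ j j<S →
                         trans (keep (1 + x) j (up 1 6 refl) (apart 1 2 λ ()) (apart 1 3 λ ())) (done j j<S))))))
          λ τ₁ (keep₁ , done₁) →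
        let f₁ = kept 2 3 f keep₁ in
        run-weaken ≤-refl (λ τ₂ (keep₂ , done₂) →
            frame-trans ≤-refl (kept 1 3 f₁ keep₂) (frame-update τ₂ 0 _ (m≤n+m x 4))
          , trans (update-≢ τ₂ 0 _ 0 (apart 5 4 λ ()))
              (trans (keep₂ (5 + x) 0 (up 5 6 refl) (apart 5 1 λ ()) (apart 5 3 λ ()))
                (trans (keep₁ (5 + x) 0 (up 5 6 refl) (apart 5 2 λ ()) (apart 5 3 λ ())) lim))
          , (λ j j<S → trans (update-≢ τ₂ 0 _ j (apart 1 4 λ ())) (trans (done₂ j j<S) (sym (table-< (G t (iterate S F G t)) j<S))))
          , trans (update-≡ τ₂ (4 + x) 0 _)
              (trans (cong (_+ 1) (trans (keep₂ (4 + x) 0 (up 4 6 refl) (apart 4 1 λ ()) (apart 4 3 λ ()))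
                (trans (keep₁ (4 + x) 0 (up 4 6 refl) (apart 4 2 λ ()) (apart 4 3 λ ())) ctr))) (+-comm t 1)))
          (run-fill {D = 1 + x} {3 + x} {6 + x} (up 1 6 refl) (up 3 6 refl) (apart 1 3 λ ()) (G t (iterate S F G t)) τ₁
            (λ υ keep → eval-bd (env-frame E ≤-refl (kept 1 3 f₁ keep)) s)
            (λ i υ i<S keep idx → finish υ frame-refl (trans (cong (υ (2 + x)) idx)
              (trans (keep (2 + x) i (up 2 6 refl) (apart 2 1 λ ()) (apart 2 3 λ ())) (done₁ i i<S)))))
    correct (call {m = m} f φ ts) {x} {αₙ} {ρₙ} {α} {ρ} {σ} E =
      run-seq (correct* ts (env-frame E (n≤1+n _) frame-refl)) λ σ₁ (f₁ , args) →
      let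
        f₁ = frame-pred (n≤1+n _) f₁
        x≤y : x ≤ m + (1 + x)
        x≤y = ≤-trans (n≤1+n x) (m≤n+m _ m)
        E₁ = env-frame E ≤-refl f₁
      in
      run-seq (correct f record
          { 0<x    = ≤-trans (Env.0<x E) x≤y
          ; inputs = Env.inputs E₁
          ; var<   = λ v → +-monoˡ-< (1 + x) (toℕ<n v)
          ; vars   = args
          ; arr<   = λ j → ≤-trans (Env.arr< E₁ (φ j)) x≤y
          ; arrs   = λ j → Env.arrs E₁ (φ j) })
        λ σ₂ (f₂ , res) →
      finish σ₂ (frame-trans ≤-refl f₁ (frame-pred x≤y f₂)) res

    correct* []       E = run ⇓skip ≤-refl (frame-refl , λ ())
    correct* (t ∷ ts) {x} {σ = σ} E =
      run-seq (correct t E) λ τ (f , r) →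
      run-weaken ≤-refl (λ υ (g , args) →
          frame-trans ≤-refl f (frame-pred (n≤1+n x) g)
        , λ { zero    → trans (g x 0 ≤-refl) r
            ; (suc i) → trans (cong (λ z → υ z 0) (sym (+-suc (toℕ i) x))) (args i) })
        (correct* ts (env-frame E (n≤1+n x) f))

  -- Array 1 receives the values of the term at 0, …, input 0 - 1.
  main : Tm 0 1 bool → Program
  main t = fill 1 2 3 (cell 0) (comp t 3 ∅ (2 ▹ ∅))

  mainSteps : Tm 0 1 bool → ℕ → ℕ
  mainSteps t n = fillSteps n (time t n)

  run-main : ∀ t ws → Run (main t) (initial ws) (mainSteps t (nth ws 0))
    (λ τ → ∀ i → i < nth ws 0 → τ 1 i ≡ 𝟙 (Semantics.⟦_⟧ (nth ws) t ∅ (i ▹ ∅)))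
  run-main t ws = run-weaken ≤-refl (λ τ → proj₂)
    (run-fill (s≤s (s≤s z≤n)) ≤-refl (λ ()) _ (initial ws)
      (λ τ keep → keep 0 0 (s≤s z≤n) (λ ()) (λ ()))
      (λ i τ _ keep ctr → correct (nth ws) t record
        { 0<x    = s≤s z≤n
        ; inputs = λ j → keep 0 j (s≤s z≤n) (λ ()) (λ ())
        ; var<   = λ { zero → ≤-refl }
        ; vars   = λ { zero → ctr }
        ; arr<   = λ ()
        ; arrs   = λ () }))

  tame-main : ∀ t → Tame (main t)
  tame-main t = tame-fill (s≤s z≤n) (s≤s z≤n) (tame-cell 0) (tame-comp t ∅ (2 ▹ ∅) (s≤s z≤n))

  -- The number of steps is polynomial in the first input cell, hence in the size of the input.
  -- Substituted into `timeBound`, itself polynomial in steps and size, it remains polynomial.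
  poly-run : ∀ {A : Set} (encode : A → List ℕ) {P f} {Q : List ℕ → Store → Set} → Polynomial.Poly f → Tame P →
             (∀ x → 1 ≤ size (encode x)) → (∀ x → nth (encode x) 0 ≤ size (encode x)) →
             (∀ x → Run P (initial (encode x)) (f (nth (encode x) 0)) (Q (encode x))) → PolynomialTime encode P
  poly-run encode {P} {f} (a₁ , e₁ , f≤) tP 1≤size n≤size runs = a , e , λ x →
    bounded (runs x) (f≤ (nth (encode x) 0) (size (encode x)) (n≤size x) (1≤size x)) (1≤size x)
    where
    open ≤-Reasoning
    open Polynomial
    c = suc (weight P)
    poly-^ : ∀ e → Poly (λ n → n ^ e)
    poly-^ zero    = poly-const 1
    poly-^ (suc e) = poly-* poly-id (poly-^ e)
    poly-c : Poly (λ L → c * L)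
    poly-c = poly-* (poly-const c) poly-id
    poly-s : Poly (λ L → a₁ * L ^ e₁)
    poly-s = poly-* (poly-const a₁) (poly-^ e₁)
    bound : Poly (λ L → timeBound c (a₁ * L ^ e₁) L)
    bound = poly-* poly-s (poly-* (poly-const c)
      (poly-+ (poly-const 1) (poly-+ (poly-+ poly-id (poly-* poly-s poly-c)) poly-c)))
    a = proj₁ bound
    e = proj₁ (proj₂ bound)
    timeBound-mono : ∀ s s′ L → s ≤ s′ → timeBound c s L ≤ timeBound c s′ L
    timeBound-mono s s′ L s≤ = *-mono-≤ s≤ (*-monoʳ-≤ c (s≤s (+-monoˡ-≤ (c * L) (+-monoʳ-≤ L (*-monoˡ-≤ (c * L) s≤)))))
    bounded : ∀ {ws s Q} → Run P (initial ws) s Q → s ≤ a₁ * size ws ^ e₁ → 1 ≤ size ws →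
          ∃[ τ ] ∃[ t ] ⟨ P , initial ws ⟩⇓ τ ∶ t × t ≤ a * size ws ^ e + a
    bounded {ws} {s} (run {final} {spent} D D≤ _) s≤ 1≤ = final , spent , D , (begin
      spent                                   ≤⟨ time-initial≤ D tP 1≤ ⟩
      timeBound c (steps D) (size ws)         ≤⟨ timeBound-mono _ _ (size ws) (≤-trans D≤ s≤) ⟩
      timeBound c (a₁ * size ws ^ e₁) (size ws) ≤⟨ proj₂ (proj₂ bound) (size ws) (size ws) ≤-refl 1≤ ⟩
      a * size ws ^ e                         ≤⟨ m≤m+n _ a ⟩
      a * size ws ^ e + a                     ∎)

  poly-main : ∀ {A : Set} (encode : A → List ℕ) t → (∀ x → 1 ≤ size (encode x)) →
              (∀ x → nth (encode x) 0 ≤ size (encode x)) → PolynomialTime encode (main t)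
  poly-main encode t 1≤size n≤size =
    poly-run encode {P = main t}
      {Q = λ ws τ → ∀ i → i < nth ws 0 → τ 1 i ≡ 𝟙 (Semantics.⟦_⟧ (nth ws) t ∅ (i ▹ ∅))}
      (poly-fill Polynomial.poly-id (poly-time t)) (tame-main t) 1≤size n≤size
      (λ x → run-main t (encode x))

-- The algorithm as a term

module Implementation where
  open import Data.Fin.Base using (Fin; zero; suc)
  open import Data.Vec.Base using (Vec; []; _∷_)
  open Sums
  open Language
  open Algorithm

  pattern 0# = zero
  pattern 1# = suc zero
  pattern 2# = suc (suc zero)
  pattern 3# = suc (suc (suc zero))

  private
    variable
      a k : ℕ
      A   : Ty

  v₀ : Tm a (1 + k) nat
  v₀ = var 0#

  v₁ : Tm a (2 + k) nat
  v₁ = var 1#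

  v₂ : Tm a (3 + k) nat
  v₂ = var 2#

  v₃ : Tm a (4 + k) nat
  v₃ = var 3#

  ⌜_⌝ : ℕ → Tm a k nat
  ⌜ c ⌝ = bd (# c)

  n Mᵇ Nᵇ Tᵇ : Bd
  n  = n̂
  Mᵇ = # 1 ⊞ n̂
  Nᵇ = n̂ ⊠ n̂ ⊞ n̂ ⊞ # 1
  Tᵇ = Nᵇ ⊠ Nᵇ ⊠ n̂ ⊞ # 1

  ffᵗ : Tm a k bool
  ffᵗ = ⌜ 0 ⌝ ⊲ ⌜ 0 ⌝

  ttᵗ : Tm a k bool
  ttᵗ = ⌜ 0 ⌝ ⊲ ⌜ 1 ⌝

  infixr 4 _and_
  infixl 3 _or_

  _and_ _or_ : Tm a k bool → Tm a k bool → Tm a k bool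
  b and c = ite b c ffᵗ
  b or c  = ite b ttᵗ c

  not : Tm a k bool → Tm a k bool
  not b = ite b ffᵗ ttᵗ

  tally : Bd → Tm a (suc k) bool → Tm a k nat
  tally B t = sum B (ite t (⌜ 1 ⌝) (⌜ 0 ⌝))

  some : Bd → Tm a (suc k) bool → Tm a k bool
  some B t = ⌜ 0 ⌝ ⊲ tally B t

  _≐_ : Tm a k nat → Tm a k nat → Tm a k bool
  t ≐ u = not (t ⊲ u) and not (u ⊲ t)

  infix 5 _≐_

  quotᵗ remᵗ : Bd → Tm a k nat → Tm a k nat
  quotᵗ B t = t ⊘ B
  remᵗ B t  = t ⊖ quotᵗ B t ⊗ B

  quots : ℕ → Tm a k nat → Tm a k nat
  quots zero    t = t
  quots (suc i) t = quotᵗ Mᵇ (quots i t)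

  -- A guess is a number with digits e, f, q₀, …, q₃, τ, rₛ, bₛ, κ, a, β to
  -- base n + 1, followed by the number of relaxation rounds.
  digit : ℕ → Tm a k nat → Tm a k nat
  digit i t = remᵗ Mᵇ (quots i t)

  call₀ : ∀ {m} → Tm 0 m A → Vec (Tm a k nat) m → Tm a k A
  call₀ f = call f ∅

  call₁ : ∀ {m} → Tm 1 m A → Fin a → Vec (Tm a k nat) m → Tm a k A
  call₁ f i = call f (i ▹ ∅)

  -- Four header cells and `n` colours precede the distances, which take two cells each.
  numᵗ denᵗ : Tm a k nat → Tm a k nat → Tm a k nat
  numᵗ i j = bd (# 4 ⊞ n̂) ⊕ (i ⊗ n̂ ⊕ j) ⊗ # 2
  denᵗ i j = ⌜ 1 ⌝ ⊕ numᵗ i j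

  redᵗ : Tm 0 1 bool
  redᵗ = ⌜ 0 ⌝ ⊲ inp (⌜ 4 ⌝ ⊕ v₀)

  sideᵗ : Bool → Tm 0 1 bool
  sideᵗ true  = redᵗ
  sideᵗ false = not redᵗ

  -- `v₀` is the guess; its two lowest digits name a pair of points whose distance is the radius.
  -- Distances are compared by cross-multiplication, which takes only products of input cells and so
  -- stays tame.
  adjᵗ : Tm 0 3 bool
  adjᵗ = (v₁ ⊲ bd n) and (v₂ ⊲ bd n) and
    not (inp₂ (numᵗ (digit 0 v₀) (digit 1 v₀)) (denᵗ v₁ v₂) ⊲ inp₂ (numᵗ v₁ v₂) (denᵗ (digit 0 v₀) (digit 1 v₀)))

  hop₂ᵗ hop₃ᵗ : Tm 0 3 bool
  hop₂ᵗ = some n (call₀ adjᵗ (v₁ ∷ v₂ ∷ v₀ ∷ []) and call₀ adjᵗ (v₁ ∷ v₀ ∷ v₃ ∷ []))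
  hop₃ᵗ = some n (call₀ adjᵗ (v₁ ∷ v₂ ∷ v₀ ∷ []) and call₀ hop₂ᵗ (v₁ ∷ v₀ ∷ v₃ ∷ []))

  regionᵗ : Tm 0 2 bool
  regionᵗ = call₀ hop₃ᵗ (v₀ ∷ digit 2 v₀ ∷ v₁ ∷ []) or call₀ hop₂ᵗ (v₀ ∷ digit 3 v₀ ∷ v₁ ∷ []) or
            call₀ hop₂ᵗ (v₀ ∷ digit 4 v₀ ∷ v₁ ∷ []) or call₀ hop₂ᵗ (v₀ ∷ digit 5 v₀ ∷ v₁ ∷ [])

  freeᵗ : Tm 1 2 bool
  freeᵗ = (v₁ ⊲ bd n) and not (call₀ regionᵗ (v₀ ∷ v₁ ∷ [])) and not (arr 0# v₁ ⊲ bd n)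

  redsᵗ : Tm 1 2 nat
  redsᵗ = tally n (call₀ adjᵗ (v₁ ∷ v₂ ∷ v₀ ∷ []) and call₀ redᵗ (v₀ ∷ []) and call₁ freeᵗ 0# (v₁ ∷ v₀ ∷ []))

  commonᵗ : Tm 1 3 nat
  commonᵗ = tally n (call₀ adjᵗ (v₁ ∷ v₂ ∷ v₀ ∷ []) and call₀ adjᵗ (v₁ ∷ v₃ ∷ v₀ ∷ []) and
                     call₀ redᵗ (v₀ ∷ []) and call₁ freeᵗ 0# (v₁ ∷ v₀ ∷ []))

  denseStepᵗ : Tm 1 3 nat
  denseStepᵗ = ite
    (call₁ freeᵗ 0# (v₂ ∷ v₀ ∷ []) and (digit 6 v₂ ⊕ digit 6 v₂ ⊲ call₁ redsᵗ 0# (v₂ ∷ v₁ ∷ [])) and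
     some n (call₀ adjᵗ (v₃ ∷ v₀ ∷ v₁ ∷ []) and (digit 6 v₃ ⊲ call₁ commonᵗ 0# (v₃ ∷ v₂ ∷ v₀ ∷ []))))
    v₁ (arr 0# v₀)

  lightᵗ : Tm 1 2 bool
  lightᵗ = call₁ freeᵗ 0# (v₀ ∷ v₁ ∷ []) and not (digit 6 v₀ ⊕ digit 6 v₀ ⊕ digit 6 v₀ ⊲
    tally n (call₀ hop₂ᵗ (v₁ ∷ v₂ ∷ v₀ ∷ []) and call₀ redᵗ (v₀ ∷ []) and call₁ freeᵗ 0# (v₁ ∷ v₀ ∷ [])))

  clusterStepᵗ : Tm 3 3 nat
  clusterStepᵗ = ite
    (call₁ lightᵗ 2# (v₂ ∷ v₀ ∷ []) and not (arr 0# v₀ ⊲ bd n) and call₁ lightᵗ 2# (v₂ ∷ c ∷ []) and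
     not (arr 0# c ⊲ bd n) and not (arr 1# c ⊲ bd Nᵇ ⊖ quotᵗ Mᵇ v₁) and call₀ hop₂ᵗ (v₂ ∷ c ∷ v₀ ∷ []))
    c (arr 0# v₀)
    where
    c : Tm 3 3 nat
    c = remᵗ Mᵇ v₁

  -- The body receives the clustering as an additional array. The relaxation step and the final
  -- selection can thus both run it on their own `z`.
  clusterᵗ : ∀ {A} → Tm 3 2 A → Tm 2 2 A
  clusterᵗ = rec (bd ((Nᵇ ⊞ # 1) ⊠ Mᵇ)) ((Nᵇ ⊞ # 1) ⊠ Mᵇ) n (bd n)
    (call clusterStepᵗ (0# ▹ 1# ▹ 2# ▹ ∅) (v₀ ∷ v₁ ∷ v₂ ∷ []))

  memberᵗ : Bool → Tm 1 2 bool
  memberᵗ c = call₁ lightᵗ 0# (v₀ ∷ v₁ ∷ []) and call₀ (sideᵗ c) (v₁ ∷ [])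

  massᵗ : Bool → Tm 2 1 nat
  massᵗ c = sum n (ite (call₁ (memberᵗ c) 1# (v₁ ∷ v₀ ∷ [])) (arr 0# v₀) (⌜ 0 ⌝))

  raiseᵗ : Bool → Tm 2 2 nat
  raiseᵗ c = ite (call₁ (memberᵗ c) 1# (v₀ ∷ v₁ ∷ []) and (arr 0# v₁ ⊲ bd Nᵇ)) (arr 0# v₁ ⊕ ⌜ 1 ⌝) (arr 0# v₁)

  lowerᵗ : Tm 2 2 nat
  lowerᵗ = clusterᵗ (ite (arr 0# v₁ ≐ v₁) (arr 1# v₁ ⊖ ⌜ 1 ⌝) (arr 1# v₁))

  relaxStepᵗ : Tm 2 3 nat
  relaxStepᵗ =
    ite (call (massᵗ true) (λ i → i) (v₂ ∷ []) ⊕ bd n ⊲ digit 7 v₂ ⊗ Nᵇ) (call (raiseᵗ true) (λ i → i) (v₂ ∷ v₀ ∷ []))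
    (ite (call (massᵗ false) (λ i → i) (v₂ ∷ []) ⊕ bd n ⊲ digit 8 v₂ ⊗ Nᵇ) (call (raiseᵗ false) (λ i → i) (v₂ ∷ v₀ ∷ []))
      (call lowerᵗ (λ i → i) (v₂ ∷ v₀ ∷ [])))

  itemᵗ : Tm 2 1 nat
  itemᵗ = ite (arr 1# v₀ ⊲ bd n) (arr 1# v₀) (arr 0# v₀)

  weightᵗ : Bool → Tm 2 1 nat
  weightᵗ c = tally n (call itemᵗ (λ i → i) (v₀ ∷ []) ≐ v₁ and call₀ (sideᵗ c) (v₀ ∷ []))

  indexᵗ : Tm a k nat → Tm a k nat → Tm a k nat → Tm a k nat → Tm a k nat
  indexᵗ κ a β j = ((κ ⊗ Mᵇ ⊕ a) ⊗ Mᵇ ⊕ β) ⊗ Mᵇ ⊕ j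

  reachedᵗ : Tm 1 3 bool
  reachedᵗ = ⌜ 0 ⌝ ⊲ arr 0# (indexᵗ v₀ v₁ v₂ (bd n))

  knapsackStepᵗ : Tm 3 2 nat
  knapsackStepᵗ =
    ite (call₁ reachedᵗ 0# (κ ∷ α ∷ β ∷ [])) (arr 0# (indexᵗ κ α β j))
    (ite ((⌜ 0 ⌝ ⊲ κ) and not (α ⊲ w true) and not (β ⊲ w false) and
          call₁ reachedᵗ 0# (κ ⊖ ⌜ 1 ⌝ ∷ α ⊖ w true ∷ β ⊖ w false ∷ []))
      (ite (j ≐ v₁) (⌜ 1 ⌝) (arr 0# (indexᵗ (κ ⊖ ⌜ 1 ⌝) (α ⊖ w true) (β ⊖ w false) j)))
      (⌜ 0 ⌝))
    where
    κ α β j : Tm 3 2 nat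
    κ = quots 3 v₀
    α = remᵗ Mᵇ (quots 2 v₀)
    β = remᵗ Mᵇ (quots 1 v₀)
    j = remᵗ Mᵇ v₀
    w : Bool → Tm 3 2 nat
    w c = call (weightᵗ c) (1# ▹ 2# ▹ ∅) (v₁ ∷ [])

  -- Opaque, as its denotation is too large to be unfolded repeatedly.
  opaque
    candidateᵗ : Tm 0 2 bool
    candidateᵗ =
      rec (bd n) n n (bd n) (call₁ denseStepᵗ 0# (v₀ ∷ v₁ ∷ v₂ ∷ []))
      (rec (quots 12 v₀) Tᵇ n (⌜ 0 ⌝) (call relaxStepᵗ (λ i → i) (v₀ ∷ v₁ ∷ v₂ ∷ []))
      (clusterᵗ
      (rec (bd n) n (Mᵇ ⊠ Mᵇ ⊠ Mᵇ ⊠ Mᵇ) (ite (v₀ ≐ bd n) (⌜ 1 ⌝) (⌜ 0 ⌝)) (call knapsackStepᵗ (0# ▹ 1# ▹ 3# ▹ ∅) (v₀ ∷ v₁ ∷ []))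
      ((digit 2 v₀ ≐ v₁ or digit 3 v₀ ≐ v₁ or digit 4 v₀ ≐ v₁ or digit 5 v₀ ≐ v₁) or
        (⌜ 0 ⌝ ⊲ arr 0# (indexᵗ (digit 9 v₀) (digit 10 v₀) (digit 11 v₀) v₁))))))

  coversᵗ : Tm 0 2 bool
  coversᵗ = some n (call₀ candidateᵗ (v₁ ∷ v₀ ∷ []) and call₀ hop₃ᵗ (v₁ ∷ v₀ ∷ v₂ ∷ []))

  opaque
    passᵗ : Tm 0 1 bool
    passᵗ = ((digit 0 v₀ ⊲ bd n) and (digit 1 v₀ ⊲ bd n)) and
      not (inp (⌜ 1 ⌝) ⊲ tally n (call₀ candidateᵗ (v₁ ∷ v₀ ∷ []))) and
      not (tally n (call₀ redᵗ (v₀ ∷ []) and call₀ coversᵗ (v₁ ∷ v₀ ∷ [])) ⊲ inp (⌜ 2 ⌝)) and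
      not (tally n (not (call₀ redᵗ (v₀ ∷ [])) and call₀ coversᵗ (v₁ ∷ v₀ ∷ [])) ⊲ inp (⌜ 3 ⌝))

  smallerᵗ : Tm 0 2 bool
  smallerᵗ = inp₂ (num v₀) (den v₁) ⊲ inp₂ (num v₁) (den v₀)
    where
    num den : Tm 0 2 nat → Tm 0 2 nat
    num g = numᵗ (digit 0 g) (digit 1 g)
    den g = denᵗ (digit 0 g) (digit 1 g)

  -- Twelve digits to base `n + 1`, and above them a number of rounds up to the value of `Tᵇ`.
  Gᵇ : Bd
  Gᵇ = grow 12
    where
    grow : ℕ → Bd
    grow zero    = Tᵇ ⊞ # 1
    grow (suc i) = grow i ⊠ Mᵇ

  opaque
    bestᵗ : Tm 0 1 bool
    bestᵗ = call₀ passᵗ (v₀ ∷ []) and not (some Gᵇ (call₀ passᵗ (v₀ ∷ []) and call₀ smallerᵗ (v₀ ∷ v₁ ∷ [])))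

  -- A search in the form of a count; `first-satisfies` shows that the count is the index sought.
  first : Bd → Tm a 1 bool → Tm a k nat
  first B t = tally B (not (some B (call t (λ i → i) (v₀ ∷ []) and not (v₁ ⊲ v₀))))

  opaque
    outputᵗ : Tm 0 1 bool
    outputᵗ = call₀ candidateᵗ (first Gᵇ bestᵗ ∷ v₀ ∷ [])

  module Denotation (input : ℕ → ℕ) where
    open Semantics input

    n₀ : ℕ
    n₀ = input 0

    dig : ℕ → ℕ → ℕ
    dig i g = rem (1 + n₀) (shift i g)
      where
      shift : ℕ → ℕ → ℕ
      shift zero    g = g
      shift (suc i) g = quot (1 + n₀) (shift i g)

    position : ℕ → ℕ → ℕ
    position i j = 4 + n₀ + (i * n₀ + j) * 2

    adj : ℕ → ℕ → ℕ → ℕ → Bool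
    adj e f i j = (i <ᵇ n₀) & (j <ᵇ n₀) &
      ∼ (input (position e f) * input (1 + position i j) <ᵇ input (position i j) * input (1 + position e f))

    red : ℕ → Bool
    red p = 0 <ᵇ input (4 + p)

    open Graph n₀

    rounds : ℕ → ℕ
    rounds g = quot (1 + n₀) (quot (1 + n₀) (quot (1 + n₀) (quot (1 + n₀) (quot (1 + n₀) (quot (1 + n₀)
      (quot (1 + n₀) (quot (1 + n₀) (quot (1 + n₀) (quot (1 + n₀) (quot (1 + n₀) (quot (1 + n₀) g)))))))))))

    opaque
      cand : ℕ → ℕ → Bool
      cand g = candidate (adj (dig 0 g) (dig 1 g)) red (dig 2 g) (dig 3 g) (dig 4 g) (dig 5 g) (dig 6 g)
        (dig 7 g) (dig 8 g) (rounds g) (dig 9 g) (dig 10 g) (dig 11 g)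

    opaque
      unfolding candidateᵗ cand

      denotes-cand : ∀ α g p → ⟦ candidateᵗ ⟧ α (g ▹ p ▹ ∅) ≡ cand g p
      denotes-cand α g p = refl

    opaque
      unfolding cand

      cand≡ : ∀ g → cand g ≡ candidate (adj (dig 0 g) (dig 1 g)) red (dig 2 g) (dig 3 g) (dig 4 g) (dig 5 g) (dig 6 g)
                               (dig 7 g) (dig 8 g) (rounds g) (dig 9 g) (dig 10 g) (dig 11 g)
      cand≡ g = refl

-- What the terms compute

module Denotations (input : ℕ → ℕ) where
  open import Data.Fin.Base using (Fin)
  open Sums
  open SumLemmas
  open Language
  open Semantics input
  open Algorithm
  open Implementation
  open Denotation input
  open Graph n₀ using (solves; candidate)

  smaller : ℕ → ℕ → Bool
  smaller g h = input (position (dig 0 g) (dig 1 g)) * input (1 + position (dig 0 h) (dig 1 h)) <ᵇ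
                input (position (dig 0 h) (dig 1 h)) * input (1 + position (dig 0 g) (dig 1 g))

  solves-with : (E : ℕ → ℕ → Bool) (q₀ q₁ q₂ q₃ τ rₛ bₛ T κ a β : ℕ) → Bool
  solves-with E q₀ q₁ q₂ q₃ τ rₛ bₛ T κ a β =
    solves E red (input 1) (input 2) (input 3) (candidate E red q₀ q₁ q₂ q₃ τ rₛ bₛ T κ a β)

  opaque
    passes : ℕ → Bool
    passes g = ((dig 0 g <ᵇ n₀) & (dig 1 g <ᵇ n₀)) &
      solves (adj (dig 0 g) (dig 1 g)) red (input 1) (input 2) (input 3) (cand g)

    -- The digits are separate arguments, so that replacing them by equal numbers is a mere
    -- congruence and unfolds no candidate.
    passes-with : (e f q₀ q₁ q₂ q₃ τ rₛ bₛ T κ a β : ℕ) → Bool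
    passes-with e f q₀ q₁ q₂ q₃ τ rₛ bₛ T κ a β =
      ((e <ᵇ n₀) & (f <ᵇ n₀)) & solves-with (adj e f) q₀ q₁ q₂ q₃ τ rₛ bₛ T κ a β

    passes≡ : ∀ g → passes g ≡ passes-with (dig 0 g) (dig 1 g) (dig 2 g) (dig 3 g) (dig 4 g) (dig 5 g) (dig 6 g)
                                 (dig 7 g) (dig 8 g) (rounds g) (dig 9 g) (dig 10 g) (dig 11 g)
    passes≡ g = cong (λ C → ((dig 0 g <ᵇ n₀) & (dig 1 g <ᵇ n₀)) & solves (adj (dig 0 g) (dig 1 g)) red (input 1) (input 2) (input 3) C) (cand≡ g)

    passes-with-intro : ∀ {E e f q₀ q₁ q₂ q₃ τ rₛ bₛ T κ a β} → E ≡ adj e f → e < n₀ → f < n₀ →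
      solves-with E q₀ q₁ q₂ q₃ τ rₛ bₛ T κ a β ≡ true → passes-with e f q₀ q₁ q₂ q₃ τ rₛ bₛ T κ a β ≡ true
    passes-with-intro {E} {e} {f} {q₀} {q₁} {q₂} {q₃} {τ} {rₛ} {bₛ} {T} {κ} {a} {β} refl e< f< w =
      &-intro {(e <ᵇ n₀) & (f <ᵇ n₀)} {solves-with E q₀ q₁ q₂ q₃ τ rₛ bₛ T κ a β} (&-intro (<ᵇ-true e<) (<ᵇ-true f<)) w

    passes-elim : ∀ {g} → passes g ≡ true → dig 0 g < n₀ × dig 1 g < n₀ ×
      solves (adj (dig 0 g) (dig 1 g)) red (input 1) (input 2) (input 3) (cand g) ≡ true
    passes-elim {g} p = true-<ᵇ (&-fst (dig 0 g <ᵇ n₀) guard) , true-<ᵇ (&-snd (dig 0 g <ᵇ n₀) guard) ,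
        &-snd ((dig 0 g <ᵇ n₀) & (dig 1 g <ᵇ n₀)) p
      where
      guard : ((dig 0 g <ᵇ n₀) & (dig 1 g <ᵇ n₀)) ≡ true
      guard = &-fst ((dig 0 g <ᵇ n₀) & (dig 1 g <ᵇ n₀)) p

  G : ℕ
  G = ⟦ Gᵇ ⟧ˢ

  best : ℕ → Bool
  best g = passes g & ∼ any G (λ h → passes h & smaller h g)

  winner : ℕ
  winner = ∑ G λ g → 𝟙 (∼ any G (λ h → best h & ∼ (g <ᵇ h)))

  any-cong : ∀ n {P Q : ℕ → Bool} → (∀ i → P i ≡ Q i) → any n P ≡ any n Q
  any-cong n P≗Q = cong (0 <ᵇ_) (count-cong n λ i _ → P≗Q i)

  denotes-covers : ∀ α g p → ⟦ coversᵗ ⟧ α (g ▹ p ▹ ∅) ≡ Graph.covers n₀ (adj (dig 0 g) (dig 1 g)) (cand g) p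
  denotes-covers α g p = any-cong n₀ λ c → cong (_& Graph.hop₃ n₀ (adj (dig 0 g) (dig 1 g)) c p) (denotes-cand (α ∘ ∅) g c)

  opaque
    unfolding passᵗ passes

    denotes-passes : ∀ α g → ⟦ passᵗ ⟧ α (g ▹ ∅) ≡ passes g
    denotes-passes α g = cong (((dig 0 g <ᵇ n₀) & (dig 1 g <ᵇ n₀)) &_) (cong₂ _&_
      (cong (λ x → ∼ (input 1 <ᵇ x)) (count-cong n₀ λ p _ → denotes-cand (α ∘ ∅) g p))
      (cong₂ _&_
        (cong (λ x → ∼ (x <ᵇ input 2)) (count-cong n₀ λ p _ → cong (red p &_) (denotes-covers (α ∘ ∅) g p)))
        (cong (λ x → ∼ (x <ᵇ input 3)) (count-cong n₀ λ p _ → cong (∼ red p &_) (denotes-covers (α ∘ ∅) g p)))))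

  opaque
    unfolding bestᵗ

    denotes-best : ∀ α g → ⟦ bestᵗ ⟧ α (g ▹ ∅) ≡ best g
    denotes-best α g = cong₂ _&_ (denotes-passes (α ∘ ∅) g)
      (cong (λ b → ∼ b) (any-cong G λ h → cong (_& smaller h g) (denotes-passes (α ∘ ∅) h)))

  denotes-winner : ∀ α (ρ : Fin 1 → ℕ) → ⟦ first {0} {1} Gᵇ bestᵗ ⟧ α ρ ≡ winner
  denotes-winner α ρ = ∑-cong G {λ g → 𝟙 (∼ any G (λ h → ⟦ bestᵗ ⟧ (α ∘ (λ i → i)) (h ▹ ∅) & ∼ (g <ᵇ h)))}
    {λ g → 𝟙 (∼ any G (λ h → best h & ∼ (g <ᵇ h)))} λ g _ → cong (λ b → 𝟙 (∼ b))
      (any-cong G {λ h → ⟦ bestᵗ ⟧ (α ∘ (λ i → i)) (h ▹ ∅) & ∼ (g <ᵇ h)} {λ h → best h & ∼ (g <ᵇ h)}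
        λ h → cong (_& ∼ (g <ᵇ h)) (denotes-best (α ∘ (λ i → i)) h))

  opaque
    unfolding outputᵗ

    denotes-output : ∀ α p → ⟦ outputᵗ ⟧ α (p ▹ ∅) ≡ cand winner p
    denotes-output α p = trans (denotes-cand (α ∘ ∅) (⟦ first {0} {1} Gᵇ bestᵗ ⟧ α (p ▹ ∅)) p)
      (cong (λ w → cand w p) (denotes-winner α (p ▹ ∅)))

-- Rationals, subsets and the encoding of instances

module Rationals where
  open import Data.Integer.Base as ℤ using (+_)
  import Data.Integer.Properties as ℤ
  open import Data.Rational.Base as ℚ using (ℚ; 0ℚ; 1ℚ; ↥_; ↧_; ↧ₙ_; *≤*)
  import Data.Rational.Properties as ℚ

  -- The input holds absolute values of numerators; for distances, which are nonnegative, this loses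
  -- nothing.
  0≤⇒numerator : ∀ {p} → 0ℚ ℚ.≤ p → + ℤ.∣ ↥ p ∣ ≡ ↥ p
  0≤⇒numerator {ℚ.mkℚ (+ _) _ _} _ = refl
  0≤⇒numerator {p@(ℚ.mkℚ (ℤ.-[1+ _ ]) _ _)} 0≤p with () ← ℚ.nonNegative {p} 0≤p

  cross : ∀ p q → 0ℚ ℚ.≤ p → + (ℤ.∣ ↥ p ∣ * ↧ₙ q) ≡ ↥ p ℤ.* ↧ q
  cross p q 0≤p = trans (ℤ.pos-* ℤ.∣ ↥ p ∣ (↧ₙ q)) (cong (ℤ._* ↧ q) (0≤⇒numerator 0≤p))

  ≤⇒cross≤ : ∀ {p q} → 0ℚ ℚ.≤ p → 0ℚ ℚ.≤ q → p ℚ.≤ q → ℤ.∣ ↥ p ∣ * ↧ₙ q ≤ ℤ.∣ ↥ q ∣ * ↧ₙ p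
  ≤⇒cross≤ {p} {q} 0≤p 0≤q p≤q = ℤ.drop‿+≤+ (subst₂ ℤ._≤_ (sym (cross p q 0≤p)) (sym (cross q p 0≤q)) (ℚ.drop-*≤* p≤q))

  cross≤⇒≤ : ∀ {p q} → 0ℚ ℚ.≤ p → 0ℚ ℚ.≤ q → ℤ.∣ ↥ p ∣ * ↧ₙ q ≤ ℤ.∣ ↥ q ∣ * ↧ₙ p → p ℚ.≤ q
  cross≤⇒≤ {p} {q} 0≤p 0≤q le = *≤* (subst₂ ℤ._≤_ (cross p q 0≤p) (cross q p 0≤q) (ℤ.+≤+ le))

  triple : ∀ ρ → (+ 3 ℚ./ 1) ℚ.* ρ ≡ ρ ℚ.+ (ρ ℚ.+ ρ)
  triple ρ = trans (ℚ.*-distribʳ-+ ρ 1ℚ (+ 2 ℚ./ 1)) (cong₂ ℚ._+_ (ℚ.*-identityˡ ρ)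
    (trans (ℚ.*-distribʳ-+ ρ 1ℚ 1ℚ) (cong₂ ℚ._+_ (ℚ.*-identityˡ ρ) (ℚ.*-identityˡ ρ))))

module Subsets where
  open import Data.Fin.Base using (Fin; zero; suc; toℕ; fromℕ<)
  open import Data.Fin.Properties using (toℕ-fromℕ<)
  open import Data.Fin.Subset using (Subset; inside; outside; ⋃; ∣_∣; _∈_)
  open import Data.Fin.Subset.Properties using (_∈?_; ∉⊥; x∈p∪q⁻; x∈p∪q⁺)
  open import Data.List.Base using (map; allFin; filter)
  open import Data.List.Membership.Propositional using () renaming (_∈_ to _∈ˡ_)
  open import Data.List.Membership.Propositional.Properties using (∈-filter⁺; ∈-filter⁻; ∈-map⁺; ∈-map⁻; ∈-allFin)
  open import Data.List.Relation.Unary.Any using (here; there)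
  open import Data.Rational.Base as ℚ using ()
  import Data.Rational.Properties as ℚ
  open import Data.Vec.Base as Vec using ([]; _∷_; lookup)
  open import Data.Vec.Properties using (lookup∘tabulate; []=⇒lookup; lookup⇒[]=)
  open Sums
  open SumLemmas

  χ : ∀ {n} → Subset n → ℕ → Bool
  χ []      _       = false
  χ (b ∷ p) zero    = b
  χ (b ∷ p) (suc i) = χ p i

  ∑-head : ∀ n f → ∑ (suc n) f ≡ f 0 + ∑ n (f ∘ suc)
  ∑-head zero    f = sym (+-identityʳ (f 0))
  ∑-head (suc n) f = trans (cong (_+ f (suc n)) (∑-head n f)) (+-assoc (f 0) (∑ n (f ∘ suc)) (f (suc n)))

  card : ∀ {n} (p : Subset n) → ∣ p ∣ ≡ count n (χ p)
  card []                    = refl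
  card {suc n} (inside ∷ p)  = trans (cong suc (card p)) (sym (∑-head n (𝟙 ∘ χ (inside ∷ p))))
  card {suc n} (outside ∷ p) = trans (card p) (sym (∑-head n (𝟙 ∘ χ (outside ∷ p))))

  χ-lookup : ∀ {n} (p : Subset n) i → χ p (toℕ i) ≡ lookup p i
  χ-lookup (b ∷ p) zero    = refl
  χ-lookup (b ∷ p) (suc i) = χ-lookup p i

  χ⇒∈ : ∀ {n} (p : Subset n) {i} → χ p (toℕ i) ≡ true → i ∈ p
  χ⇒∈ p {i} q = lookup⇒[]= i p (trans (sym (χ-lookup p i)) q)

  ∈⇒χ : ∀ {n} {p : Subset n} {i} → i ∈ p → χ p (toℕ i) ≡ true
  ∈⇒χ {p = p} {i} q = trans (χ-lookup p i) ([]=⇒lookup q)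

  ∈-tabulate⁻ : ∀ {n} {f : Fin n → Bool} {i} → i ∈ Vec.tabulate f → f i ≡ true
  ∈-tabulate⁻ {f = f} {i} q = trans (sym (lookup∘tabulate f i)) ([]=⇒lookup q)

  ∈-tabulate⁺ : ∀ {n} {f : Fin n → Bool} {i} → f i ≡ true → i ∈ Vec.tabulate f
  ∈-tabulate⁺ {f = f} {i} q = lookup⇒[]= i _ (trans (lookup∘tabulate f i) q)

  point : ∀ {n} i → i < n → ∃[ x ] toℕ {n} x ≡ i
  point i i<n = fromℕ< i<n , toℕ-fromℕ< i<n

  count-fin : ∀ {n} {P Q : ℕ → Bool} → (∀ (x : Fin n) → P (toℕ x) ≡ true → Q (toℕ x) ≡ true) → count n P ≤ count n Q
  count-fin {n} P⊆Q = count-mono n λ i i<n → at i (point i i<n)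
    where
    at : ∀ i → ∃[ x ] toℕ {n} x ≡ i → _ → _
    at _ (x , refl) = P⊆Q x

  ∈-⋃⁻ : ∀ {n} {x : Fin n} ps → x ∈ ⋃ ps → ∃[ p ] p ∈ˡ ps × x ∈ p
  ∈-⋃⁻ []       q = ⊥-elim (∉⊥ q)
  ∈-⋃⁻ (p ∷ ps) q with x∈p∪q⁻ p (⋃ ps) q
  ... | inj₁ x∈p = p , here refl , x∈p
  ... | inj₂ x∈ps with ∈-⋃⁻ ps x∈ps
  ...   | p′ , p′∈ , x∈ = p′ , there p′∈ , x∈

  ∈-⋃⁺ : ∀ {n} {x : Fin n} {p ps} → p ∈ˡ ps → x ∈ p → x ∈ ⋃ ps
  ∈-⋃⁺ (here refl) x∈p = x∈p∪q⁺ (inj₁ x∈p)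
  ∈-⋃⁺ {p = p} {ps = p′ ∷ _} (there p∈) x∈p = x∈p∪q⁺ {p = p′} (inj₂ (∈-⋃⁺ p∈ x∈p))

  does-true : ∀ {P : Set} (P? : Dec P) → does P? ≡ true → P
  does-true (yes p) _ = p

  module _ (I : Instance) where
    open Instance I

    covered⁻ : ∀ {C ρ x} → x ∈ covered C ρ → ∃[ c ] c ∈ C × d c x ℚ.≤ ρ
    covered⁻ {C} {ρ} {x} q with ∈-⋃⁻ (map (λ c → ball c ρ) (filter (_∈? C) (allFin n))) q
    ... | p , p∈ , x∈p with ∈-map⁻ (λ c → ball c ρ) p∈
    ...   | c , c∈ , refl = c , proj₂ (∈-filter⁻ (_∈? C) {xs = allFin n} c∈) ,
            does-true (d c x ℚ.≤? ρ) (∈-tabulate⁻ {f = λ y → does (d c y ℚ.≤? ρ)} x∈p)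

    covered⁺ : ∀ {C ρ x} c → c ∈ C → d c x ℚ.≤ ρ → x ∈ covered C ρ
    covered⁺ {C} {ρ} {x} c c∈C le = ∈-⋃⁺ (∈-map⁺ (λ c → ball c ρ) (∈-filter⁺ (_∈? C) (∈-allFin c) c∈C))
      (∈-tabulate⁺ {f = λ y → does (d c y ℚ.≤? ρ)} (dec-true (d c x ℚ.≤? ρ) le))

module Encoding where
  open import Data.Fin.Base using (Fin; zero; suc; toℕ)
  open import Data.Fin.Properties using (toℕ<n)
  open import Data.Fin.Subset.Properties using (_∈?_)
  open import Data.Integer.Base as ℤ using ()
  open import Data.List.Base using (_++_; map; concatMap; allFin; tabulate)
  open import Data.List.Properties using (length-++; length-++-≤ˡ; length-map; length-tabulate; map-tabulate)
  open import Data.Rational.Base using (↥_; ↧ₙ_)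
  nth-++ˡ : ∀ xs {ys m} → m < length xs → nth (xs ++ ys) m ≡ nth xs m
  nth-++ˡ (x ∷ xs) {m = zero}  _         = refl
  nth-++ˡ (x ∷ xs) {m = suc m} (s≤s m<)  = nth-++ˡ xs m<

  nth-++ʳ : ∀ xs {ys} m → nth (xs ++ ys) (length xs + m) ≡ nth ys m
  nth-++ʳ []       m = refl
  nth-++ʳ (x ∷ xs) m = nth-++ʳ xs m

  nth-tabulate : ∀ {n} (f : Fin n → ℕ) i → nth (tabulate f) (toℕ i) ≡ f i
  nth-tabulate f zero    = refl
  nth-tabulate f (suc i) = nth-tabulate (f ∘ suc) i

  nth-map : ∀ {n} (f : Fin n → ℕ) ys i → nth (map f (allFin n) ++ ys) (toℕ i) ≡ f i
  nth-map {n} f ys i = trans (cong (λ l → nth (l ++ ys) (toℕ i)) (map-tabulate id f))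
    (trans (nth-++ˡ (tabulate f) (subst (toℕ i <_) (sym (length-tabulate f)) (toℕ<n i))) (nth-tabulate f i))

  nth-after-map : ∀ {n} (f : Fin n → ℕ) ys m → nth (map f (allFin n) ++ ys) (n + m) ≡ nth ys m
  nth-after-map {n} f ys m = trans (cong (λ l → nth (map f (allFin n) ++ ys) (l + m))
    (sym (trans (length-map f (allFin n)) (length-tabulate id)))) (nth-++ʳ (map f (allFin n)) m)

  nth-concatMap : ∀ {A : Set} {n} (g : A → List ℕ) c → (∀ a → length (g a) ≡ c) → (h : Fin n → A) → ∀ i {m} → m < c →
                  nth (concatMap g (tabulate h)) (toℕ i * c + m) ≡ nth (g (h i)) m
  nth-concatMap g c len h zero {m} m<c = nth-++ˡ (g (h zero)) (subst (m <_) (sym (len (h zero))) m<c)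
  nth-concatMap g c len h (suc i) {m} m<c = trans
    (cong (nth (g (h zero) ++ concatMap g (tabulate (h ∘ suc)))) (trans (+-assoc c (toℕ i * c) m) (cong (_+ (toℕ i * c + m)) (sym (len (h zero))))))
    (trans (nth-++ʳ (g (h zero)) (toℕ i * c + m)) (nth-concatMap g c len (h ∘ suc) i m<c))

  length-concatMap : ∀ {A : Set} {n} (g : A → List ℕ) c → (∀ a → length (g a) ≡ c) → (h : Fin n → A) →
                     length (concatMap g (tabulate h)) ≡ n * c
  length-concatMap {n = zero}  g c len h = refl
  length-concatMap {n = suc n} g c len h = trans (length-++ (g (h zero))) (cong₂ _+_ (len (h zero)) (length-concatMap g c len (h ∘ suc)))

  length≤size : ∀ ws → length ws ≤ size ws
  length≤size []       = z≤n
  length≤size (w ∷ ws) = +-mono-≤ (s≤s z≤n) (length≤size ws)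

  1≤size : ∀ I → 1 ≤ size (encode I)
  1≤size I = ≤-trans (s≤s z≤n) (length≤size (encode I))

  n≤size : ∀ I → nth (encode I) 0 ≤ size (encode I)
  n≤size I = ≤-trans (≤-trans (≤-trans (≤-reflexive (sym (trans (length-map _ (allFin n)) (length-tabulate id))))
      (length-++-≤ˡ (map _ (allFin n)))) (m≤n+m _ 4)) (length≤size (encode I))
    where open Instance I

  nth-pairs : ∀ {n} (f g : Fin n → Fin n → ℕ) (i j : Fin n) {m} → m < 2 →
    nth (concatMap (λ i → concatMap (λ j → f i j ∷ g i j ∷ []) (allFin n)) (allFin n)) ((toℕ i * n + toℕ j) * 2 + m) ≡
    nth (f i j ∷ g i j ∷ []) m
  nth-pairs {n} f g i j {m} m<2 = trans
    (cong (nth (concatMap row (allFin n))) (lemma (toℕ i) n (toℕ j) m))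
    (trans (nth-concatMap row (n * 2) (λ i → length-concatMap (λ j → f i j ∷ g i j ∷ []) 2 (λ _ → refl) id) id i inside-row)
      (nth-concatMap (λ j → f i j ∷ g i j ∷ []) 2 (λ _ → refl) id j m<2))
    where
    row : Fin n → List ℕ
    row i = concatMap (λ j → f i j ∷ g i j ∷ []) (allFin n)
    lemma : ∀ i n j m → (i * n + j) * 2 + m ≡ i * (n * 2) + (j * 2 + m)
    lemma = solve-∀
    inside-row : toℕ j * 2 + m < n * 2
    inside-row = ≤-trans (+-monoʳ-< (toℕ j * 2) m<2) (≤-trans (≤-reflexive (+-comm (toℕ j * 2) 2)) (*-monoˡ-≤ 2 (toℕ<n j)))

  module _ (I : Instance) where
    open Instance I

    input : ℕ → ℕ
    input = nth (encode I)

    input-colour : ∀ x → input (4 + toℕ x) ≡ (if does (x ∈? R) then 1 else 0)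
    input-colour x = nth-map _ _ x

    distances : List ℕ
    distances = concatMap (λ i → concatMap (λ j → ℤ.∣ ↥ d i j ∣ ∷ ↧ₙ d i j ∷ []) (allFin n)) (allFin n)

    input-distance : ∀ i j {m} → m < 2 →
      input (4 + (n + ((toℕ i * n + toℕ j) * 2 + m))) ≡ nth (ℤ.∣ ↥ d i j ∣ ∷ ↧ₙ d i j ∷ []) m
    input-distance i j {m} m<2 = trans (nth-after-map {n} _ distances ((toℕ i * n + toℕ j) * 2 + m))
      (nth-pairs (λ i j → ℤ.∣ ↥ d i j ∣) (λ i j → ↧ₙ d i j) i j m<2)

    input-numerator : ∀ i j → input (4 + n + (toℕ i * n + toℕ j) * 2) ≡ ℤ.∣ ↥ d i j ∣
    input-numerator i j = trans (cong (λ z → input (4 + (n + z))) (sym (+-identityʳ ((toℕ i * n + toℕ j) * 2))))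
      (input-distance i j (s≤s z≤n))

    input-denominator : ∀ i j → input (1 + (4 + n + (toℕ i * n + toℕ j) * 2)) ≡ ↧ₙ d i j
    input-denominator i j = trans (cong (λ z → input (4 + z)) (lemma n ((toℕ i * n + toℕ j) * 2)))
      (input-distance i j (s≤s (s≤s z≤n)))
      where
      lemma : ∀ n x → 1 + (n + x) ≡ n + (x + 1)
      lemma = solve-∀

-- The approximation guarantee

module Approximation (I : Instance) where
  open import Data.Fin.Base using (Fin; toℕ; fromℕ<)
  open import Data.Fin.Properties using (toℕ<n; fromℕ<-toℕ)
  open import Data.Fin.Subset using (Subset; _∩_; ∣_∣; _∈_)
  open import Data.Fin.Subset.Properties using (_∈?_; x∈p∩q⁺; x∈p∩q⁻; x∈∁p⇒x∉p; x∉p⇒x∈∁p; anySubset?)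
  open import Data.Integer.Base as ℤ using (+_)
  open import Data.Rational.Base as ℚ using (ℚ; 0ℚ; ↥_; ↧ₙ_)
  import Data.Rational.Properties as ℚ
  open import Data.Vec.Base as Vec using ()
  open import Data.Vec.Properties using (tabulate-cong)
  open import Function.Metric.Rational using (module IsMetric)
  open Instance I
  open Sums
  open SumLemmas
  open Algorithm using (quot; rem; module Graph)
  open Rationals
  open Subsets
  open Encoding
  open Implementation using (module Denotation)
  open Denotation (input I)
  open Denotations (input I)
  open Graph n₀ using (solves)
  open Pairing n
  open IsMetric isMetric using (nonNegative; triangle; ≈⇒0) renaming (sym to d-sym)


  module Radius (e f : Fin n) where

    ρ : ℚ
    ρ = d e f

    edge : ℕ → ℕ → Bool
    edge = adj (toℕ e) (toℕ f)

    test≡ : ∀ i j → (input I (position (toℕ e) (toℕ f)) * input I (1 + position (toℕ i) (toℕ j)) <ᵇ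
                     input I (position (toℕ i) (toℕ j)) * input I (1 + position (toℕ e) (toℕ f))) ≡
                    (ℤ.∣ ↥ ρ ∣ * ↧ₙ d i j <ᵇ ℤ.∣ ↥ d i j ∣ * ↧ₙ ρ)
    test≡ i j = cong₂ _<ᵇ_ (cong₂ _*_ (input-numerator I e f) (input-denominator I i j))
                           (cong₂ _*_ (input-numerator I i j) (input-denominator I e f))

    edge⁺ : ∀ {i j} → d i j ℚ.≤ ρ → edge (toℕ i) (toℕ j) ≡ true
    edge⁺ {i} {j} le = &-intro₃ (<ᵇ-true (toℕ<n i)) (<ᵇ-true (toℕ<n j))
      (∼-intro (trans (test≡ i j) (<ᵇ-false (≤⇒cross≤ nonNegative nonNegative le))))

    edge⁻ : ∀ {i j} → edge (toℕ i) (toℕ j) ≡ true → d i j ℚ.≤ ρ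
    edge⁻ {i} {j} p = cross≤⇒≤ nonNegative nonNegative (false-<ᵇ (trans (sym (test≡ i j))
      (∼-elim (proj₂ (proj₂ (&₃-elim (toℕ i <ᵇ n) (toℕ j <ᵇ n) p))))))

    edge-ends : ∀ i j → edge i j ≡ true → i < n × j < n
    edge-ends i j p with &₃-elim (i <ᵇ n) (j <ᵇ n) p
    ... | i<n , j<n , _ = true-<ᵇ i<n , true-<ᵇ j<n

    edge-range : ∀ i j → edge i j ≡ true → j < n
    edge-range i j p = proj₂ (edge-ends i j p)

    edge-refl : ∀ i → i < n → edge i i ≡ true
    edge-refl i i<n with point i i<n
    ... | x , refl = edge⁺ (subst (ℚ._≤ ρ) (sym (≈⇒0 refl)) nonNegative)

    edge-sym : ∀ i j → edge i j ≡ true → edge j i ≡ true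
    edge-sym i j p with point i (proj₁ (edge-ends i j p)) | point j (proj₂ (edge-ends i j p))
    ... | x , refl | y , refl = edge⁺ (subst (ℚ._≤ ρ) (d-sym x y) (edge⁻ p))

    open GraphLemmas n₀ edge edge-sym edge-refl edge-range using (cov; cov-intro; cov-elim; hop₃-elim)
    open Guessing n₀ edge edge-sym edge-refl edge-range red using (Guess; guess)
    open Graph n₀ edge using (hop₃; covers)

    red≡ : ∀ x → red (toℕ x) ≡ does (x ∈? R)
    red≡ x = trans (cong (0 <ᵇ_) (input-colour I x)) (bit (does (x ∈? R)))
      where
      bit : ∀ b → (0 <ᵇ (if b then 1 else 0)) ≡ b
      bit true  = refl
      bit false = refl

    red⁺ : ∀ {x} → x ∈ R → red (toℕ x) ≡ true
    red⁺ {x} x∈R = trans (red≡ x) (dec-true (x ∈? R) x∈R)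

    red⁻ : ∀ {x} → red (toℕ x) ≡ true → x ∈ R
    red⁻ {x} p = does-true (x ∈? R) (trans (sym (red≡ x)) p)

    blue⁺ : ∀ {x} → x ∈ B → ∼ red (toℕ x) ≡ true
    blue⁺ {x} x∈B = ∼-intro (trans (red≡ x) (dec-false (x ∈? R) (x∈∁p⇒x∉p x∈B)))

    blue⁻ : ∀ {x} → ∼ red (toℕ x) ≡ true → x ∈ B
    blue⁻ {x} p = x∉p⇒x∈∁p λ x∈R → absurd (red⁺ x∈R) (∼-elim p)

    Attempt : Set
    Attempt = Guess (input I 1) (input I 2) (input I 3)

    guess-solution : ∀ {C} → IsSolution ρ C → Attempt
    guess-solution {C} (C≤k , r≤ , b≤) = guess (χ C) (subst (_≤ k) (card C) C≤k)
        (≤-trans r≤ (≤-trans (≤-reflexive (card (covered C ρ ∩ R))) (count-fin {n} {χ (covered C ρ ∩ R)} {λ p → red p & cov (χ C) p} λ x p → let x∈ = x∈p∩q⁻ _ _ (χ⇒∈ (covered C ρ ∩ R) p) in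
          &-intro (red⁺ (proj₂ x∈)) (cov⁺ (proj₁ x∈)))))
        (≤-trans b≤ (≤-trans (≤-reflexive (card (covered C ρ ∩ B))) (count-fin {n} {χ (covered C ρ ∩ B)} {λ p → ∼ red p & cov (χ C) p} λ x p → let x∈ = x∈p∩q⁻ _ _ (χ⇒∈ (covered C ρ ∩ B) p) in
          &-intro (blue⁺ (proj₂ x∈)) (cov⁺ (proj₁ x∈)))))
      where
      cov⁺ : ∀ {x} → x ∈ covered C ρ → cov (χ C) (toℕ x) ≡ true
      cov⁺ q with covered⁻ I {C} q
      ... | c , c∈C , le = cov-intro {χ C} (toℕ c) (∈⇒χ c∈C) (edge⁺ le)

    hop₃-near : ∀ {c x} → hop₃ (toℕ c) (toℕ x) ≡ true → d c x ℚ.≤ ρ ℚ.+ (ρ ℚ.+ ρ)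
    hop₃-near {c} {x} h = path (hop₃-elim {toℕ c} {toℕ x} h)
      where
      path : (∃[ u ] ∃[ v ] edge (toℕ c) u ≡ true × edge u v ≡ true × edge v (toℕ x) ≡ true) → d c x ℚ.≤ ρ ℚ.+ (ρ ℚ.+ ρ)
      path (u , v , cu , uv , vx) = along (point u (edge-range (toℕ c) u cu)) (point v (edge-range u v uv))
        where
        along : (∃[ y ] toℕ {n} y ≡ u) → (∃[ z ] toℕ {n} z ≡ v) → d c x ℚ.≤ ρ ℚ.+ (ρ ℚ.+ ρ)
        along (y , y≡u) (z , z≡v) = ℚ.≤-trans (triangle c y x) (ℚ.+-mono-≤ (edge⁻ (subst (λ u → edge (toℕ c) u ≡ true) (sym y≡u) cu))
          (ℚ.≤-trans (triangle y z x) (ℚ.+-mono-≤ (edge⁻ (subst₂ (λ u v → edge u v ≡ true) (sym y≡u) (sym z≡v) uv))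
            (edge⁻ (subst (λ v → edge v (toℕ x) ≡ true) (sym z≡v) vx)))))

    points : (ℕ → Bool) → Subset n
    points P = Vec.tabulate (P ∘ toℕ)

    -- Only the final check enters, not the way in which `P` was found. Every passing guess is
    -- therefore safe, whatever its digits mean, and the analysis has to provide just one that
    -- passes.
    solves-sound : ∀ {P σ} → solves edge red (input I 1) (input I 2) (input I 3) P ≡ true → ρ ℚ.≤ σ → IsSolution ((+ 3 ℚ./ 1) ℚ.* σ) (points P)
    solves-sound {P} {σ} s ρ≤σ with &₃-elim (∼ (input I 1 <ᵇ count n₀ P)) (∼ (count n₀ (λ p → red p & covers P p) <ᵇ input I 2)) s
    ... | k≥ , r≤ , b≤ =
        ≤-trans (≤-reflexive (card (points P))) (≤-trans (count-fin {n} {χ (points P)} {P} λ x p → ∈-tabulate⁻ (χ⇒∈ (points P) p)) (≮ᵇ-elim k≥))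
      , ≤-trans (≮ᵇ-elim r≤) (≤-trans (count-fin {n} {λ p → red p & covers P p} {χ (covered (points P) 3σ ∩ R)} λ x p → ∈⇒χ (x∈p∩q⁺ (near (&-snd (red (toℕ x)) p) , red⁻ (&-fst (red (toℕ x)) p))))
          (≤-reflexive (sym (card (covered (points P) 3σ ∩ R)))))
      , ≤-trans (≮ᵇ-elim b≤) (≤-trans (count-fin {n} {λ p → ∼ red p & covers P p} {χ (covered (points P) 3σ ∩ B)} λ x p → ∈⇒χ (x∈p∩q⁺ (near (&-snd (∼ red (toℕ x)) p) , blue⁻ (&-fst (∼ red (toℕ x)) p))))
          (≤-reflexive (sym (card (covered (points P) 3σ ∩ B)))))
      where
      3σ = (+ 3 ℚ./ 1) ℚ.* σ
      near : ∀ {x} → covers P (toℕ x) ≡ true → x ∈ covered (points P) 3σ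
      near {x} q with any-elim {n} {λ c → P c & hop₃ c (toℕ x)} q
      ... | i , i<n , q′ with point i i<n
      ...   | c , refl = covered⁺ I c (∈-tabulate⁺ (&-fst (P (toℕ c)) q′))
                (ℚ.≤-trans (hop₃-near (&-snd (P (toℕ c)) q′)) (subst (ρ ℚ.+ (ρ ℚ.+ ρ) ℚ.≤_) (sym (triple σ))
                  (ℚ.+-mono-≤ ρ≤σ (ℚ.+-mono-≤ ρ≤σ ρ≤σ))))

    M : ℕ
    M = 1 + n

    push : ℕ → ℕ → ℕ
    push x y = x * M + y

    congruence : ∀ (h : (e f q₀ q₁ q₂ q₃ τ rₛ bₛ T κ a β : ℕ) → Bool) {e e′ f f′ q₀ q₀′ q₁ q₁′ q₂ q₂′ q₃ q₃′ τ τ′ r r′ b b′ t t′ κ κ′ a a′ β β′} →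
      e ≡ e′ → f ≡ f′ → q₀ ≡ q₀′ → q₁ ≡ q₁′ → q₂ ≡ q₂′ → q₃ ≡ q₃′ → τ ≡ τ′ → r ≡ r′ → b ≡ b′ → t ≡ t′ → κ ≡ κ′ → a ≡ a′ → β ≡ β′ →
      h e f q₀ q₁ q₂ q₃ τ r b t κ a β ≡ h e′ f′ q₀′ q₁′ q₂′ q₃′ τ′ r′ b′ t′ κ′ a′ β′
    congruence h refl refl refl refl refl refl refl refl refl refl refl refl refl = refl

    module _ (guess : Attempt) where
      open Guess guess

      guess-passes : passes-with (toℕ e) (toℕ f) q₀ q₁ q₂ q₃ τ rₛ bₛ T κ a β ≡ true
      guess-passes = passes-with-intro {edge} refl (toℕ<n e) (toℕ<n f) works

      passes-at : ∀ g → dig 0 g ≡ toℕ e → dig 1 g ≡ toℕ f → dig 2 g ≡ q₀ → dig 3 g ≡ q₁ → dig 4 g ≡ q₂ → dig 5 g ≡ q₃ →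
        dig 6 g ≡ τ → dig 7 g ≡ rₛ → dig 8 g ≡ bₛ → rounds g ≡ T → dig 9 g ≡ κ → dig 10 g ≡ a → dig 11 g ≡ β → passes g ≡ true
      passes-at g p₀ p₁ p₂ p₃ p₄ p₅ p₆ p₇ p₈ t p₉ p₁₀ p₁₁ = trans (passes≡ g) (trans
        (congruence passes-with p₀ p₁ p₂ p₃ p₄ p₅ p₆ p₇ p₈ t p₉ p₁₀ p₁₁) guess-passes)

      -- `T` comes first, as the leading part that may exceed the base; the number pushed last,
      -- `toℕ e`, becomes digit 0.
      g₁₁ g₁₀ g₉ g₈ g₇ g₆ g₅ g₄ g₃ g₂ g₁ g₀ : ℕ
      g₁₁ = push T β
      g₁₀ = push g₁₁ a
      g₉  = push g₁₀ κ
      g₈  = push g₉ bₛ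
      g₇  = push g₈ rₛ
      g₆  = push g₇ τ
      g₅  = push g₆ q₃
      g₄  = push g₅ q₂
      g₃  = push g₄ q₁
      g₂  = push g₃ q₀
      g₁  = push g₂ (toℕ f)
      g₀  = push g₁ (toℕ e)

      e≤ = <⇒≤ (toℕ<n e)
      f≤ = <⇒≤ (toℕ<n f)

      number< : g₀ < G
      number< = pair< (pair< (pair< (pair< (pair< (pair< (pair< (pair< (pair< (pair< (pair< (pair<
        (≤-trans (s≤s T≤) (≤-reflexive (+-comm 1 _))) β≤) a≤) κ≤) bₛ≤) rₛ≤) τ≤) q₃≤) q₂≤) q₁≤) q₀≤) f≤) e≤

      s₁ : quot M g₀ ≡ g₁
      s₁ = quot-pair g₁ e≤
      s₂ : quot M (quot M g₀) ≡ g₂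
      s₂ = trans (cong (quot M) s₁) (quot-pair g₂ f≤)
      s₃ : quot M (quot M (quot M g₀)) ≡ g₃
      s₃ = trans (cong (quot M) s₂) (quot-pair g₃ q₀≤)
      s₄ : quot M (quot M (quot M (quot M g₀))) ≡ g₄
      s₄ = trans (cong (quot M) s₃) (quot-pair g₄ q₁≤)
      s₅ : quot M (quot M (quot M (quot M (quot M g₀)))) ≡ g₅
      s₅ = trans (cong (quot M) s₄) (quot-pair g₅ q₂≤)
      s₆ : quot M (quot M (quot M (quot M (quot M (quot M g₀))))) ≡ g₆
      s₆ = trans (cong (quot M) s₅) (quot-pair g₆ q₃≤)
      s₇ : quot M (quot M (quot M (quot M (quot M (quot M (quot M g₀)))))) ≡ g₇
      s₇ = trans (cong (quot M) s₆) (quot-pair g₇ τ≤)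
      s₈ : quot M (quot M (quot M (quot M (quot M (quot M (quot M (quot M g₀))))))) ≡ g₈
      s₈ = trans (cong (quot M) s₇) (quot-pair g₈ rₛ≤)
      s₉ : quot M (quot M (quot M (quot M (quot M (quot M (quot M (quot M (quot M g₀)))))))) ≡ g₉
      s₉ = trans (cong (quot M) s₈) (quot-pair g₉ bₛ≤)
      s₁₀ : quot M (quot M (quot M (quot M (quot M (quot M (quot M (quot M (quot M (quot M g₀))))))))) ≡ g₁₀
      s₁₀ = trans (cong (quot M) s₉) (quot-pair g₁₀ κ≤)
      s₁₁ : quot M (quot M (quot M (quot M (quot M (quot M (quot M (quot M (quot M (quot M (quot M g₀)))))))))) ≡ g₁₁
      s₁₁ = trans (cong (quot M) s₁₀) (quot-pair g₁₁ a≤)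

      dig₀ : dig 0 g₀ ≡ toℕ e
      dig₀ = rem-pair g₁ e≤

      dig₁ : dig 1 g₀ ≡ toℕ f
      dig₁ = trans (cong (rem M) s₁) (rem-pair g₂ f≤)

      number-passes : passes g₀ ≡ true
      number-passes = passes-at g₀ dig₀ dig₁
        (trans (cong (rem M) s₂) (rem-pair g₃ q₀≤)) (trans (cong (rem M) s₃) (rem-pair g₄ q₁≤))
        (trans (cong (rem M) s₄) (rem-pair g₅ q₂≤)) (trans (cong (rem M) s₅) (rem-pair g₆ q₃≤))
        (trans (cong (rem M) s₆) (rem-pair g₇ τ≤)) (trans (cong (rem M) s₇) (rem-pair g₈ rₛ≤))
        (trans (cong (rem M) s₈) (rem-pair g₉ bₛ≤)) (trans (cong (quot M) s₁₁) (quot-pair T β≤))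
        (trans (cong (rem M) s₉) (rem-pair g₁₀ κ≤)) (trans (cong (rem M) s₁₀) (rem-pair g₁₁ a≤))
        (trans (cong (rem M) s₁₁) (rem-pair T β≤))

  dd : ℕ → ℕ → ℚ
  dd i j with i <? n | j <? n
  ... | yes i<n | yes j<n = d (fromℕ< i<n) (fromℕ< j<n)
  ... | yes _   | no _    = 0ℚ
  ... | no _    | _       = 0ℚ

  dd-point : ∀ e f → dd (toℕ e) (toℕ f) ≡ d e f
  dd-point e f with toℕ e <? n | toℕ f <? n
  ... | yes e<n | yes f<n = cong₂ d (fromℕ<-toℕ e e<n) (fromℕ<-toℕ f f<n)
  ... | yes _   | no f≮n  = ⊥-elim (f≮n (toℕ<n f))
  ... | no e≮n  | _       = ⊥-elim (e≮n (toℕ<n e))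

  -- Pairs of points are packed into numbers so that `optimum` applies. The order is left open, as
  -- both the least solvable distance and the greatest distance within a given radius are needed.
  best-pair : ∀ {_≼_ : ℚ → ℚ → Set} → (∀ {x} → x ≼ x) → (∀ {x y z} → x ≼ y → y ≼ z → x ≼ z) → (∀ x y → x ≼ y ⊎ y ≼ x) →
    (Q : ℚ → Bool) → (∀ e f → Q (d e f) ≡ false) ⊎ ∃[ e ] ∃[ f ] Q (d e f) ≡ true × (∀ e′ f′ → Q (d e′ f′) ≡ true → d e f ≼ d e′ f′)
  best-pair {_≼_} rfl trs tot Q = decode (optimum {_≼_ = _≼_} rfl trs tot (n * (1 + n)) P value)
    where
    value : ℕ → ℚ
    value x = dd (quot (1 + n) x) (rem (1 + n) x)
    P : ℕ → Bool
    P x = (quot (1 + n) x <ᵇ n) & (rem (1 + n) x <ᵇ n) & Q (value x)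
    index : Fin n → Fin n → ℕ
    index e f = toℕ e * (1 + n) + toℕ f
    index< : ∀ e f → index e f < n * (1 + n)
    index< e f = pair< (toℕ<n e) (<⇒≤ (toℕ<n f))
    value-index : ∀ e f → value (index e f) ≡ d e f
    value-index e f = trans (cong₂ dd (quot-pair (toℕ e) (<⇒≤ (toℕ<n f))) (rem-pair (toℕ e) (<⇒≤ (toℕ<n f)))) (dd-point e f)
    P-index : ∀ e f → Q (d e f) ≡ true → P (index e f) ≡ true
    P-index e f q = &-intro₃ (<ᵇ-true (subst (_< n) (sym (quot-pair (toℕ e) (<⇒≤ (toℕ<n f)))) (toℕ<n e)))
      (<ᵇ-true (subst (_< n) (sym (rem-pair (toℕ e) (<⇒≤ (toℕ<n f)))) (toℕ<n f))) (trans (cong Q (value-index e f)) q)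
    decode : (∀ x → x < n * (1 + n) → P x ≡ false) ⊎
             (∃[ u ] u < n * (1 + n) × P u ≡ true × (∀ x → x < n * (1 + n) → P x ≡ true → value u ≼ value x)) →
             (∀ e f → Q (d e f) ≡ false) ⊎ ∃[ e ] ∃[ f ] Q (d e f) ≡ true × (∀ e′ f′ → Q (d e′ f′) ≡ true → d e f ≼ d e′ f′)
    decode (inj₁ none) = inj₁ λ e f → false-Q e f (dichotomy (Q (d e f)))
      where
      false-Q : ∀ e f → Q (d e f) ≡ true ⊎ Q (d e f) ≡ false → Q (d e f) ≡ false
      false-Q e f (inj₁ q) = absurd (P-index e f q) (none (index e f) (index< e f))
      false-Q e f (inj₂ q) = q
    decode (inj₂ (u , _ , Pu , opt)) = inj₂ (at (&₃-elim (quot (1 + n) u <ᵇ n) (rem (1 + n) u <ᵇ n) Pu))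
      where
      at : (quot (1 + n) u <ᵇ n) ≡ true × (rem (1 + n) u <ᵇ n) ≡ true × Q (value u) ≡ true →
           ∃[ e ] ∃[ f ] Q (d e f) ≡ true × (∀ e′ f′ → Q (d e′ f′) ≡ true → d e f ≼ d e′ f′)
      at (p , q , Qu) with point (quot (1 + n) u) (true-<ᵇ p) | point (rem (1 + n) u) (true-<ᵇ q)
      ... | e , e≡ | f , f≡ = e , f , subst (λ σ → Q σ ≡ true) value≡ Qu ,
              λ e′ f′ Q′ → subst₂ _≼_ value≡ (value-index e′ f′) (opt (index e′ f′) (index< e′ f′) (P-index e′ f′ Q′))
        where
        value≡ : value u ≡ d e f
        value≡ = trans (cong₂ dd (sym e≡) (sym f≡)) (dd-point e f)

  isSolution? : ∀ ρ C → Dec (IsSolution ρ C)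
  isSolution? ρ C = (∣ C ∣ ≤? k) ×-dec (r ≤? ∣ covered C ρ ∩ R ∣) ×-dec (b ≤? ∣ covered C ρ ∩ B ∣)

  -- All subsets are searched here, but only in the proof that an optimal radius exists.
  solvable? : ∀ ρ → Dec (∃[ C ] IsSolution ρ C)
  solvable? ρ = anySubset? (isSolution? ρ)

  covered-mono : ∀ {C ρ σ} (S : Subset n) → (∀ c x → d c x ℚ.≤ ρ → d c x ℚ.≤ σ) → ∣ covered C ρ ∩ S ∣ ≤ ∣ covered C σ ∩ S ∣
  covered-mono {C} {ρ} {σ} S ρ⇒σ = subst₂ _≤_ (sym (card (covered C ρ ∩ S))) (sym (card (covered C σ ∩ S)))
    (count-fin {n} {χ (covered C ρ ∩ S)} {χ (covered C σ ∩ S)} λ x p → grow x (x∈p∩q⁻ (covered C ρ) S (χ⇒∈ (covered C ρ ∩ S) p)))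
    where
    grow : ∀ x → x ∈ covered C ρ × x ∈ S → χ (covered C σ ∩ S) (toℕ x) ≡ true
    grow x (x∈ , x∈S) with covered⁻ I {C} x∈
    ... | c , c∈C , le = ∈⇒χ (x∈p∩q⁺ (covered⁺ I c c∈C (ρ⇒σ c x le) , x∈S))

  solution-mono : ∀ {C ρ σ} → (∀ c x → d c x ℚ.≤ ρ → d c x ℚ.≤ σ) → IsSolution ρ C → IsSolution σ C
  solution-mono {C} {ρ} {σ} ρ⇒σ (C≤k , r≤ , b≤) =
    C≤k , ≤-trans r≤ (covered-mono {C} {ρ} {σ} R ρ⇒σ) , ≤-trans b≤ (covered-mono {C} {ρ} {σ} B ρ⇒σ)

  -- Rounding a radius down to a distance changes no ball.
  closest : ∀ {ρ C} → 0ℚ ℚ.≤ ρ → IsSolution ρ C → (Fin n → ⊥) ⊎ ∃[ e ] ∃[ f ] d e f ℚ.≤ ρ × IsSolution (d e f) C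
  closest {ρ} {C} 0≤ρ sol with best-pair {λ x y → y ℚ.≤ x} ℚ.≤-refl (λ p q → ℚ.≤-trans q p) (λ x y → ℚ.≤-total y x) (λ σ → does (σ ℚ.≤? ρ))
  ... | inj₁ none = inj₁ λ x → absurd (dec-true (d x x ℚ.≤? ρ) (subst (ℚ._≤ ρ) (sym (≈⇒0 refl)) 0≤ρ)) (none x x)
  ... | inj₂ (e , f , q , max) = inj₂ (e , f , does-true (d e f ℚ.≤? ρ) q ,
          solution-mono {C} {ρ} {d e f} (λ c x le → max c x (dec-true (d c x ℚ.≤? ρ) le)) sol)

  -- By `closest` it suffices to compare the finitely many distances. If there are no points, there
  -- are no distances either; then every nonnegative radius works, and zero is optimal.
  optimal : Feasible → ∃[ ρ* ] IsOptimalRadius ρ* × ((Fin n → ⊥) ⊎ ∃[ e ] ∃[ f ] ρ* ≡ d e f)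
  optimal (ρ , 0≤ρ , C , sol) with best-pair {ℚ._≤_} ℚ.≤-refl ℚ.≤-trans ℚ.≤-total (λ σ → does (solvable? σ))
  ... | inj₂ (e , f , q , min) = d e f , ((nonNegative , does-true (solvable? (d e f)) q) , least-radius) , inj₂ (e , f , refl)
    where
    least-radius : ∀ σ → Achievable σ → d e f ℚ.≤ σ
    least-radius σ (0≤σ , C′ , sol′) with closest 0≤σ sol′
    ... | inj₁ empty = ⊥-elim (empty e)
    ... | inj₂ (e′ , f′ , le , sol″) = ℚ.≤-trans (min e′ f′ (dec-true (solvable? (d e′ f′)) (C′ , sol″))) le
  ... | inj₁ none with closest 0≤ρ sol
  ...   | inj₂ (e , f , le , sol′) = absurd (dec-true (solvable? (d e f)) (C , sol′)) (none e f)
  ...   | inj₁ empty = 0ℚ , ((ℚ.≤-refl , C , solution-mono {C} {ρ} {0ℚ} (λ c _ _ → ⊥-elim (empty c)) sol) , λ σ → proj₁) , inj₁ empty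

  ρ̂ : ℕ → ℚ
  ρ̂ g = dd (dig 0 g) (dig 1 g)

  record Digits (g : ℕ) : Set where
    field
      {e f}    : Fin n
      e≡       : toℕ e ≡ dig 0 g
      f≡       : toℕ f ≡ dig 1 g

    ρ̂≡ : ρ̂ g ≡ d e f
    ρ̂≡ = trans (cong₂ dd (sym e≡) (sym f≡)) (dd-point e f)

  digits : ∀ {g} → passes g ≡ true → Digits g
  digits {g} p = from (point (dig 0 g) (proj₁ (passes-elim p))) (point (dig 1 g) (proj₁ (proj₂ (passes-elim p))))
    where
    from : ∃[ e ] toℕ e ≡ dig 0 g → ∃[ f ] toℕ f ≡ dig 1 g → Digits g
    from (e , e≡) (f , f≡) = record { e≡ = e≡ ; f≡ = f≡ }

  smaller≡ : ∀ {g h} → Digits g → Digits h → smaller g h ≡ (ℤ.∣ ↥ ρ̂ g ∣ * ↧ₙ ρ̂ h <ᵇ ℤ.∣ ↥ ρ̂ h ∣ * ↧ₙ ρ̂ g)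
  smaller≡ {g} {h} G H = comparison (Digits.e≡ G) (Digits.f≡ G) (Digits.e≡ H) (Digits.f≡ H)
    where
    comparison : ∀ {e f e′ f′ i j i′ j′} → toℕ e ≡ i → toℕ f ≡ j → toℕ e′ ≡ i′ → toℕ f′ ≡ j′ →
      (input I (position i j) * input I (1 + position i′ j′) <ᵇ input I (position i′ j′) * input I (1 + position i j)) ≡
      (ℤ.∣ ↥ dd i j ∣ * ↧ₙ dd i′ j′ <ᵇ ℤ.∣ ↥ dd i′ j′ ∣ * ↧ₙ dd i j)
    comparison {e} {f} {e′} {f′} refl refl refl refl = trans (Radius.test≡ e f e′ f′)
      (cong₂ (λ x y → ℤ.∣ ↥ x ∣ * ↧ₙ y <ᵇ ℤ.∣ ↥ y ∣ * ↧ₙ x) (sym (dd-point e f)) (sym (dd-point e′ f′)))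

  0≤ρ̂ : ∀ {g} → Digits g → 0ℚ ℚ.≤ ρ̂ g
  0≤ρ̂ D = subst (0ℚ ℚ.≤_) (sym (Digits.ρ̂≡ D)) nonNegative

  best-exists : ∀ {g} → g < G → passes g ≡ true → ∃[ u ] u < G × best u ≡ true
  best-exists {g} g<G p = from (optimum {_≼_ = ℚ._≤_} ℚ.≤-refl ℚ.≤-trans ℚ.≤-total G passes ρ̂)
    where
    from : (∀ i → i < G → passes i ≡ false) ⊎ (∃[ u ] u < G × passes u ≡ true × (∀ i → i < G → passes i ≡ true → ρ̂ u ℚ.≤ ρ̂ i)) →
           ∃[ u ] u < G × best u ≡ true
    from (inj₁ none) = absurd p (none g g<G)
    from (inj₂ (u , u<G , pu , min)) = u , u<G , &-intro pu (∼-intro (nothing (dichotomy (any G (λ h → passes h & smaller h u)))))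
      where
      nothing : any G (λ h → passes h & smaller h u) ≡ true ⊎ any G (λ h → passes h & smaller h u) ≡ false →
                any G (λ h → passes h & smaller h u) ≡ false
      nothing (inj₂ q) = q
      nothing (inj₁ q) with any-elim {G} {λ h → passes h & smaller h u} q
      ... | h , h<G , r′ = absurd (&-snd (passes h) r′) (trans (smaller≡ (digits ph) (digits pu))
              (<ᵇ-false (≤⇒cross≤ (0≤ρ̂ (digits pu)) (0≤ρ̂ (digits ph)) (min h h<G ph))))
        where ph = &-fst (passes h) r′

  -- The winner has the least radius among the passing guesses. That radius may lie below the
  -- optimum, as covering within three hops is easier, and this only improves the bound.
  winner-passes : ∀ {g} → g < G → passes g ≡ true → passes winner ≡ true × ρ̂ winner ℚ.≤ ρ̂ g
  winner-passes {g} g<G p = pw , cross≤⇒≤ (0≤ρ̂ (digits pw)) (0≤ρ̂ (digits p))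
      (false-<ᵇ (trans (sym (smaller≡ (digits p) (digits pw))) not-smaller))
    where
    best-winner : best winner ≡ true
    best-winner = first-satisfies G best (proj₁ (proj₂ (best-exists g<G p))) (proj₂ (proj₂ (best-exists g<G p)))
    pw : passes winner ≡ true
    pw = &-fst (passes winner) best-winner
    not-smaller : smaller g winner ≡ false
    not-smaller with dichotomy (smaller g winner)
    ... | inj₂ q = q
    ... | inj₁ q = absurd (any-intro {G} {λ h → passes h & smaller h winner} g<G (&-intro p q)) (∼-elim (&-snd (passes winner) best-winner))

  output : Subset n
  output = Vec.tabulate (cand winner ∘ toℕ)

  output-solves : ∀ {σ} → passes winner ≡ true → ρ̂ winner ℚ.≤ σ → IsSolution ((+ 3 ℚ./ 1) ℚ.* σ) output
  output-solves {σ} p le = Radius.solves-sound (Digits.e D) (Digits.f D) {P = cand winner}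
      (subst₂ (λ i j → Graph.solves n₀ (adj i j) red (input I 1) (input I 2) (input I 3) (cand winner) ≡ true)
        (sym (Digits.e≡ D)) (sym (Digits.f≡ D)) (proj₂ (proj₂ (passes-elim p))))
      (subst (ℚ._≤ σ) (Digits.ρ̂≡ D) le)
    where D = digits p

  card-empty : (Fin n → ⊥) → ∀ (S S′ : Subset n) → ∣ S ∣ ≤ ∣ S′ ∣
  card-empty empty S S′ = subst₂ _≤_ (sym (card S)) (sym (card S′)) (count-fin {n} {χ S} {χ S′} λ x → ⊥-elim (empty x))

  -- The guess is an argument, so that it is not evaluated.
  winner-wins : ∀ e f → Radius.Attempt e f → passes winner ≡ true × ρ̂ winner ℚ.≤ d e f
  winner-wins e f g = proj₁ won , ℚ.≤-trans (proj₂ won)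
      (ℚ.≤-reflexive (trans (cong₂ dd (Radius.dig₀ e f g) (Radius.dig₁ e f g)) (dd-point e f)))
    where
    won : passes winner ≡ true × ρ̂ winner ℚ.≤ ρ̂ (Radius.g₀ e f g)
    won = winner-passes (Radius.number< e f g) (Radius.number-passes e f g)

  approximates : Feasible → ∃[ ρ* ] IsOptimalRadius ρ* × IsSolution ((+ 3 ℚ./ 1) ℚ.* ρ*) output
  approximates feasible = from (optimal feasible)
    where
    output-optimal : ∀ e f → passes winner ≡ true × ρ̂ winner ℚ.≤ d e f → IsSolution ((+ 3 ℚ./ 1) ℚ.* d e f) output
    output-optimal e f (p , le) = output-solves {d e f} p le
    from : ∃[ ρ* ] IsOptimalRadius ρ* × ((Fin n → ⊥) ⊎ ∃[ e ] ∃[ f ] ρ* ≡ d e f) →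
           ∃[ ρ* ] IsOptimalRadius ρ* × IsSolution ((+ 3 ℚ./ 1) ℚ.* ρ*) output
    -- Without points all subsets have the same size, so the inequalities of any solution carry over
    -- to the output.
    from (ρ* , opt@((0≤ρ* , C , C≤k , r≤ , b≤) , _) , inj₁ empty) = ρ* , opt ,
      ≤-trans (card-empty empty output C) C≤k ,
      ≤-trans r≤ (card-empty empty (covered C ρ* ∩ R) (covered output ((+ 3 ℚ./ 1) ℚ.* ρ*) ∩ R)) ,
      ≤-trans b≤ (card-empty empty (covered C ρ* ∩ B) (covered output ((+ 3 ℚ./ 1) ℚ.* ρ*) ∩ B))
    from (_ , opt@((_ , C , sol) , _) , inj₂ (e , f , refl)) = d e f , opt ,
      output-optimal e f (winner-wins e f (Radius.guess-solution e f {C} sol))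

  outputs : Outputs (Correctness.main Implementation.outputᵗ) I output
  outputs = from (Correctness.run-main Implementation.outputᵗ (encode I))
    where
    open Correctness using (Run; run; main; mainSteps)
    open Language using (_▹_; ∅)
    from : Run (main Implementation.outputᵗ) (initial (encode I)) (mainSteps Implementation.outputᵗ n₀)
             (λ τ → ∀ i → i < n₀ → τ 1 i ≡ 𝟙 (Language.Semantics.⟦_⟧ (input I) Implementation.outputᵗ ∅ (i ▹ ∅))) →
           Outputs (main Implementation.outputᵗ) I output
    from (run {τ} {t} D _ post) = τ , t , D , tabulate-cong λ x →
      nonzero (τ 1 (toℕ x)) (trans (post (toℕ x) (toℕ<n x)) (cong 𝟙 (denotes-output ∅ (toℕ x))))
      where
      nonzero : ∀ v {c} → v ≡ 𝟙 c → does (¬? (v ≟ 0)) ≡ c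
      nonzero _ {true}  refl = refl
      nonzero _ {false} refl = refl

theorem1 : ∃[ P ] PolynomialTime encode P × IsApproximation 3 P
theorem1 = Correctness.main Implementation.outputᵗ ,
  Correctness.poly-main encode Implementation.outputᵗ Encoding.1≤size Encoding.n≤size ,
  λ I feasible → Approximation.output I , Approximation.outputs I , Approximation.approximates I feasible
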